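{- Assume the following conjecture: there exist constants $A>0$ and $B>0$ such that for all integers $m\ge 2$ and $c$ with $\gcd(c,m)=1$, the smallest prime $p$ with $p\equiv c \pmod m$ satisfies $p\le B\,m(\log m)^A$. Then for every integer $a$ there are infinitely many composite positive integers $n$ such that $p-a\mid n-a$ for each prime $p\mid n$. Moreover, for every integer $a$ there exist a constant $C>0$ and a constant $c_0>0$ such that for all sufficiently large real $X$, the number of $a$-Carmichael numbers $n\le X$ is at least $$c_0\,X^{\frac{C}{(\log\log\log X)^2}}.$$
   Context: For an integer $a$, an $a$-Carmichael number is a composite positive integer $n$ such that $p-a\mid n-a$ for every prime $p\mid n$. (The convention is that $0\mid m$ if and only if $m=0$.) -}

module Defs where

import Algebra.Definitions.RawSemiring
open import Data.Empty using (⊥-elim)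
open import Data.Integer.Base as ℤ using (ℤ; +_)
import Data.Integer.Divisibility as ℤ
import Data.Integer.GCD as ℤ
import Data.Integer.Properties as ℤₚ
open import Data.List.Base using (List; length)
open import Data.List.Relation.Unary.All using (All)
open import Data.List.Relation.Unary.Unique.Propositional using (Unique)
import Data.Nat.Base as ℕ
open import Data.Nat.Base using (ℕ; zero; suc)
import Data.Nat.Coprimality as Coprimality
import Data.Nat.Divisibility as ℕ
import Data.Nat.Properties as ℕₚ
open import Data.Nat.Primality using (Prime; Composite)
open import Data.Product.Base using (∃; _×_; _,_; proj₁; proj₂)
open import Data.Rational.Base
  using (ℚ; mkℚ; 0ℚ; 1ℚ; ½; _+_; _*_; _-_; -_; 1/_; _/_; ∣_∣; _≤_; _<_; _⊓_; *≤*
        ; +-*-rawSemiring; ≢-nonZero; nonNegative; positive)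
open import Data.Rational.Properties
open import Data.Rational.Solver using (module +-*-Solver)
open import Data.Sum.Base using (inj₁; inj₂)
open import Relation.Binary.PropositionalEquality
  using (_≡_; _≢_; refl; sym; trans; cong; cong₂; subst; subst₂)
open import Relation.Nullary using (yes; no)

open Algebra.Definitions.RawSemiring +-*-rawSemiring using (_^_)

private
  variable
    a b : ℚ

natℚ : ℕ → ℚ
natℚ n = + n / 1

1/suc : ℕ → ℚ
1/suc k = + 1 / suc k

-- Takes the junk value 0 at 0.
recip : ℚ → ℚ
recip q with q ≟ 0ℚ
... | yes _  = 0ℚ
... | no q≢0 = (1/ q) {{≢-nonZero q≢0}}

∑< : ℕ → (ℕ → ℚ) → ℚ
∑< zero    f = 0ℚ
∑< (suc n) f = ∑< n f + f n

open +-*-Solver using (solve; _:+_; _:*_; _:-_; :-_; _:=_; con)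

*-mono : ∀ {a b c d} → 0ℚ ≤ a → a ≤ b → 0ℚ ≤ c → c ≤ d → a * c ≤ b * d
*-mono {a} {b} {c} {d} 0≤a a≤b 0≤c c≤d = ≤-trans
  (*-monoˡ-≤-nonNeg a {{nonNegative 0≤a}} c≤d)
  (*-monoʳ-≤-nonNeg d {{nonNegative (≤-trans 0≤c c≤d)}} a≤b)

*-nonNeg : 0ℚ ≤ a → 0ℚ ≤ b → 0ℚ ≤ a * b
*-nonNeg {a} {b} 0≤a 0≤b = subst (_≤ a * b) (*-zeroˡ 0ℚ) (*-mono ≤-refl 0≤a ≤-refl 0≤b)

*-pos : 0ℚ < a → 0ℚ < b → 0ℚ < a * b
*-pos {a} {b} 0<a 0<b =
  subst (_< a * b) (*-zeroʳ a) (*-monoʳ-<-pos a {{positive 0<a}} 0<b)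

+-nonNeg : 0ℚ ≤ a → 0ℚ ≤ b → 0ℚ ≤ a + b
+-nonNeg {a} {b} 0≤a 0≤b = subst (_≤ a + b) (+-identityˡ 0ℚ) (+-mono-≤ 0≤a 0≤b)

0≤1 : 0ℚ ≤ 1ℚ
0≤1 = nonNegative⁻¹ 1ℚ

0<1 : 0ℚ < 1ℚ
0<1 = positive⁻¹ 1ℚ

0≤a⇒b≤b+a : 0ℚ ≤ a → ∀ b → b ≤ b + a
0≤a⇒b≤b+a {a} 0≤a b = subst (_≤ b + a) (+-identityʳ b) (+-monoʳ-≤ b 0≤a)

≤⇒0≤- : a ≤ b → 0ℚ ≤ b - a
≤⇒0≤- {a} {b} a≤b = subst (_≤ b - a) (+-inverseʳ a) (+-monoˡ-≤ (- a) a≤b)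

0≤-⇒≤ : 0ℚ ≤ b - a → a ≤ b
0≤-⇒≤ {b} {a} 0≤ = subst₂ _≤_ (+-identityˡ a)
  (solve 2 (λ x y → (x :- y) :+ y := x) refl b a) (+-monoˡ-≤ a 0≤)

p≤∣p∣ : ∀ p → p ≤ ∣ p ∣
p≤∣p∣ p with ≤-total 0ℚ p
... | inj₁ 0≤p = ≤-reflexive (sym (0≤p⇒∣p∣≡p 0≤p))
... | inj₂ p≤0 = ≤-trans p≤0 (0≤∣p∣ p)

-p≤∣p∣ : ∀ p → - p ≤ ∣ p ∣
-p≤∣p∣ p = subst (- p ≤_) (∣-p∣≡∣p∣ p) (p≤∣p∣ (- p))

∣p∣≤ : ∀ p → p ≤ b → - p ≤ b → ∣ p ∣ ≤ b
∣p∣≤ p p≤b -p≤b with ∣p∣≡p∨∣p∣≡-p p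
... | inj₁ eq = subst (_≤ _) (sym eq) p≤b
... | inj₂ eq = subst (_≤ _) (sym eq) -p≤b

∣-∣-sym : ∀ p q → ∣ p - q ∣ ≡ ∣ q - p ∣
∣-∣-sym p q = trans (sym (∣-p∣≡∣p∣ (p - q)))
  (cong ∣_∣ (solve 2 (λ x y → :- (x :- y) := y :- x) refl p q))

∣-∣-triangle : ∀ p q r → ∣ p - r ∣ ≤ ∣ p - q ∣ + ∣ q - r ∣
∣-∣-triangle p q r = subst (λ t → ∣ t ∣ ≤ ∣ p - q ∣ + ∣ q - r ∣)
  (solve 3 (λ x y z → (x :- y) :+ (y :- z) := x :- z) refl p q r)
  (∣p+q∣≤∣p∣+∣q∣ (p - q) (q - r))

recip-inverse : ∀ q → q ≢ 0ℚ → q * recip q ≡ 1ℚ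
recip-inverse q q≢0 with q ≟ 0ℚ
... | yes q≡0 = ⊥-elim (q≢0 q≡0)
... | no q≢0′ = *-inverseʳ q {{≢-nonZero q≢0′}}

>⇒≢0 : 0ℚ < a → a ≢ 0ℚ
>⇒≢0 0<a a≡0 = <⇒≢ 0<a (sym a≡0)

recip-pos : 0ℚ < a → 0ℚ < recip a
recip-pos {a} 0<a = *-cancelˡ-<-nonNeg a {{nonNegative (<⇒≤ 0<a)}}
  (subst₂ _<_ (sym (*-zeroʳ a)) (sym (recip-inverse a (>⇒≢0 0<a))) 0<1)

natℚ≡mkℚ : ∀ n → natℚ n ≡ mkℚ (+ n) 0 (Coprimality.sym (Coprimality.1-coprimeTo n))
natℚ≡mkℚ n = normalize-coprime (Coprimality.sym (Coprimality.1-coprimeTo n))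

1/suc≡mkℚ : ∀ k → 1/suc k ≡ mkℚ (+ 1) k (Coprimality.1-coprimeTo (suc k))
1/suc≡mkℚ k = normalize-coprime (Coprimality.1-coprimeTo (suc k))

natℚ-suc : ∀ n → natℚ (suc n) ≡ natℚ n + 1ℚ
natℚ-suc n rewrite natℚ≡mkℚ n =
  cong (_/ 1) (trans (cong +_ (ℕₚ.+-comm 1 n)) (cong (ℤ._+ (+ 1)) (sym (ℤₚ.*-identityʳ (+ n)))))

1/suc-inverse : ∀ k → natℚ (suc k) * 1/suc k ≡ 1ℚ
1/suc-inverse k rewrite 1/suc≡mkℚ k | natℚ≡mkℚ (suc k) =
  *-inverseʳ (mkℚ (+ suc k) 0 (Coprimality.sym (Coprimality.1-coprimeTo (suc k))))

natℚ-nonNeg : ∀ n → 0ℚ ≤ natℚ n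
natℚ-nonNeg zero    = ≤-refl
natℚ-nonNeg (suc n) = subst (0ℚ ≤_) (sym (natℚ-suc n)) (+-nonNeg (natℚ-nonNeg n) 0≤1)

1/suc-nonNeg : ∀ k → 0ℚ ≤ 1/suc k
1/suc-nonNeg k = nonNegative⁻¹ (1/suc k) {{normalize-nonNeg 1 (suc k)}}

natℚ-mono : ∀ {m n} → m ℕ.≤ n → natℚ m ≤ natℚ n
natℚ-mono {n = n} ℕ.z≤n       = natℚ-nonNeg n
natℚ-mono {suc m} {suc n} (ℕ.s≤s m≤n) =
  subst₂ _≤_ (sym (natℚ-suc m)) (sym (natℚ-suc n)) (+-monoˡ-≤ 1ℚ (natℚ-mono m≤n))

archimedean : ∀ q → ∃ λ n → q ≤ natℚ n
archimedean q@(mkℚ (+ n) d _) = n , subst (q ≤_) (sym (natℚ≡mkℚ n))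
  (*≤* (subst₂ ℤ._≤_ (ℤₚ.pos-* n 1) (ℤₚ.pos-* n (suc d))
    (ℤ.+≤+ (ℕₚ.*-monoʳ-≤ n (ℕ.s≤s ℕ.z≤n)))))
archimedean q@(mkℚ ℤ.-[1+ n ] d _) = 0 , ≤-trans (<⇒≤ (negative⁻¹ q)) ≤-refl

^-nonNeg : 0ℚ ≤ a → ∀ n → 0ℚ ≤ a ^ n
^-nonNeg 0≤a zero    = 0≤1
^-nonNeg 0≤a (suc n) = *-nonNeg 0≤a (^-nonNeg 0≤a n)

^-abs : ∀ {q r} → ∣ q ∣ ≤ r → ∀ n → ∣ q ^ n ∣ ≤ r ^ n
^-abs             ∣q∣≤r zero    = ≤-refl
^-abs {q} {r} ∣q∣≤r (suc n) = subst (_≤ r * r ^ n) (sym (∣p*q∣≡∣p∣*∣q∣ q (q ^ n)))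
  (*-mono (0≤∣p∣ q) ∣q∣≤r (0≤∣p∣ (q ^ n)) (^-abs ∣q∣≤r n))

module _ {θ h : ℚ} (0≤θ : 0ℚ ≤ θ) (0<h : 0ℚ < h) (θ+h≡1 : θ + h ≡ 1ℚ) where

  θ≤1 : θ ≤ 1ℚ
  θ≤1 = subst (θ ≤_) θ+h≡1 (0≤a⇒b≤b+a (<⇒≤ 0<h) θ)

  ^-step : ∀ n → θ ^ suc n ≤ θ ^ n
  ^-step n = subst (θ * θ ^ n ≤_) (*-identityˡ (θ ^ n))
    (*-mono 0≤θ θ≤1 (^-nonNeg 0≤θ n) ≤-refl)

  ^-antimono′ : ∀ m j → θ ^ (j ℕ.+ m) ≤ θ ^ m
  ^-antimono′ m zero    = ≤-refl
  ^-antimono′ m (suc j) = ≤-trans (^-step (j ℕ.+ m)) (^-antimono′ m j)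

  ^-antimono : ∀ {m n} → m ℕ.≤ n → θ ^ n ≤ θ ^ m
  ^-antimono {m} {n} m≤n =
    subst (λ t → θ ^ t ≤ θ ^ m) (ℕₚ.m∸n+n≡m m≤n) (^-antimono′ m (n ℕ.∸ m))

  ^-bernoulli : ∀ n → θ ^ n * (1ℚ + natℚ n * h) ≤ 1ℚ
  ^-bernoulli zero    = ≤-reflexive
    (solve 1 (λ h → con 1ℚ :* (con 1ℚ :+ con 0ℚ :* h) := con 1ℚ) refl h)
  ^-bernoulli (suc n) = ≤-trans (0≤-⇒≤ (subst (0ℚ ≤_) (sym eq)
    (*-nonNeg (^-nonNeg 0≤θ n)
      (*-nonNeg (+-nonNeg (natℚ-nonNeg n) 0≤1) (*-nonNeg (<⇒≤ 0<h) (<⇒≤ 0<h))))))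
    (^-bernoulli n)
    where
    θ≡ : θ ≡ 1ℚ - h
    θ≡ = trans (solve 2 (λ t h → t := (t :+ h) :- h) refl θ h) (cong (_- h) θ+h≡1)
    eq : θ ^ n * (1ℚ + natℚ n * h) - θ ^ suc n * (1ℚ + natℚ (suc n) * h)
       ≡ θ ^ n * ((natℚ n + 1ℚ) * (h * h))
    eq = trans (cong₂ (λ t s → θ ^ n * (1ℚ + natℚ n * h) - (t * θ ^ n) * (1ℚ + s * h))
           θ≡ (natℚ-suc n))
      (solve 3 (λ p n h → p :* (con 1ℚ :+ n :* h)
          :- ((con 1ℚ :- h) :* p) :* (con 1ℚ :+ (n :+ con 1ℚ) :* h)
        := p :* ((n :+ con 1ℚ) :* (h :* h))) refl (θ ^ n) (natℚ n) h)

  ^-null : ∀ ε → 0ℚ < ε → ∃ λ n → θ ^ n ≤ ε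
  ^-null ε 0<ε = n , *-cancelʳ-≤-pos D {{positive 0<D}} (≤-trans (^-bernoulli n)
      (≤-trans (≤-reflexive (sym one)) (≤-trans (*-mono (<⇒≤ (*-pos 0<h 0<ε)) ≤-refl
        (<⇒≤ (recip-pos (*-pos 0<h 0<ε))) (proj₂ arch))
        (subst₂ _≤_ (solve 3 (λ e n h → e :* (n :* h) := (h :* e) :* n) refl ε (natℚ n) h)
           (solve 3 (λ e n h → e :* (n :* h) :+ e :* con 1ℚ := e :* (con 1ℚ :+ n :* h))
             refl ε (natℚ n) h)
           (0≤a⇒b≤b+a (*-nonNeg (<⇒≤ 0<ε) 0≤1) (ε * (natℚ n * h)))))))
    where
    arch = archimedean (recip (h * ε))
    n    = proj₁ arch
    D    = 1ℚ + natℚ n * h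
    0<D : 0ℚ < D
    0<D = <-≤-trans 0<1 (0≤a⇒b≤b+a (*-nonNeg (natℚ-nonNeg n) (<⇒≤ 0<h)) 1ℚ)
    one : (h * ε) * recip (h * ε) ≡ 1ℚ
    one = recip-inverse (h * ε) (>⇒≢0 (*-pos 0<h 0<ε))

-- Equality of reals is not needed: a real is used only through its limit, via the
-- relations _≤ᴿ_ and _<ᴿ_, which do not depend on the choice of sequence.
Cauchy : (ℕ → ℚ) → Set
Cauchy s = ∀ ε → 0ℚ < ε →
  ∃ λ N → ∀ m n → N ℕ.≤ m → N ℕ.≤ n → ∣ s m - s n ∣ ≤ ε

record ℝ : Set where
  constructor mkℝ
  field
    approx : ℕ → ℚ
    cauchy : Cauchy approx

open ℝ public

infix 4 _≤ᴿ_ _<ᴿ_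

_≤ᴿ_ : ℝ → ℝ → Set
x ≤ᴿ y = ∀ ε → 0ℚ < ε → ∃ λ N → ∀ n → N ℕ.≤ n → approx x n ≤ approx y n + ε

_<ᴿ_ : ℝ → ℝ → Set
x <ᴿ y = ∃ λ ε → 0ℚ < ε × ∃ λ N → ∀ n → N ℕ.≤ n → approx x n + ε ≤ approx y n

bounded : ∀ {s} → Cauchy s → ∃ λ K → 0ℚ < K × ∃ λ N → ∀ n → N ℕ.≤ n → ∣ s n ∣ ≤ K
bounded {s} cs = ∣ s N ∣ + 1ℚ , 0<K , N , λ n N≤n →
    ≤-trans (subst (λ t → ∣ t ∣ ≤ ∣ s N ∣ + ∣ s n - s N ∣)
        (solve 2 (λ x y → x :+ (y :- x) := y) refl (s N) (s n))
        (∣p+q∣≤∣p∣+∣q∣ (s N) (s n - s N)))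
      (+-monoʳ-≤ ∣ s N ∣ (proj₂ (cs 1ℚ 0<1) n N N≤n ℕₚ.≤-refl))
  where
  N = proj₁ (cs 1ℚ 0<1)
  0<K : 0ℚ < ∣ s N ∣ + 1ℚ
  0<K = <-≤-trans 0<1 (subst (1ℚ ≤_) (+-comm 1ℚ ∣ s N ∣) (0≤a⇒b≤b+a (0≤∣p∣ (s N)) 1ℚ))

const-cauchy : ∀ q → Cauchy (λ _ → q)
const-cauchy q ε 0<ε = 0 , λ _ _ _ _ → subst (λ t → ∣ t ∣ ≤ ε) (sym (+-inverseʳ q)) (<⇒≤ 0<ε)

dominated : ∀ s u t → Cauchy s → Cauchy u → ∀ K → 0ℚ < K → ∀ N →
  (∀ m n → N ℕ.≤ m → N ℕ.≤ n → ∣ t m - t n ∣ ≤ K * (∣ s m - s n ∣ + ∣ u m - u n ∣)) →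
  Cauchy t
dominated s u t cs cu K 0<K N bound ε 0<ε =
  N ℕ.⊔ (N₁ ℕ.⊔ N₂) , λ m n Nm Nn →
    let N₁₂ = ℕₚ.m≤n⊔m N (N₁ ℕ.⊔ N₂)
        l   = ℕₚ.≤-trans (ℕₚ.m≤m⊔n N₁ N₂) N₁₂
        r   = ℕₚ.≤-trans (ℕₚ.m≤n⊔m N₁ N₂) N₁₂
        o   = ℕₚ.m≤m⊔n N (N₁ ℕ.⊔ N₂)
    in ≤-trans (bound m n (ℕₚ.≤-trans o Nm) (ℕₚ.≤-trans o Nn))
         (≤-trans (*-monoˡ-≤-nonNeg K {{nonNegative (<⇒≤ 0<K)}}
           (+-mono-≤ (proj₂ (cs δ 0<δ) m n (ℕₚ.≤-trans l Nm) (ℕₚ.≤-trans l Nn))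
                     (proj₂ (cu δ 0<δ) m n (ℕₚ.≤-trans r Nm) (ℕₚ.≤-trans r Nn))))
           (≤-reflexive eq))
  where
  δ = (½ * recip K) * ε
  0<δ : 0ℚ < δ
  0<δ = *-pos (*-pos (positive⁻¹ ½) (recip-pos 0<K)) 0<ε
  N₁ = proj₁ (cs δ 0<δ)
  N₂ = proj₁ (cu δ 0<δ)
  eq : K * (δ + δ) ≡ ε
  eq = trans (solve 3 (λ k r e → k :* ((con ½ :* r) :* e :+ (con ½ :* r) :* e) := (k :* r) :* e)
               refl K (recip K) ε)
         (trans (cong (_* ε) (recip-inverse K (>⇒≢0 0<K))) (*-identityˡ ε))

geometric-cauchy : ∀ {θ h} → 0ℚ ≤ θ → 0ℚ < h → θ + h ≡ 1ℚ → Cauchy (θ ^_)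
geometric-cauchy {θ} 0≤θ 0<h eq ε 0<ε = N , λ m n Nm Nn →
    ∣p∣≤ (θ ^ m - θ ^ n) (half m n Nm)
      (subst (_≤ ε) (solve 2 (λ x y → x :- y := :- (y :- x)) refl (θ ^ n) (θ ^ m)) (half n m Nn))
  where
  N = proj₁ (^-null 0≤θ 0<h eq ε 0<ε)
  half : ∀ m n → N ℕ.≤ m → θ ^ m - θ ^ n ≤ ε
  half m n Nm = ≤-trans
    (subst (θ ^ m - θ ^ n ≤_) (+-identityʳ (θ ^ m))
      (+-monoʳ-≤ (θ ^ m) (neg-antimono-≤ (^-nonNeg 0≤θ n))))
    (≤-trans (^-antimono 0≤θ 0<h eq Nm) (proj₂ (^-null 0≤θ 0<h eq ε 0<ε)))

∑<-minus : ∀ n f g → ∑< n f - ∑< n g ≡ ∑< n (λ k → f k - g k)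
∑<-minus zero    f g = refl
∑<-minus (suc n) f g = trans
  (solve 4 (λ a b c d → (a :+ b) :- (c :+ d) := (a :- c) :+ (b :- d))
    refl (∑< n f) (f n) (∑< n g) (g n))
  (cong (_+ (f n - g n)) (∑<-minus n f g))

-- The diagonal n ↦ ∑_{k<n} T (x n) k converges to ∑_k T (lim x) k when both the
-- terms and their Lipschitz constants in x are dominated by a geometric series.
module Series
  (T : ℚ → ℕ → ℚ) {x : ℕ → ℚ} (cx : Cauchy x)
  {θ h : ℚ} (0≤θ : 0ℚ ≤ θ) (0<h : 0ℚ < h) (θ+h≡1 : θ + h ≡ 1ℚ)
  (M : ℚ) (0≤M : 0ℚ ≤ M) (N : ℕ)
  (size : ∀ n → N ℕ.≤ n → ∀ k → ∣ T (x n) k ∣ ≤ M * θ ^ k)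
  (lip  : ∀ m n → N ℕ.≤ m → N ℕ.≤ n → ∀ k →
          ∣ T (x m) k - T (x n) k ∣ ≤ (M * ∣ x m - x n ∣) * θ ^ k)
  where

  C = recip h

  0≤C : 0ℚ ≤ C
  0≤C = <⇒≤ (recip-pos 0<h)

  drop : ∀ k → θ ^ k ≡ C * (θ ^ k - θ ^ suc k)
  drop k = sym (trans (solve 3 (λ c p t → c :* (p :- t :* p) := ((con 1ℚ :- t) :* c) :* p) refl C (θ ^ k) θ)
    (trans (cong (λ t → (t * C) * θ ^ k)
      (trans (cong (_- θ) (sym θ+h≡1)) (solve 2 (λ t h → (t :+ h) :- t := h) refl θ h)))
    (trans (cong (_* θ ^ k) (recip-inverse h (>⇒≢0 0<h))) (*-identityˡ (θ ^ k)))))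

  tail′ : ∀ f P → (∀ k → ∣ f k ∣ ≤ P * θ ^ k) → ∀ m j →
    ∣ ∑< (j ℕ.+ m) f - ∑< m f ∣ ≤ (P * C) * (θ ^ m - θ ^ (j ℕ.+ m))
  tail′ f P f≤ m zero = subst₂ _≤_ (sym (cong ∣_∣ (+-inverseʳ (∑< m f))))
    (solve 2 (λ a b → con 0ℚ := a :* (b :- b)) refl (P * C) (θ ^ m)) ≤-refl
  tail′ f P f≤ m (suc j) = ≤-trans
    (subst (λ t → ∣ t ∣ ≤ ∣ S - ∑< m f ∣ + ∣ f (j ℕ.+ m) ∣)
      (solve 3 (λ a b c → (a :- b) :+ c := (a :+ c) :- b) refl S (∑< m f) (f (j ℕ.+ m)))
      (∣p+q∣≤∣p∣+∣q∣ (S - ∑< m f) (f (j ℕ.+ m))))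
    (≤-trans (+-mono-≤ (tail′ f P f≤ m j)
        (≤-trans (f≤ (j ℕ.+ m)) (≤-reflexive (cong (P *_) (drop (j ℕ.+ m))))))
      (≤-reflexive (solve 5 (λ p c u v w → (p :* c) :* (u :- v) :+ p :* (c :* (v :- w))
        := (p :* c) :* (u :- w)) refl P C (θ ^ m) (θ ^ (j ℕ.+ m)) (θ ^ suc (j ℕ.+ m)))))
    where S = ∑< (j ℕ.+ m) f

  tail : ∀ f P → (∀ k → ∣ f k ∣ ≤ P * θ ^ k) → ∀ {m n} → m ℕ.≤ n →
    ∣ ∑< n f - ∑< m f ∣ ≤ (P * C) * (θ ^ m - θ ^ n)
  tail f P f≤ {m} {n} m≤n =
    subst (λ t → ∣ ∑< t f - ∑< m f ∣ ≤ (P * C) * (θ ^ m - θ ^ t))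
      (ℕₚ.m∸n+n≡m m≤n) (tail′ f P f≤ m (n ℕ.∸ m))

  total : ∀ f P → 0ℚ ≤ P → (∀ k → ∣ f k ∣ ≤ P * θ ^ k) → ∀ n → ∣ ∑< n f ∣ ≤ P * C
  total f P 0≤P f≤ n = subst (λ t → ∣ t ∣ ≤ P * C)
    (solve 1 (λ a → a :- con 0ℚ := a) refl (∑< n f))
    (≤-trans (tail f P f≤ {0} {n} ℕ.z≤n)
      (0≤-⇒≤ (subst (0ℚ ≤_) (solve 2 (λ a b → a :* b := a :- a :* (con 1ℚ :- b)) refl (P * C) (θ ^ n))
        (*-nonNeg (*-nonNeg 0≤P 0≤C) (^-nonNeg 0≤θ n)))))

  V : ℕ → ℚ
  V n = ∑< n (T (x n))

  K = M * C + 1ℚ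

  0<K : 0ℚ < K
  0<K = <-≤-trans 0<1 (subst (1ℚ ≤_) (+-comm 1ℚ (M * C)) (0≤a⇒b≤b+a (*-nonNeg 0≤M 0≤C) 1ℚ))

  ordered : ∀ m n → N ℕ.≤ m → N ℕ.≤ n → m ℕ.≤ n →
    ∣ V m - V n ∣ ≤ K * (∣ x m - x n ∣ + ∣ θ ^ m - θ ^ n ∣)
  ordered m n Nm Nn m≤n = ≤-trans (∣-∣-triangle (V m) W (V n))
    (≤-trans (+-mono-≤ p₁ p₂)
      (≤-trans (≤-reflexive (solve 4 (λ m c a b → (m :* a) :* c :+ (m :* c) :* b := (m :* c) :* (a :+ b))
          refl M C ∣ x m - x n ∣ (θ ^ m - θ ^ n)))
        (≤-trans (*-monoˡ-≤-nonNeg (M * C) {{nonNegative (*-nonNeg 0≤M 0≤C)}}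
            (+-monoʳ-≤ ∣ x m - x n ∣ (p≤∣p∣ (θ ^ m - θ ^ n))))
          (*-monoʳ-≤-nonNeg Q {{nonNegative 0≤Q}} (0≤a⇒b≤b+a 0≤1 (M * C))))))
    where
    W = ∑< m (T (x n))
    Q = ∣ x m - x n ∣ + ∣ θ ^ m - θ ^ n ∣
    0≤Q : 0ℚ ≤ Q
    0≤Q = +-nonNeg (0≤∣p∣ (x m - x n)) (0≤∣p∣ (θ ^ m - θ ^ n))
    p₁ : ∣ V m - W ∣ ≤ (M * ∣ x m - x n ∣) * C
    p₁ = subst (λ t → ∣ t ∣ ≤ (M * ∣ x m - x n ∣) * C)
      (sym (∑<-minus m (T (x m)) (T (x n))))
      (total (λ k → T (x m) k - T (x n) k) (M * ∣ x m - x n ∣)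
        (*-nonNeg 0≤M (0≤∣p∣ (x m - x n))) (lip m n Nm Nn) m)
    p₂ : ∣ W - V n ∣ ≤ (M * C) * (θ ^ m - θ ^ n)
    p₂ = subst (_≤ (M * C) * (θ ^ m - θ ^ n)) (∣-∣-sym (V n) W)
      (tail (T (x n)) M (size n Nn) m≤n)

  series-cauchy : Cauchy V
  series-cauchy = dominated x (θ ^_) V cx (geometric-cauchy 0≤θ 0<h θ+h≡1) K 0<K N go
    where
    go : ∀ m n → N ℕ.≤ m → N ℕ.≤ n → ∣ V m - V n ∣ ≤ K * (∣ x m - x n ∣ + ∣ θ ^ m - θ ^ n ∣)
    go m n Nm Nn with ℕₚ.≤-total m n
    ... | inj₁ m≤n = ordered m n Nm Nn m≤n
    ... | inj₂ n≤m = subst₂ _≤_ (∣-∣-sym (V n) (V m))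
      (cong (K *_) (cong₂ _+_ (∣-∣-sym (x n) (x m)) (∣-∣-sym (θ ^ n) (θ ^ m))))
      (ordered n m Nn Nm n≤m)

infixl 6 _+ᴿ_ _-ᴿ_
infixl 7 _*ᴿ_

fromℚ : ℚ → ℝ
fromℚ q = mkℝ (λ _ → q) (const-cauchy q)

fromℕ : ℕ → ℝ
fromℕ n = fromℚ (natℚ n)

0ᴿ 1ᴿ : ℝ
0ᴿ = fromℚ 0ℚ
1ᴿ = fromℚ 1ℚ

_+ᴿ_ : ℝ → ℝ → ℝ
x +ᴿ y = mkℝ (λ n → approx x n + approx y n)
  (dominated (approx x) (approx y) (λ n → approx x n + approx y n) (cauchy x) (cauchy y) 1ℚ 0<1 0 λ m n _ _ →
    subst₂ _≤_
      (cong ∣_∣ (solve 4 (λ a b c d → (a :- b) :+ (c :- d) := (a :+ c) :- (b :+ d))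
        refl (approx x m) (approx x n) (approx y m) (approx y n)))
      (sym (*-identityˡ _))
      (∣p+q∣≤∣p∣+∣q∣ (approx x m - approx x n) (approx y m - approx y n)))

_-ᴿ_ : ℝ → ℝ → ℝ
x -ᴿ y = mkℝ (λ n → approx x n - approx y n)
  (dominated (approx x) (approx y) (λ n → approx x n - approx y n) (cauchy x) (cauchy y) 1ℚ 0<1 0 λ m n _ _ →
    subst₂ _≤_
      (cong ∣_∣ (solve 4 (λ a b c d → (a :- b) :- (c :- d) := (a :- c) :- (b :- d))
        refl (approx x m) (approx x n) (approx y m) (approx y n)))
      (sym (*-identityˡ _))
      (∣p-q∣≤∣p∣+∣q∣ (approx x m - approx x n) (approx y m - approx y n)))

_*ᴿ_ : ℝ → ℝ → ℝ
x *ᴿ y = mkℝ (λ n → approx x n * approx y n) (*-cauchy (bounded (cauchy x)) (bounded (cauchy y)))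
  where
  s = approx x
  t = approx y
  *-cauchy : (∃ λ K → 0ℚ < K × ∃ λ N → ∀ n → N ℕ.≤ n → ∣ s n ∣ ≤ K) →
             (∃ λ K → 0ℚ < K × ∃ λ N → ∀ n → N ℕ.≤ n → ∣ t n ∣ ≤ K) →
             Cauchy (λ n → s n * t n)
  *-cauchy (K , 0<K , N , s≤) (L , 0<L , P , t≤) =
    dominated s t (λ n → s n * t n) (cauchy x) (cauchy y) (K + L) (+-mono-< 0<K 0<L) (N ℕ.⊔ P) λ m n mN nN →
      let Δs = ∣ s m - s n ∣
          Δt = ∣ t m - t n ∣
          N≤m = ℕₚ.≤-trans (ℕₚ.m≤m⊔n N P) mN
          P≤n = ℕₚ.≤-trans (ℕₚ.m≤n⊔m N P) nN
      in ≤-trans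
        (subst (λ u → ∣ u ∣ ≤ ∣ s m * (t m - t n) ∣ + ∣ (s m - s n) * t n ∣)
          (solve 4 (λ a b c d → a :* (c :- d) :+ (a :- b) :* d := a :* c :- b :* d)
            refl (s m) (s n) (t m) (t n))
          (∣p+q∣≤∣p∣+∣q∣ (s m * (t m - t n)) ((s m - s n) * t n)))
        (≤-trans (+-mono-≤
            (≤-trans (≤-reflexive (∣p*q∣≡∣p∣*∣q∣ (s m) (t m - t n)))
              (*-mono (0≤∣p∣ (s m)) (s≤ m N≤m) (0≤∣p∣ (t m - t n)) ≤-refl))
            (≤-trans (≤-reflexive (∣p*q∣≡∣p∣*∣q∣ (s m - s n) (t n)))
              (*-mono (0≤∣p∣ (s m - s n)) ≤-refl (0≤∣p∣ (t n)) (t≤ n P≤n))))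
          (subst (K * Δt + Δs * L ≤_)
            (solve 4 (λ k l a b → (k :* b :+ a :* l) :+ (k :* a :+ l :* b) := (k :+ l) :* (a :+ b))
              refl K L Δs Δt)
            (0≤a⇒b≤b+a
              (+-nonNeg (*-nonNeg (<⇒≤ 0<K) (0≤∣p∣ (s m - s n))) (*-nonNeg (<⇒≤ 0<L) (0≤∣p∣ (t m - t n))))
              (K * Δt + Δs * L))))

eventually-≥ : ∀ x → 0ᴿ <ᴿ x → ∃ λ ε → 0ℚ < ε × ∃ λ N → ∀ n → N ℕ.≤ n → ε ≤ approx x n
eventually-≥ x (ε , 0<ε , N , ε≤) = ε , 0<ε , N , λ n N≤n →
  subst (_≤ approx x n) (+-identityˡ ε) (ε≤ n N≤n)

recip-antimono : 0ℚ < a → a ≤ b → recip b ≤ recip a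
recip-antimono {a} {b} 0<a a≤b = *-cancelʳ-≤-pos (a * b) {{positive (*-pos 0<a 0<b)}}
  (subst₂ _≤_
    (sym (trans (solve 3 (λ r a b → r :* (a :* b) := (b :* r) :* a) refl (recip b) a b)
      (trans (cong (_* a) (recip-inverse b (>⇒≢0 0<b))) (*-identityˡ a))))
    (sym (trans (solve 3 (λ r a b → r :* (a :* b) := (a :* r) :* b) refl (recip a) a b)
      (trans (cong (_* b) (recip-inverse a (>⇒≢0 0<a))) (*-identityˡ b))))
    a≤b)
  where
  0<b : 0ℚ < b
  0<b = <-≤-trans 0<a a≤b

recip-diff : a ≢ 0ℚ → b ≢ 0ℚ → recip a - recip b ≡ (recip a * recip b) * (b - a)
recip-diff {a} {b} a≢0 b≢0 = trans
  (cong₂ _-_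
    (sym (trans (cong (recip a *_) (recip-inverse b b≢0)) (*-identityʳ (recip a))))
    (sym (trans (cong (recip b *_) (recip-inverse a a≢0)) (*-identityʳ (recip b)))))
  (solve 4 (λ a b r s → r :* (b :* s) :- s :* (a :* r) := (r :* s) :* (b :- a))
    refl a b (recip a) (recip b))

recipᴿ : (x : ℝ) → 0ᴿ <ᴿ x → ℝ
recipᴿ x 0<x = mkℝ (λ n → recip (s n)) (go (eventually-≥ x 0<x))
  where
  s = approx x
  go : (∃ λ ε → 0ℚ < ε × ∃ λ N → ∀ n → N ℕ.≤ n → ε ≤ s n) → Cauchy (λ n → recip (s n))
  go (ε , 0<ε , N , ε≤) =
    dominated s s (λ n → recip (s n)) (cauchy x) (cauchy x) (r * r) (*-pos 0<r 0<r) N λ m n N≤m N≤n →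
      let 0<m = <-≤-trans 0<ε (ε≤ m N≤m)
          0<n = <-≤-trans 0<ε (ε≤ n N≤n)
          0≤rm = <⇒≤ (recip-pos 0<m)
          0≤rn = <⇒≤ (recip-pos 0<n)
          Δ = ∣ s m - s n ∣
      in ≤-trans
        (≤-reflexive (trans (cong ∣_∣ (recip-diff (>⇒≢0 0<m) (>⇒≢0 0<n)))
          (trans (∣p*q∣≡∣p∣*∣q∣ (recip (s m) * recip (s n)) (s n - s m))
            (cong₂ _*_ (0≤p⇒∣p∣≡p (*-nonNeg 0≤rm 0≤rn)) (∣-∣-sym (s n) (s m))))))
        (*-mono (*-nonNeg 0≤rm 0≤rn)
          (*-mono 0≤rm (recip-antimono 0<ε (ε≤ m N≤m)) 0≤rn (recip-antimono 0<ε (ε≤ n N≤n)))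
          (0≤∣p∣ (s m - s n)) (0≤a⇒b≤b+a (0≤∣p∣ (s m - s n)) Δ))
    where
    r = recip ε
    0<r : 0ℚ < r
    0<r = recip-pos 0<ε

0<*ᴿ : ∀ x y → 0ᴿ <ᴿ x → 0ᴿ <ᴿ y → 0ᴿ <ᴿ x *ᴿ y
0<*ᴿ x y 0<x 0<y with eventually-≥ x 0<x | eventually-≥ y 0<y
... | ε , 0<ε , N , ε≤ | δ , 0<δ , P , δ≤ = ε * δ , *-pos 0<ε 0<δ , N ℕ.⊔ P , λ n n≥ →
  subst (_≤ approx x n * approx y n) (sym (+-identityˡ (ε * δ)))
    (*-mono (<⇒≤ 0<ε) (ε≤ n (ℕₚ.≤-trans (ℕₚ.m≤m⊔n N P) n≥))
            (<⇒≤ 0<δ) (δ≤ n (ℕₚ.≤-trans (ℕₚ.m≤n⊔m N P) n≥)))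

0<+1ᴿ : ∀ x → 0ᴿ <ᴿ x → 0ᴿ <ᴿ x +ᴿ 1ᴿ
0<+1ᴿ x (ε , 0<ε , N , ε≤) = ε , 0<ε , N , λ n N≤n →
  ≤-trans (ε≤ n N≤n) (0≤a⇒b≤b+a 0≤1 (approx x n))

1<⇒0<ᴿ : ∀ x → 1ᴿ <ᴿ x → 0ᴿ <ᴿ x
1<⇒0<ᴿ x (ε , 0<ε , N , ε≤) = ε , 0<ε , N , λ n N≤n →
  ≤-trans (+-monoˡ-≤ ε 0≤1) (ε≤ n N≤n)

1<fromℕ : ∀ {m} → 2 ℕ.≤ m → 1ᴿ <ᴿ fromℕ m
1<fromℕ 2≤m = 1ℚ , 0<1 , 0 , λ _ _ → natℚ-mono 2≤m

infixl 7 _÷ᴿ_[_]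

_÷ᴿ_[_] : ℝ → (y : ℝ) → 0ᴿ <ᴿ y → ℝ
x ÷ᴿ y [ 0<y ] = x *ᴿ recipᴿ y 0<y

-- expTerm q k = q ^ k / k !
expTerm : ℚ → ℕ → ℚ
expTerm q zero    = 1ℚ
expTerm q (suc k) = (expTerm q k * q) * 1/suc k

half^ : ℕ → ℚ
half^ = ½ ^_

expTerm-nonNeg : 0ℚ ≤ a → ∀ k → 0ℚ ≤ expTerm a k
expTerm-nonNeg 0≤a zero    = 0≤1
expTerm-nonNeg 0≤a (suc k) = *-nonNeg (*-nonNeg (expTerm-nonNeg 0≤a k) 0≤a) (1/suc-nonNeg k)

expTerm-abs : ∀ {q R} → ∣ q ∣ ≤ R → ∀ k → ∣ expTerm q k ∣ ≤ expTerm R k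
expTerm-abs ∣q∣≤R zero = ≤-refl
expTerm-abs {q} {R} ∣q∣≤R (suc k) = ≤-trans
  (≤-reflexive (trans (∣p*q∣≡∣p∣*∣q∣ (expTerm q k * q) (1/suc k))
    (cong₂ _*_ (∣p*q∣≡∣p∣*∣q∣ (expTerm q k) q) (0≤p⇒∣p∣≡p (1/suc-nonNeg k)))))
  (*-monoʳ-≤-nonNeg (1/suc k) {{nonNegative (1/suc-nonNeg k)}}
    (*-mono (0≤∣p∣ (expTerm q k)) (expTerm-abs ∣q∣≤R k) (0≤∣p∣ q) ∣q∣≤R))

expLip : ℚ → ℕ → ℚ
expLip R zero    = 0ℚ
expLip R (suc k) = expTerm R k

expLip-* : ∀ R k → expLip R k * R ≡ natℚ k * expTerm R k
expLip-* R zero    = solve 1 (λ r → con 0ℚ :* r := con 0ℚ :* con 1ℚ) refl R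
expLip-* R (suc k) = sym (trans
  (solve 3 (λ n e r → n :* (e :* r) := (n :* r) :* e) refl
    (natℚ (suc k)) (expTerm R k * R) (1/suc k))
  (trans (cong (_* (expTerm R k * R)) (1/suc-inverse k)) (*-identityˡ (expTerm R k * R))))

expTerm-lip : ∀ {p q R} → 0ℚ ≤ R → ∣ p ∣ ≤ R → ∣ q ∣ ≤ R → ∀ k →
  ∣ expTerm p k - expTerm q k ∣ ≤ expLip R k * ∣ p - q ∣
expTerm-lip {p} {q} 0≤R p≤ q≤ zero = ≤-reflexive (sym (*-zeroˡ ∣ p - q ∣))
expTerm-lip {p} {q} {R} 0≤R p≤ q≤ (suc k) = ≤-trans
  (≤-reflexive (trans
    (cong ∣_∣ (solve 5 (λ s t p q r → (s :* p) :* r :- (t :* q) :* r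
      := ((s :- t) :* p :+ t :* (p :- q)) :* r) refl s t p q r))
    (trans (∣p*q∣≡∣p∣*∣q∣ ((s - t) * p + t * (p - q)) r)
      (cong (∣ (s - t) * p + t * (p - q) ∣ *_) (0≤p⇒∣p∣≡p (1/suc-nonNeg k))))))
  (≤-trans (*-monoʳ-≤-nonNeg r {{nonNegative (1/suc-nonNeg k)}}
    (≤-trans (∣p+q∣≤∣p∣+∣q∣ ((s - t) * p) (t * (p - q)))
      (+-mono-≤
        (≤-trans (≤-reflexive (∣p*q∣≡∣p∣*∣q∣ (s - t) p))
          (*-mono (0≤∣p∣ (s - t)) (expTerm-lip 0≤R p≤ q≤ k) (0≤∣p∣ p) p≤))
        (≤-trans (≤-reflexive (∣p*q∣≡∣p∣*∣q∣ t (p - q)))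
          (*-mono (0≤∣p∣ t) (expTerm-abs q≤ k) (0≤∣p∣ (p - q)) ≤-refl)))))
    (≤-reflexive eq))
  where
  s = expTerm p k
  t = expTerm q k
  r = 1/suc k
  d = ∣ p - q ∣
  E = expTerm R k
  eq : ((expLip R k * d) * R + E * d) * r ≡ E * d
  eq = trans (solve 5 (λ f d R E r → ((f :* d) :* R :+ E :* d) :* r
         := ((f :* R) :+ E) :* (d :* r)) refl (expLip R k) d R E r)
    (trans (cong (λ u → (u + E) * (d * r)) (expLip-* R k))
    (trans (solve 4 (λ n E d r → (n :* E :+ E) :* (d :* r) := ((n :+ con 1ℚ) :* r) :* (E :* d))
         refl (natℚ k) E d r)
    (trans (cong (λ u → (u * r) * (E * d)) (sym (natℚ-suc k)))
    (trans (cong (_* (E * d)) (1/suc-inverse k)) (*-identityˡ (E * d))))))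

halving : ∀ (f : ℕ → ℚ) K → (∀ k → 0ℚ ≤ f k) → (∀ k → K ℕ.≤ k → f (suc k) ≤ ½ * f k) →
  ∃ λ M → 0ℚ ≤ M × (∀ k → f k ≤ M * half^ k)
halving f zero 0≤f step = f 0 , 0≤f 0 , bound
  where
  bound : ∀ k → f k ≤ f 0 * half^ k
  bound zero    = ≤-reflexive (sym (*-identityʳ (f 0)))
  bound (suc k) = ≤-trans (step k ℕ.z≤n)
    (≤-trans (*-monoˡ-≤-nonNeg ½ (bound k))
      (≤-reflexive (solve 3 (λ h a b → h :* (a :* b) := a :* (h :* b)) refl ½ (f 0) (half^ k))))
halving f (suc K) 0≤f step with halving (λ k → f (suc k)) K (λ k → 0≤f (suc k))
                                   (λ k K≤k → step (suc k) (ℕ.s≤s K≤k))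
... | M , 0≤M , bound = M′ , +-nonNeg (0≤f 0) (+-nonNeg 0≤M 0≤M) , bound′
  where
  M′ = f 0 + (M + M)
  bound′ : ∀ k → f k ≤ M′ * half^ k
  bound′ zero    = ≤-trans (0≤a⇒b≤b+a (+-nonNeg 0≤M 0≤M) (f 0)) (≤-reflexive (sym (*-identityʳ M′)))
  bound′ (suc k) = ≤-trans (bound k) (subst (M * half^ k ≤_)
    (solve 3 (λ f m h → m :* h :+ f :* (con ½ :* h) := (f :+ (m :+ m)) :* (con ½ :* h))
      refl (f 0) M (half^ k))
    (0≤a⇒b≤b+a (*-nonNeg (0≤f 0) (^-nonNeg (nonNegative⁻¹ ½) (suc k))) (M * half^ k)))

expTerm-halving : ∀ {R} → 0ℚ ≤ R →
  ∃ λ K → ∀ k → K ℕ.≤ k → expTerm R (suc k) ≤ ½ * expTerm R k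
expTerm-halving {R} 0≤R with archimedean (R + R)
... | K , 2R≤K = K , λ k K≤k → ≤-trans
  (subst (_≤ expTerm R k * ((natℚ (suc k) * 1/suc k) * ½))
    (solve 3 (λ e R r → e :* (((R :+ R) :* r) :* con ½) := (e :* R) :* r)
      refl (expTerm R k) R (1/suc k))
    (*-monoˡ-≤-nonNeg (expTerm R k) {{nonNegative (expTerm-nonNeg 0≤R k)}}
      (*-monoʳ-≤-nonNeg ½ (*-monoʳ-≤-nonNeg (1/suc k) {{nonNegative (1/suc-nonNeg k)}}
        (≤-trans 2R≤K (natℚ-mono (ℕₚ.m≤n⇒m≤1+n K≤k)))))))
  (≤-reflexive (trans (cong (λ u → expTerm R k * (u * ½)) (1/suc-inverse k))
    (solve 1 (λ e → e :* (con 1ℚ :* con ½) := con ½ :* e) refl (expTerm R k))))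

module Exp
  {s : ℕ → ℚ} (cs : Cauchy s) {R : ℚ} (0<R : 0ℚ < R)
  {N : ℕ} (s≤ : ∀ n → N ℕ.≤ n → ∣ s n ∣ ≤ R)
  {M : ℚ} (0≤M : 0ℚ ≤ M) (E≤ : ∀ k → expTerm R k ≤ M * half^ k)
  where

  0≤½ : 0ℚ ≤ ½
  0≤½ = nonNegative⁻¹ ½

  0≤M+M : 0ℚ ≤ M + M
  0≤M+M = +-nonNeg 0≤M 0≤M

  size : ∀ n → N ℕ.≤ n → ∀ k → ∣ expTerm (s n) k ∣ ≤ (M + M) * half^ k
  size n N≤n k = ≤-trans (expTerm-abs (s≤ n N≤n) k) (≤-trans (E≤ k)
    (*-monoʳ-≤-nonNeg (half^ k) {{nonNegative (^-nonNeg 0≤½ k)}} (0≤a⇒b≤b+a 0≤M M)))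

  expLip≤ : ∀ k → expLip R k ≤ (M + M) * half^ k
  expLip≤ zero    = *-nonNeg {M + M} {1ℚ} 0≤M+M 0≤1
  expLip≤ (suc k) = ≤-trans (E≤ k) (≤-reflexive
    (solve 2 (λ m h → m :* h := (m :+ m) :* (con ½ :* h)) refl M (half^ k)))

  lip : ∀ m n → N ℕ.≤ m → N ℕ.≤ n → ∀ k →
    ∣ expTerm (s m) k - expTerm (s n) k ∣ ≤ ((M + M) * ∣ s m - s n ∣) * half^ k
  lip m n N≤m N≤n k = ≤-trans (expTerm-lip (<⇒≤ 0<R) (s≤ m N≤m) (s≤ n N≤n) k)
    (≤-trans (*-monoʳ-≤-nonNeg ∣ s m - s n ∣ {{∣-∣-nonNeg (s m - s n)}} (expLip≤ k))
      (≤-reflexive (solve 3 (λ m h d → (m :* h) :* d := (m :* d) :* h)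
        refl (M + M) (half^ k) ∣ s m - s n ∣)))

  exp-cauchy : Cauchy (λ n → ∑< n (expTerm (s n)))
  exp-cauchy = Series.series-cauchy expTerm {s} cs {½} {½} 0≤½ (positive⁻¹ ½) refl
    (M + M) 0≤M+M N size lip

exp : ℝ → ℝ
exp x = mkℝ (λ n → ∑< n (expTerm (approx x n))) (go (bounded (cauchy x)))
  where
  go : (∃ λ R → 0ℚ < R × ∃ λ N → ∀ n → N ℕ.≤ n → ∣ approx x n ∣ ≤ R) →
       Cauchy (λ n → ∑< n (expTerm (approx x n)))
  go (R , 0<R , N , s≤) =
    let K , step      = expTerm-halving (<⇒≤ 0<R)
        M , 0≤M , E≤ = halving (expTerm R) K (expTerm-nonNeg (<⇒≤ 0<R)) step
    in Exp.exp-cauchy (cauchy x) 0<R s≤ 0≤M E≤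

logTerm : ℚ → ℕ → ℚ
logTerm z k = (natℚ 2 * z ^ suc (2 ℕ.* k)) * 1/suc (2 ℕ.* k)

1/suc≤1 : ∀ k → 1/suc k ≤ 1ℚ
1/suc≤1 k = subst (1/suc k ≤_)
  (trans (solve 2 (λ n r → r :+ n :* r := (n :+ con 1ℚ) :* r) refl (natℚ k) (1/suc k))
    (trans (cong (_* 1/suc k) (sym (natℚ-suc k))) (1/suc-inverse k)))
  (0≤a⇒b≤b+a (*-nonNeg (natℚ-nonNeg k) (1/suc-nonNeg k)) (1/suc k))

^-lip : ∀ {z w ρ} → 0ℚ ≤ ρ → ∣ z ∣ ≤ ρ → ∣ w ∣ ≤ ρ → ∀ j →
  ∣ z ^ suc j - w ^ suc j ∣ ≤ (natℚ (suc j) * ρ ^ j) * ∣ z - w ∣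
^-lip {z} {w} 0≤ρ z≤ w≤ zero = ≤-reflexive (trans
  (cong ∣_∣ (solve 2 (λ z w → z :* con 1ℚ :- w :* con 1ℚ := z :- w) refl z w))
  (solve 1 (λ d → d := (con 1ℚ :* con 1ℚ) :* d) refl ∣ z - w ∣))
^-lip {z} {w} {ρ} 0≤ρ z≤ w≤ (suc j) = ≤-trans
  (subst (λ u → ∣ u ∣ ≤ ∣ z * (s - t) ∣ + ∣ (z - w) * t ∣)
    (solve 4 (λ z w s t → z :* (s :- t) :+ (z :- w) :* t := z :* s :- w :* t) refl z w s t)
    (∣p+q∣≤∣p∣+∣q∣ (z * (s - t)) ((z - w) * t)))
  (≤-trans (+-mono-≤
      (≤-trans (≤-reflexive (∣p*q∣≡∣p∣*∣q∣ z (s - t)))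
        (*-mono (0≤∣p∣ z) z≤ (0≤∣p∣ (s - t)) (^-lip 0≤ρ z≤ w≤ j)))
      (≤-trans (≤-reflexive (∣p*q∣≡∣p∣*∣q∣ (z - w) t))
        (*-mono (0≤∣p∣ (z - w)) ≤-refl (0≤∣p∣ t) (^-abs w≤ (suc j)))))
    (≤-reflexive (trans
      (solve 4 (λ ρ n p d → ρ :* ((n :* p) :* d) :+ d :* (ρ :* p)
        := ((n :+ con 1ℚ) :* (ρ :* p)) :* d) refl ρ (natℚ (suc j)) (ρ ^ j) ∣ z - w ∣)
      (cong (λ u → (u * (ρ * ρ ^ j)) * ∣ z - w ∣) (sym (natℚ-suc (suc j)))))))
  where
  s = z ^ suc j
  t = w ^ suc j

0≤2 : 0ℚ ≤ natℚ 2
0≤2 = natℚ-nonNeg 2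

module _ {θ h : ℚ} (0≤θ : 0ℚ ≤ θ) (0<h : 0ℚ < h) (θ+h≡1 : θ + h ≡ 1ℚ) where

  k≤2k : ∀ k → k ℕ.≤ 2 ℕ.* k
  k≤2k k = ℕₚ.m≤m+n k _

  logTerm-abs : ∀ {z} → ∣ z ∣ ≤ θ → ∀ k → ∣ logTerm z k ∣ ≤ natℚ 2 * θ ^ k
  logTerm-abs {z} z≤ k = ≤-trans
    (≤-reflexive (trans (∣p*q∣≡∣p∣*∣q∣ (natℚ 2 * p) r)
      (cong₂ _*_ (∣p*q∣≡∣p∣*∣q∣ (natℚ 2) p) (0≤p⇒∣p∣≡p (1/suc-nonNeg (2 ℕ.* k))))))
    (≤-trans (*-mono (*-nonNeg (0≤∣p∣ (natℚ 2)) (0≤∣p∣ p))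
        (*-monoˡ-≤-nonNeg (natℚ 2)
          (≤-trans (^-abs z≤ (suc (2 ℕ.* k)))
            (^-antimono 0≤θ 0<h θ+h≡1 (ℕₚ.m≤n⇒m≤1+n (k≤2k k)))))
        (1/suc-nonNeg (2 ℕ.* k)) (1/suc≤1 (2 ℕ.* k)))
      (≤-reflexive (*-identityʳ (natℚ 2 * θ ^ k))))
    where
    p = z ^ suc (2 ℕ.* k)
    r = 1/suc (2 ℕ.* k)

  logTerm-lip : ∀ {z w} → ∣ z ∣ ≤ θ → ∣ w ∣ ≤ θ → ∀ k →
    ∣ logTerm z k - logTerm w k ∣ ≤ (natℚ 2 * ∣ z - w ∣) * θ ^ k
  logTerm-lip {z} {w} z≤ w≤ k = ≤-trans
    (≤-reflexive (trans
      (cong ∣_∣ (solve 4 (λ a p q r → (a :* p) :* r :- (a :* q) :* r := (a :* r) :* (p :- q))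
        refl (natℚ 2) p q r))
      (trans (∣p*q∣≡∣p∣*∣q∣ (natℚ 2 * r) (p - q))
        (cong (_* ∣ p - q ∣) (0≤p⇒∣p∣≡p (*-nonNeg 0≤2 0≤r))))))
    (≤-trans (*-monoˡ-≤-nonNeg (natℚ 2 * r) {{nonNegative (*-nonNeg 0≤2 0≤r)}}
        (^-lip 0≤θ z≤ w≤ (2 ℕ.* k)))
      (≤-trans (≤-reflexive (trans
          (solve 5 (λ a r n t d → (a :* r) :* ((n :* t) :* d) := (n :* r) :* ((a :* d) :* t))
            refl (natℚ 2) r (natℚ (suc (2 ℕ.* k))) (θ ^ (2 ℕ.* k)) ∣ z - w ∣)
          (trans (cong (_* ((natℚ 2 * ∣ z - w ∣) * θ ^ (2 ℕ.* k))) (1/suc-inverse (2 ℕ.* k)))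
            (*-identityˡ ((natℚ 2 * ∣ z - w ∣) * θ ^ (2 ℕ.* k))))))
        (*-monoˡ-≤-nonNeg (natℚ 2 * ∣ z - w ∣)
          {{nonNegative (*-nonNeg 0≤2 (0≤∣p∣ (z - w)))}}
          (^-antimono 0≤θ 0<h θ+h≡1 (k≤2k k)))))
    where
    p = z ^ suc (2 ℕ.* k)
    q = w ^ suc (2 ℕ.* k)
    r = 1/suc (2 ℕ.* k)
    0≤r : 0ℚ ≤ r
    0≤r = 1/suc-nonNeg (2 ℕ.* k)

cayley : (x : ℝ) → 0ᴿ <ᴿ x → ℝ
cayley x 0<x = (x -ᴿ 1ᴿ) ÷ᴿ (x +ᴿ 1ᴿ) [ 0<+1ᴿ x 0<x ]

module Cayley {s ε K} (0<ε : 0ℚ < ε) (0<K : 0ℚ < K) (ε≤s : ε ≤ s) (s≤K : s ≤ K) where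

  D = s + 1ℚ

  0<D : 0ℚ < D
  0<D = +-mono-< (<-≤-trans 0<ε ε≤s) 0<1

  h = (ε ⊓ 1ℚ) * recip (K + 1ℚ)

  0<K+1 : 0ℚ < K + 1ℚ
  0<K+1 = +-mono-< 0<K 0<1

  0≤μ : 0ℚ ≤ ε ⊓ 1ℚ
  0≤μ = ⊓-glb (<⇒≤ 0<ε) 0≤1

  hD≤ : h * D ≤ ε ⊓ 1ℚ
  hD≤ = ≤-trans
    (*-monoˡ-≤-nonNeg h {{nonNegative (*-nonNeg 0≤μ (<⇒≤ (recip-pos 0<K+1)))}}
      (+-monoˡ-≤ 1ℚ s≤K))
    (≤-reflexive (trans
      (solve 3 (λ m r k → (m :* r) :* k := m :* (k :* r)) refl (ε ⊓ 1ℚ) (recip (K + 1ℚ)) (K + 1ℚ))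
      (trans (cong ((ε ⊓ 1ℚ) *_) (recip-inverse (K + 1ℚ) (>⇒≢0 0<K+1))) (*-identityʳ (ε ⊓ 1ℚ)))))

  cayley≤ : ∣ (s - 1ℚ) * recip D ∣ ≤ 1ℚ - h
  cayley≤ = *-cancelʳ-≤-pos D {{positive 0<D}} (≤-trans
    (≤-reflexive (trans
      (cong₂ _*_ (trans (∣p*q∣≡∣p∣*∣q∣ (s - 1ℚ) (recip D))
        (cong (∣ s - 1ℚ ∣ *_) (0≤p⇒∣p∣≡p (<⇒≤ (recip-pos 0<D))))) refl)
      (trans (solve 3 (λ a r d → (a :* r) :* d := a :* (d :* r)) refl ∣ s - 1ℚ ∣ (recip D) D)
        (trans (cong (∣ s - 1ℚ ∣ *_) (recip-inverse D (>⇒≢0 0<D))) (*-identityʳ ∣ s - 1ℚ ∣)))))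
    (∣p∣≤ (s - 1ℚ)
      (0≤-⇒≤ (subst (0ℚ ≤_)
        (solve 2 (λ s hd → (con 1ℚ :- hd) :+ con 1ℚ := (s :+ con 1ℚ :- hd) :- (s :- con 1ℚ)) refl s (h * D))
        (+-nonNeg (≤⇒0≤- (≤-trans hD≤ (p⊓q≤q ε 1ℚ))) 0≤1) ▹ dist₁))
      (0≤-⇒≤ (subst (0ℚ ≤_)
        (solve 2 (λ s hd → (s :- hd) :+ s := (s :+ con 1ℚ :- hd) :- (:- (s :- con 1ℚ))) refl s (h * D))
        (+-nonNeg (≤⇒0≤- (≤-trans hD≤ (≤-trans (p⊓q≤p ε 1ℚ) ε≤s))) (<⇒≤ (<-≤-trans 0<ε ε≤s))) ▹ dist₂))))
    where
    _▹_ : ∀ {u v} → 0ℚ ≤ u → u ≡ v → 0ℚ ≤ v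
    0≤u ▹ refl = 0≤u
    dist₁ : (D - h * D) - (s - 1ℚ) ≡ (1ℚ - h) * D - (s - 1ℚ)
    dist₁ = solve 2 (λ s h → (s :+ con 1ℚ :- h :* (s :+ con 1ℚ)) :- (s :- con 1ℚ)
      := (con 1ℚ :- h) :* (s :+ con 1ℚ) :- (s :- con 1ℚ)) refl s h
    dist₂ : (D - h * D) - (- (s - 1ℚ)) ≡ (1ℚ - h) * D - (- (s - 1ℚ))
    dist₂ = solve 2 (λ s h → (s :+ con 1ℚ :- h :* (s :+ con 1ℚ)) :- (:- (s :- con 1ℚ))
      := (con 1ℚ :- h) :* (s :+ con 1ℚ) :- (:- (s :- con 1ℚ))) refl s h

-- log x = 2 artanh ((x - 1) / (x + 1)) = ∑_k 2 z ^ (2k + 1) / (2k + 1)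
-- with z = (x - 1) / (x + 1); since ∣ z ∣ < 1 this is valid for every x > 0.
log : (x : ℝ) → 0ᴿ <ᴿ x → ℝ
log x 0<x = mkℝ (λ n → ∑< n (logTerm (approx (cayley x 0<x) n)))
                (go (eventually-≥ x 0<x) (bounded (cauchy x)))
  where
  s = approx x
  z = approx (cayley x 0<x)
  go : (∃ λ ε → 0ℚ < ε × ∃ λ N → ∀ n → N ℕ.≤ n → ε ≤ s n) →
       (∃ λ K → 0ℚ < K × ∃ λ N → ∀ n → N ℕ.≤ n → ∣ s n ∣ ≤ K) →
       Cauchy (λ n → ∑< n (logTerm (z n)))
  go (ε , 0<ε , N , ε≤) (K , 0<K , P , s≤) =
    Series.series-cauchy logTerm {z} (cauchy (cayley x 0<x)) {θ} {h} 0≤θ 0<h θ+h≡1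
      (natℚ 2) 0≤2 Q
      (λ n Q≤n → logTerm-abs 0≤θ 0<h θ+h≡1 (z≤ n Q≤n))
      (λ m n Q≤m Q≤n → logTerm-lip 0≤θ 0<h θ+h≡1 (z≤ m Q≤m) (z≤ n Q≤n))
    where
    Q = N ℕ.⊔ P
    h = (ε ⊓ 1ℚ) * recip (K + 1ℚ)
    θ = 1ℚ - h
    0<μ : 0ℚ < ε ⊓ 1ℚ
    0<μ with ⊓-sel ε 1ℚ
    ... | inj₁ eq = subst (0ℚ <_) (sym eq) 0<ε
    ... | inj₂ eq = subst (0ℚ <_) (sym eq) 0<1
    0<h : 0ℚ < h
    0<h = *-pos 0<μ (recip-pos (+-mono-< 0<K 0<1))
    θ+h≡1 : θ + h ≡ 1ℚ
    θ+h≡1 = solve 1 (λ h → (con 1ℚ :- h) :+ h := con 1ℚ) refl h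
    z≤ : ∀ n → Q ℕ.≤ n → ∣ z n ∣ ≤ θ
    z≤ n Q≤n = Cayley.cayley≤ 0<ε 0<K
      (ε≤ n (ℕₚ.≤-trans (ℕₚ.m≤m⊔n N P) Q≤n))
      (≤-trans (p≤∣p∣ (s n)) (s≤ n (ℕₚ.≤-trans (ℕₚ.m≤n⊔m N P) Q≤n)))
    0≤θ : 0ℚ ≤ θ
    0≤θ = ≤-trans (0≤∣p∣ (z Q)) (z≤ Q ℕₚ.≤-refl)

log-pos : ∀ x (1<x : 1ᴿ <ᴿ x) → 0ᴿ <ᴿ log x (1<⇒0<ᴿ x 1<x)
log-pos x 1<x@(ε , 0<ε , N , ε≤) = go (bounded (cauchy x))
  where
  s = approx x
  0<x = 1<⇒0<ᴿ x 1<x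
  z = approx (cayley x 0<x)
  go : (∃ λ K → 0ℚ < K × ∃ λ P → ∀ n → P ℕ.≤ n → ∣ s n ∣ ≤ K) → 0ᴿ <ᴿ log x 0<x
  go (K , 0<K , P , s≤) = δ , 0<δ , suc (N ℕ.⊔ P) , λ n n≥ →
      subst (_≤ ∑< n (logTerm (z n))) (sym (+-identityˡ δ)) (≤-trans (z≥ n n≥) (sum≥ n n≥))
    where
    δ = ε * recip (K + 1ℚ)
    0<δ : 0ℚ < δ
    0<δ = *-pos 0<ε (recip-pos (+-mono-< 0<K 0<1))
    z≥ : ∀ n → suc (N ℕ.⊔ P) ℕ.≤ n → δ ≤ z n
    z≥ n n≥ = *-mono (<⇒≤ 0<ε)
        (subst (_≤ s n - 1ℚ) (solve 1 (λ e → (con 1ℚ :+ e) :- con 1ℚ := e) refl ε)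
          (+-monoˡ-≤ (- 1ℚ) 1+ε≤))
        (<⇒≤ (recip-pos (+-mono-< 0<K 0<1)))
        (recip-antimono
          (+-mono-< (<-≤-trans 0<1 (≤-trans (0≤a⇒b≤b+a (<⇒≤ 0<ε) 1ℚ) 1+ε≤)) 0<1)
          (+-monoˡ-≤ 1ℚ (≤-trans (p≤∣p∣ (s n)) (s≤ n (ℕₚ.≤-trans (ℕₚ.m≤n⊔m N P) n≥′)))))
      where
      n≥′ : N ℕ.⊔ P ℕ.≤ n
      n≥′ = ℕₚ.≤-trans (ℕₚ.n≤1+n (N ℕ.⊔ P)) n≥
      1+ε≤ : 1ℚ + ε ≤ s n
      1+ε≤ = ε≤ n (ℕₚ.≤-trans (ℕₚ.m≤m⊔n N P) n≥′)
    first : ∀ w → 0ℚ ≤ w → ∀ j → w ≤ ∑< (suc j) (logTerm w)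
    first w 0≤w zero    = subst (w ≤_)
      (solve 1 (λ w → w :+ w := con 0ℚ :+ (con (natℚ 2) :* (w :* con 1ℚ)) :* con 1ℚ) refl w)
      (0≤a⇒b≤b+a 0≤w w)
    first w 0≤w (suc j) = ≤-trans (first w 0≤w j)
      (0≤a⇒b≤b+a (*-nonNeg (*-nonNeg 0≤2 (^-nonNeg 0≤w (suc (2 ℕ.* suc j))))
        (1/suc-nonNeg (2 ℕ.* suc j))) (∑< (suc j) (logTerm w)))
    sum≥ : ∀ n → suc (N ℕ.⊔ P) ℕ.≤ n → z n ≤ ∑< n (logTerm (z n))
    sum≥ (suc j) n≥ = first (z (suc j)) (≤-trans (<⇒≤ 0<δ) (z≥ (suc j) n≥)) j

rpow : (x : ℝ) → 0ᴿ <ᴿ x → ℝ → ℝ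
rpow x 0<x y = exp (y *ᴿ log x 0<x)

-- The unsigned divisibility on ℤ satisfies  0 ∣ m  iff  m = 0, so p = a is allowed
-- exactly when n = a.
IsCarmichael : ℤ → ℕ → Set
IsCarmichael a n =
  Composite n × (∀ p → Prime p → p ℕ.∣ n → (+ p ℤ.- a) ℤ.∣ (+ n ℤ.- a))

IsLeastPrime≡ : ℤ → ℕ → ℕ → Set
IsLeastPrime≡ c m p =
  Prime p × (+ m) ℤ.∣ (+ p ℤ.- c) ×
  (∀ q → Prime q → (+ m) ℤ.∣ (+ q ℤ.- c) → p ℕ.≤ q)

log-fromℕ : ∀ m → 2 ℕ.≤ m → ℝ
log-fromℕ m 2≤m = log (fromℕ m) (1<⇒0<ᴿ (fromℕ m) (1<fromℕ 2≤m))

log-fromℕ-pos : ∀ m (2≤m : 2 ℕ.≤ m) → 0ᴿ <ᴿ log-fromℕ m 2≤m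
log-fromℕ-pos m 2≤m = log-pos (fromℕ m) (1<fromℕ 2≤m)

LeastPrimeBound : ℝ → ℝ → Set
LeastPrimeBound A B =
  ∀ (m : ℕ) (2≤m : 2 ℕ.≤ m) (c : ℤ) → ℤ.gcd c (+ m) ≡ + 1 →
  ∃ λ p → IsLeastPrime≡ c m p ×
    fromℕ p ≤ᴿ B *ᴿ fromℕ m *ᴿ rpow (log-fromℕ m 2≤m) (log-fromℕ-pos m 2≤m) A

-- #{ n ≤ X : P n } ≥ Y. As  fromℕ n ≤ᴿ X  is undecidable for real X, the count is
-- bounded below by exhibiting that many distinct elements.
CountUpTo≥ : (ℕ → Set) → ℝ → ℝ → Set
CountUpTo≥ P X Y = ∃ λ (ns : List ℕ) →
  Unique ns × All (λ n → P n × fromℕ n ≤ᴿ X) ns × Y ≤ᴿ fromℕ (length ns)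

-- A subset-product construction in the style of Erdős and of Alford, Granville and
-- Pomerance. The assumption supplies, in every reduced class a mod m, a prime p = a + m k
-- with k ≤ (log m) ^ O(1).
--
-- Let M be a product of O(v) distinct primes with log M = O(v ^ 2). By pigeonhole on k′,
-- the divisors d of M give about 2 ^ v primes r = 1 + F d k′ with a common k′. Their
-- product L has 2 ^ v prime factors, while (ℤ/L)ˣ has exponent 2 ^ O(v ^ 2). In the same
-- way the divisors d of L give 2 ^ (c 2 ^ v) primes p = a + d k with a common k, and there
-- is a prime q = a + k L j. If ν is a product of distinct p with ν ≡ 1 mod k L j, then q ν
-- is an a-Carmichael number, because p - a ∣ k L and q - a = k L j ∣ q ν - a.
--
-- Subproducts ≡ 1 come from the pigeonhole principle alone. Suppose h + 1 residues each have
-- m disjoint representations as a product. If the group has at most 2 ^ h elements, then two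
-- different sets of these residues have the same product; after cancelling the common part
-- this product has 2 m disjoint representations. Once an element u has as many of them as the
-- exponent e of the group, their total product is u ^ e = 1. Hence (h + 1) ^ O(log e) = 2 ^ O(v ^ 3) units suffice.
-- Removing subproducts ≡ 1 greedily from each of the g ^ t choices of one prime from each of
-- t sets of size g leaves a negligible rest, so that almost g ^ t products ν ≡ 1 remain;
-- with v of the order of log log log X this is X ^ (C / v ^ 2).

module Submission where

-- The exponent is a ratio of bit counts. With v = ℓ + 3, a prime `p` is at most 2 ^ (1 + `h`),
-- where `h` is of order 2 ^ ℓ ℓ ^ 2, while choosing it among `g` primes gains only 2 ^ (ℓ + 1)
-- bits. The factor ℓ ^ 2 is the length of a single prime `r`, inherited from log M. The pigeonhole
-- principle leaves the cofactors `k` and `j` uncontrolled except in size, and this shapes the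
-- construction. Their part of the unit group is bounded trivially, by k j. Coprimality comes from
-- size: F = 2 ^ κ makes every `r` exceed ∣a∣, `k` and `j`. The primes `r` are divided into two
-- halves with products `L₀` and `L₁`, and the primes `p` are a + L₀ c k with c dividing L₁, so that
-- the fixed factor L₀ makes them exceed every `r`. Size estimates are in powers of two. Constant
-- factors disappear in C, so log and exp are needed only to the right order of magnitude: for long
-- partial sums, doubling the argument adds between ⅓ and 1 to log, and exp m is at most 4 ^ m.

module Arithmetic where

  open import Data.Bool.Base using (Bool; true; false)
  open import Data.Empty using (⊥-elim)
  open import Data.Integer.Base as ℤ using (ℤ; +_; -[1+_])
  import Data.Integer.Divisibility as ℤ
  open import Data.Integer.Divisibility.Signed as ℤ∣ using (∣ᵤ⇒∣; ∣⇒∣ᵤ)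
  import Data.Integer.GCD as ℤ
  import Data.Integer.Properties as ℤₚ
  open import Data.Integer.Tactic.RingSolver using () renaming (solve-∀ to solveℤ)
  open import Data.List.Base
    using (List; []; _∷_; _++_; length; map; filter; take; drop; upTo; applyUpTo; cartesianProductWith; deduplicate)
  open import Data.List.Membership.Propositional using (_∈_; _∉_)
  open import Data.List.Membership.Propositional.Properties
  open import Data.List.Properties
    using (length-++; length-map; length-take; length-drop; length-filter; length-applyUpTo; length-upTo
          ; ++-assoc; ++-identityʳ; take++drop≡id; ∷-injective)
  open import Data.List.Relation.Binary.Disjoint.Propositional using (Disjoint)
  open import Data.List.Relation.Binary.Permutation.Propositional
    using (_↭_; ↭-refl; ↭-reflexive; ↭-sym; ↭-trans; prep)
  open import Data.List.Relation.Binary.Permutation.Propositional.Properties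
    using (∈-resp-↭; shift; ↭-length; ++-comm; ++⁺; ++⁺ˡ; ++⁺ʳ; shifts; All-resp-↭)
  open import Data.List.Relation.Unary.All as All using (All; []; _∷_)
  import Data.List.Relation.Unary.All.Properties as Allₚ
  open import Data.List.Relation.Unary.AllPairs using ([]; _∷_)
  import Data.List.Relation.Unary.AllPairs.Properties as AllPairsₚ
  open import Data.List.Relation.Unary.Any using (here; there)
  open import Data.List.Relation.Unary.Unique.Propositional using (Unique)
  import Data.List.Relation.Unary.Unique.DecPropositional.Properties as UniqueDec
  import Data.List.Relation.Unary.Unique.Propositional.Properties as Uniqueₚ
  open import Data.Nat.Base
  open import Data.Nat.Coprimality as Coprimality
    using (Coprime; coprime?; coprime-divisor; coprime⇒gcd≡1; prime⇒coprime)
  open import Data.Nat.Divisibility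
  open import Data.Nat.DivMod using (m≡m%n+[m/n]*n; m%n<n; m/n*n≤m; m*n/n≡m; m/n≤m; /-monoˡ-≤)
  open import Data.Nat.ListAction using (product)
  open import Data.Nat.ListAction.Properties using (product-↭; product-++; ∈⇒∣product)
  open import Data.Nat.Primality hiding (prime; composite)
  open import Data.Nat.Primality.Factorisation using (factorisationHasAllPrimeFactors)
  open import Data.Nat.Properties
  open import Data.Nat.Tactic.RingSolver using () renaming (solve-∀ to solveℕ)
  open import Data.Product.Base using (∃; ∃₂; _×_; _,_; proj₁; proj₂)
  open import Data.Sum.Base using (_⊎_; inj₁; inj₂)
  open import Data.Vec.Base using (Vec; []; _∷_)
  open import Data.Vec.Properties using (∷-injectiveʳ)
  open import Defs using (IsCarmichael)
  open import Relation.Binary.PropositionalEquality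
  open import Relation.Nullary using (Dec; yes; no; ¬?)

  -- Lists: pigeonhole, divisors, choices and their products.

  private
    variable
      A B : Set

  unique-⊆⇒↭ : {ys xs : List A} → Unique ys → (∀ {x} → x ∈ ys → x ∈ xs) →
    ∃ λ zs → xs ↭ ys ++ zs
  unique-⊆⇒↭ {xs = xs} [] ys⊆xs = xs , ↭-refl
  unique-⊆⇒↭ {ys = y ∷ ys} (y∉ys ∷ uys) ys⊆xs with ∈-∃++ (ys⊆xs (here refl))
  ... | as , bs , refl with unique-⊆⇒↭ uys sub
    where
    sub : ∀ {x} → x ∈ ys → x ∈ as ++ bs
    sub x∈ys with ∈-resp-↭ (shift y as bs) (ys⊆xs (there x∈ys))
    ... | here refl = ⊥-elim (All.lookup y∉ys x∈ys refl)
    ... | there x∈ = x∈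
  ... | zs , rest↭ = zs , ↭-trans (shift y as bs) (prep y rest↭)

  unique-⊆⇒length≤ : {ys xs : List A} → Unique ys → (∀ {x} → x ∈ ys → x ∈ xs) →
    length ys ≤ length xs
  unique-⊆⇒length≤ {ys = ys} {xs} uys ys⊆xs with unique-⊆⇒↭ uys ys⊆xs
  ... | zs , xs↭ = begin
    length ys               ≤⟨ m≤m+n _ _ ⟩
    length ys + length zs   ≡⟨ length-++ ys ⟨
    length (ys ++ zs)       ≡⟨ ↭-length xs↭ ⟨
    length xs               ∎
    where open ≤-Reasoning

  unique-⊆-length⇒↭ : {ys xs : List A} → Unique ys → (∀ {x} → x ∈ ys → x ∈ xs) →
    length xs ≤ length ys → xs ↭ ys
  unique-⊆-length⇒↭ {ys = ys} {xs} uys ys⊆xs len with unique-⊆⇒↭ uys ys⊆xs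
  ... | [] , xs↭ = subst (xs ↭_) (++-identityʳ ys) xs↭
  ... | z ∷ zs , xs↭ = ⊥-elim (<-irrefl refl (begin-strict
    length ys                     <⟨ m<m+n (length ys) z<s ⟩
    length ys + length (z ∷ zs)   ≡⟨ length-++ ys ⟨
    length (ys ++ z ∷ zs)         ≡⟨ ↭-length xs↭ ⟨
    length xs                     ≤⟨ len ⟩
    length ys                     ∎))
    where open ≤-Reasoning

  unique-map : {f : A → B} {xs : List A} → Unique xs →
    (∀ {x y} → x ∈ xs → y ∈ xs → f x ≡ f y → x ≡ y) → Unique (map f xs)
  unique-map [] inj = []
  unique-map (x∉xs ∷ uxs) inj =
    Allₚ.map⁺ (All.tabulate λ y∈xs fx≡fy → All.lookup x∉xs y∈xs (inj (here refl) (there y∈xs) fx≡fy))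
    ∷ unique-map uxs (λ x∈ y∈ → inj (there x∈) (there y∈))

  module Pigeonhole (c : A → ℕ) (is? : ∀ {x} j → Dec (c x ≡ j)) where

    class : ℕ → List A → List A
    class j = filter (λ x → is? {x} j)

    other : ℕ → List A → List A
    other j = filter (λ x → ¬? (is? {x} j))

    class-other-length : ∀ j xs → length xs ≡ length (class j xs) + length (other j xs)
    class-other-length j [] = refl
    class-other-length j (x ∷ xs) with is? {x} j
    ... | yes _ = cong suc (class-other-length j xs)
    ... | no  _ = trans (cong suc (class-other-length j xs)) (sym (+-suc _ _))

    class-other≤ : ∀ i j xs → length (class i (other j xs)) ≤ length (class i xs)
    class-other≤ i j [] = z≤n
    class-other≤ i j (x ∷ xs) with is? {x} j
    ... | yes _ with is? {x} i
    ...   | yes _ = m≤n⇒m≤1+n (class-other≤ i j xs)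
    ...   | no  _ = class-other≤ i j xs
    class-other≤ i j (x ∷ xs) | no _ with is? {x} i
    ...   | yes _ = s≤s (class-other≤ i j xs)
    ...   | no  _ = class-other≤ i j xs

    other-< : ∀ k xs → All (λ x → c x < suc k) xs → All (λ x → c x < k) (other k xs)
    other-< k [] [] = []
    other-< k (x ∷ xs) (cx< ∷ cs<) with is? {x} k
    ... | yes _    = other-< k xs cs<
    ... | no  cx≢k = ≤∧≢⇒< (s≤s⁻¹ cx<) cx≢k ∷ other-< k xs cs<

    -- The last colour is removed first; of its class and the best class of the rest, the larger one
    -- is at least the average.
    large-class : ∀ k xs → All (λ x → c x < k) xs →
      ∃ λ j → length xs ≤ k * length (class j xs)
    large-class zero [] [] = 0 , z≤n
    large-class (suc k) xs c< with large-class k (other k xs) (other-< k xs c<)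
    ... | j , le with ≤-total (length (class j xs)) (length (class k xs))
    ...   | inj₁ j≤k = k , (begin
        length xs                                        ≡⟨ class-other-length k xs ⟩
        length (class k xs) + length (other k xs)        ≤⟨ +-monoʳ-≤ _ le ⟩
        length (class k xs) + k * length (class j (other k xs))
          ≤⟨ +-monoʳ-≤ _ (*-monoʳ-≤ k (≤-trans (class-other≤ j k xs) j≤k)) ⟩
        length (class k xs) + k * length (class k xs)    ∎)
      where open ≤-Reasoning
    ...   | inj₂ k≤j = j , (begin
        length xs                                        ≡⟨ class-other-length k xs ⟩
        length (class k xs) + length (other k xs)        ≤⟨ +-mono-≤ k≤j le ⟩
        length (class j xs) + k * length (class j (other k xs))
          ≤⟨ +-monoʳ-≤ _ (*-monoʳ-≤ k (class-other≤ j k xs)) ⟩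
        length (class j xs) + k * length (class j xs)    ∎)
      where open ≤-Reasoning

    collision : ∀ k {xs} → Unique xs → All (λ x → c x < k) xs → k < length xs →
      ∃₂ λ x y → x ≢ y × c x ≡ c y
    collision k {xs} uxs c< k< with large-class k xs c<
    ... | j , le = go (class j xs) refl
      where
      go : ∀ ys → class j xs ≡ ys → ∃₂ λ x y → x ≢ y × c x ≡ c y
      go [] eq = ⊥-elim (<-irrefl refl (<-≤-trans k< (begin
        length xs   ≤⟨ subst (λ ys → length xs ≤ k * length ys) eq le ⟩
        k * 0       ≡⟨ *-zeroʳ k ⟩
        0           ≤⟨ z≤n ⟩
        k           ∎)))
        where open ≤-Reasoning
      go (_ ∷ []) eq = ⊥-elim (<-irrefl refl (<-≤-trans k< (begin
        length xs   ≤⟨ subst (λ ys → length xs ≤ k * length ys) eq le ⟩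
        k * 1       ≡⟨ *-identityʳ k ⟩
        k           ∎)))
        where open ≤-Reasoning
      go (x ∷ y ∷ _) eq with subst Unique eq (Uniqueₚ.filter⁺ (λ x → is? {x} j) uxs)
                          | subst (All (λ x → c x ≡ j)) eq (Allₚ.all-filter (λ x → is? {x} j) xs)
      ... | (x≢y ∷ _) ∷ _ | cx ∷ cy ∷ _ = x , y , x≢y , trans cx (sym cy)

  bits : ∀ n → List (Vec Bool n)
  bits zero    = [] ∷ []
  bits (suc n) = map (false ∷_) (bits n) ++ map (true ∷_) (bits n)

  bits-length : ∀ n → length (bits n) ≡ 2 ^ n
  bits-length zero = refl
  bits-length (suc n) = begin
    length (map (false ∷_) (bits n) ++ map (true ∷_) (bits n))
      ≡⟨ length-++ (map (false ∷_) (bits n)) ⟩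
    length (map (false ∷_) (bits n)) + length (map (true ∷_) (bits n))
      ≡⟨ cong₂ _+_ (length-map _ (bits n)) (length-map _ (bits n)) ⟩
    length (bits n) + length (bits n)
      ≡⟨ cong₂ _+_ (bits-length n) (trans (bits-length n) (sym (+-identityʳ _))) ⟩
    2 ^ suc n ∎
    where open ≡-Reasoning

  bits-unique : ∀ n → Unique (bits n)
  bits-unique zero = [] ∷ []
  bits-unique (suc n) = Uniqueₚ.++⁺
    (Uniqueₚ.map⁺ ∷-injectiveʳ (bits-unique n)) (Uniqueₚ.map⁺ ∷-injectiveʳ (bits-unique n)) disj
    where
    disj : Disjoint (map (false ∷_) (bits n)) (map (true ∷_) (bits n))
    disj (v∈₁ , v∈₂) with ∈-map⁻ (false ∷_) v∈₁ | ∈-map⁻ (true ∷_) v∈₂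
    ... | _ , _ , refl | _ , _ , ()

  prime∣prime⇒≡ : ∀ {p q} → Prime p → Prime q → p ∣ q → p ≡ q
  prime∣prime⇒≡ pp pq p∣q with prime⇒irreducible pq p∣q
  ... | inj₁ refl = ⊥-elim (¬prime[1] pp)
  ... | inj₂ eq = eq

  divisors : List ℕ → List ℕ
  divisors []       = 1 ∷ []
  divisors (x ∷ xs) = divisors xs ++ map (x *_) (divisors xs)

  divisors-length : ∀ xs → length (divisors xs) ≡ 2 ^ length xs
  divisors-length [] = refl
  divisors-length (x ∷ xs) = begin
    length (divisors xs ++ map (x *_) (divisors xs))        ≡⟨ length-++ (divisors xs) ⟩
    length (divisors xs) + length (map (x *_) (divisors xs))
      ≡⟨ cong₂ _+_ (divisors-length xs) (trans (length-map _ (divisors xs))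
           (trans (divisors-length xs) (sym (+-identityʳ _)))) ⟩
    2 ^ suc (length xs) ∎
    where open ≡-Reasoning

  divisors-∣ : ∀ xs → All (_∣ product xs) (divisors xs)
  divisors-∣ [] = ∣-refl ∷ []
  divisors-∣ (x ∷ xs) = Allₚ.++⁺ (All.map (∣n⇒∣m*n x) (divisors-∣ xs))
    (Allₚ.map⁺ (All.map (*-monoʳ-∣ x) (divisors-∣ xs)))

  divisors-unique : ∀ {xs} → All Prime xs → Unique xs → Unique (divisors xs)
  divisors-unique [] [] = [] ∷ []
  divisors-unique {x ∷ xs} (px ∷ pxs) (x∉xs ∷ uxs) = Uniqueₚ.++⁺ ih
    (Uniqueₚ.map⁺ (*-cancelˡ-≡ _ _ x {{prime⇒nonZero px}}) ih) disj
    where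
    ih = divisors-unique pxs uxs
    disj : Disjoint (divisors xs) (map (x *_) (divisors xs))
    disj {v} (v∈₁ , v∈₂) with ∈-map⁻ (x *_) v∈₂
    ... | d , _ , refl = All.lookup x∉xs
      (factorisationHasAllPrimeFactors px (∣-trans (m∣m*n d) (All.lookup (divisors-∣ xs) v∈₁)) pxs) refl

  -- One prime from each of `t` disjoint blocks, rather than a `t`-subset of `ps`: the number is
  -- then exactly `g ^ t`, with no binomial coefficient to estimate.
  choices : ℕ → ℕ → List ℕ → List (List ℕ)
  choices zero    g ps = [] ∷ []
  choices (suc t) g ps = cartesianProductWith _∷_ (take g ps) (choices t g (drop g ps))

  length-cartesianProductWith : ∀ {C : Set} (f : A → B → C) xs ys →
    length (cartesianProductWith f xs ys) ≡ length xs * length ys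
  length-cartesianProductWith f [] ys = refl
  length-cartesianProductWith f (x ∷ xs) ys = trans (length-++ (map (f x) ys))
    (cong₂ _+_ (length-map (f x) ys) (length-cartesianProductWith f xs ys))

  choices-length : ∀ t g ps → length ps ≡ t * g → length (choices t g ps) ≡ g ^ t
  choices-length zero g ps eq = refl
  choices-length (suc t) g ps eq = begin
    length (cartesianProductWith _∷_ (take g ps) (choices t g (drop g ps)))
      ≡⟨ length-cartesianProductWith _∷_ (take g ps) _ ⟩
    length (take g ps) * length (choices t g (drop g ps))
      ≡⟨ cong₂ _*_ (trans (length-take g ps) (trans (cong (g ⊓_) eq) (m≤n⇒m⊓n≡m (m≤m+n g (t * g)))))
           (choices-length t g (drop g ps)
             (trans (length-drop g ps) (trans (cong (_∸ g) eq) (m+n∸m≡n g (t * g))))) ⟩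
    g * g ^ t ∎
    where open ≡-Reasoning

  ∈-take⁻ : ∀ {x : A} n {xs} → x ∈ take n xs → x ∈ xs
  ∈-take⁻ (suc n) {y ∷ xs} (here eq) = here eq
  ∈-take⁻ (suc n) {y ∷ xs} (there x∈) = there (∈-take⁻ n x∈)

  ∈-drop⁻ : ∀ {x : A} n {xs} → x ∈ drop n xs → x ∈ xs
  ∈-drop⁻ zero x∈ = x∈
  ∈-drop⁻ (suc n) {y ∷ xs} x∈ = there (∈-drop⁻ n x∈)

  take-drop-disjoint : ∀ n {xs : List A} {x} → Unique xs → x ∈ take n xs → x ∉ drop n xs
  take-drop-disjoint (suc n) {y ∷ xs} (y∉ ∷ _) (here refl) x∈ = All.lookup y∉ (∈-drop⁻ n x∈) refl
  take-drop-disjoint (suc n) {y ∷ xs} (_ ∷ u) (there x∈t) x∈ = take-drop-disjoint n u x∈t x∈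

  choices-⊆ : ∀ t g ps {ts} → ts ∈ choices t g ps → All (_∈ ps) ts
  choices-⊆ zero g ps (here refl) = []
  choices-⊆ (suc t) g ps ts∈ with ∈-cartesianProductWith⁻ _∷_ (take g ps) (choices t g (drop g ps)) ts∈
  ... | p , us , p∈ , us∈ , refl = ∈-take⁻ g p∈ ∷ All.map (∈-drop⁻ g) (choices-⊆ t g (drop g ps) us∈)

  choices-lengths : ∀ t g ps {ts} → ts ∈ choices t g ps → length ts ≡ t
  choices-lengths zero g ps (here refl) = refl
  choices-lengths (suc t) g ps ts∈ with ∈-cartesianProductWith⁻ _∷_ (take g ps) (choices t g (drop g ps)) ts∈
  ... | p , us , _ , us∈ , refl = cong suc (choices-lengths t g (drop g ps) us∈)

  choices-unique : ∀ t g ps → Unique ps → Unique (choices t g ps)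
  choices-unique zero g ps u = [] ∷ []
  choices-unique (suc t) g ps u = Uniqueₚ.cartesianProductWith⁺ _∷_ ∷-injective
    (Uniqueₚ.take⁺ g u) (choices-unique t g (drop g ps) (Uniqueₚ.drop⁺ g u))

  -- The first prime of `ts` divides the product of the other list. It lies in the first block, so
  -- it cannot be one of the later factors and must be the first factor there too.
  choices-product-injective : ∀ t g ps {ts us} → All Prime ps → Unique ps →
    ts ∈ choices t g ps → us ∈ choices t g ps → product ts ≡ product us → ts ≡ us
  choices-product-injective zero g ps pps u (here refl) (here refl) eq = refl
  choices-product-injective (suc t) g ps pps u ts∈ us∈ eq
    with ∈-cartesianProductWith⁻ _∷_ (take g ps) (choices t g (drop g ps)) ts∈
       | ∈-cartesianProductWith⁻ _∷_ (take g ps) (choices t g (drop g ps)) us∈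
  ... | p , ts , p∈ , ts∈ , refl | q , us , q∈ , us∈ , refl = result
    where
    pp = All.lookup pps (∈-take⁻ g p∈)
    pq = All.lookup pps (∈-take⁻ g q∈)
    dps = All.tabulate (λ x∈ → All.lookup pps (∈-drop⁻ g x∈))
    us⊆ = choices-⊆ t g (drop g ps) us∈
    p≡q : p ≡ q
    p≡q with euclidsLemma q (product us) pp (subst (p ∣_) eq (m∣m*n (product ts)))
    ... | inj₁ p∣q = prime∣prime⇒≡ pp pq p∣q
    ... | inj₂ p∣us = ⊥-elim (take-drop-disjoint g u p∈ (All.lookup us⊆
        (factorisationHasAllPrimeFactors pp p∣us (All.map (All.lookup dps) us⊆))))
    result : p ∷ ts ≡ q ∷ us
    result with p≡q
    ... | refl = cong (p ∷_) (choices-product-injective t g (drop g ps) dps (Uniqueₚ.drop⁺ g u)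
      ts∈ us∈ (*-cancelˡ-≡ _ _ p {{prime⇒nonZero pp}} eq))

  -- The factor 1 pads shorter products to exactly `d` factors. Values may repeat; the list serves
  -- only to bound how many products are possible.
  products≤ : ℕ → List ℕ → List ℕ
  products≤ zero    ps = 1 ∷ []
  products≤ (suc d) ps = cartesianProductWith _*_ (1 ∷ ps) (products≤ d ps)

  products≤-length : ∀ d ps → length (products≤ d ps) ≡ suc (length ps) ^ d
  products≤-length zero ps = refl
  products≤-length (suc d) ps = trans (length-cartesianProductWith _*_ (1 ∷ ps) (products≤ d ps))
    (cong (suc (length ps) *_) (products≤-length d ps))

  ∈-products≤ : ∀ d ps {rs} → All (_∈ ps) rs → length rs ≤ d → product rs ∈ products≤ d ps
  ∈-products≤ zero ps [] _ = here refl
  ∈-products≤ (suc d) ps [] _ =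
    ∈-cartesianProductWith⁺ _*_ {xs = 1 ∷ ps} (here refl) (∈-products≤ d ps [] z≤n)
  ∈-products≤ (suc d) ps (r∈ ∷ rs∈) (s≤s len) =
    ∈-cartesianProductWith⁺ _*_ {xs = 1 ∷ ps} (there r∈) (∈-products≤ d ps rs∈ len)

  unique-factors⇒length≤ : ∀ {xs νs ρs} → Unique xs →
    (∀ {x} → x ∈ xs → ∃₂ λ ν ρ → ν ∈ νs × ρ ∈ ρs × x ≡ ν * ρ) →
    length xs ≤ length νs * length ρs
  unique-factors⇒length≤ {xs} {νs} {ρs} uxs f =
    subst (length xs ≤_) (length-cartesianProductWith _*_ νs ρs) (unique-⊆⇒length≤ uxs sub)
    where
    sub : ∀ {x} → x ∈ xs → x ∈ cartesianProductWith _*_ νs ρs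
    sub x∈ with f x∈
    ... | ν , ρ , ν∈ , ρ∈ , refl = ∈-cartesianProductWith⁺ _*_ ν∈ ρ∈

  -- Congruences and an exponent for the unit group.

  infix 4 _≈_[mod_]

  record _≈_[mod_] (x y n : ℕ) : Set where
    constructor congruent
    field modulus∣diff : + n ℤ∣.∣ + x ℤ.- + y

  open _≈_[mod_]

  module _ {n : ℕ} where

    mod-refl : ∀ {x} → x ≈ x [mod n ]
    mod-refl {x} = congruent (ℤ∣.divides (+ 0) (ℤₚ.+-inverseʳ (+ x)))

    mod-reflexive : ∀ {x y} → x ≡ y → x ≈ y [mod n ]
    mod-reflexive refl = mod-refl

    mod-sym : ∀ {x y} → x ≈ y [mod n ] → y ≈ x [mod n ]
    mod-sym {x} {y} (congruent p) =
      congruent (subst (+ n ℤ∣.∣_) (lemma (+ x) (+ y)) (ℤ∣.∣m⇒∣-m p))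
      where
      lemma : ∀ x y → ℤ.- (x ℤ.- y) ≡ y ℤ.- x
      lemma = solveℤ

    mod-trans : ∀ {x y z} → x ≈ y [mod n ] → y ≈ z [mod n ] → x ≈ z [mod n ]
    mod-trans {x} {y} {z} (congruent p) (congruent q) =
      congruent (subst (+ n ℤ∣.∣_) (lemma (+ x) (+ y) (+ z)) (ℤ∣.∣m∣n⇒∣m+n p q))
      where
      lemma : ∀ x y z → (x ℤ.- y) ℤ.+ (y ℤ.- z) ≡ x ℤ.- z
      lemma = solveℤ

    mod-* : ∀ {x y z w} → x ≈ y [mod n ] → z ≈ w [mod n ] → x * z ≈ y * w [mod n ]
    mod-* {x} {y} {z} {w} (congruent p) (congruent q) = congruent (subst (+ n ℤ∣.∣_)
      (trans (lemma (+ x) (+ y) (+ z) (+ w)) (sym (cong₂ ℤ._-_ (ℤₚ.pos-* x z) (ℤₚ.pos-* y w))))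
      (ℤ∣.∣m∣n⇒∣m+n (ℤ∣.∣n⇒∣m*n (+ x) q) (ℤ∣.∣m⇒∣m*n (+ w) p)))
      where
      lemma : ∀ x y z w → x ℤ.* (z ℤ.- w) ℤ.+ (x ℤ.- y) ℤ.* w ≡ x ℤ.* z ℤ.- y ℤ.* w
      lemma = solveℤ

    mod-^ : ∀ {x y} e → x ≈ y [mod n ] → x ^ e ≈ y ^ e [mod n ]
    mod-^ zero    p = mod-refl
    mod-^ (suc e) p = mod-* p (mod-^ e p)

    mod-cancelʳ : ∀ {x y} c → Coprime n c → x * c ≈ y * c [mod n ] → x ≈ y [mod n ]
    mod-cancelʳ {x} {y} c cop (congruent p) = congruent (∣ᵤ⇒∣ (coprime-divisor cop
      (subst (n ∣_) (trans (ℤₚ.abs-* (+ x ℤ.- + y) (+ c)) (*-comm ℤ.∣ + x ℤ.- + y ∣ c))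
        (∣⇒∣ᵤ (subst (+ n ℤ∣.∣_) eq p)))))
      where
      lemma : ∀ x y c → x ℤ.* c ℤ.- y ℤ.* c ≡ (x ℤ.- y) ℤ.* c
      lemma = solveℤ
      eq : + (x * c) ℤ.- + (y * c) ≡ (+ x ℤ.- + y) ℤ.* + c
      eq = trans (cong₂ ℤ._-_ (ℤₚ.pos-* x c) (ℤₚ.pos-* y c)) (lemma (+ x) (+ y) (+ c))

    mod-% : ∀ x .{{_ : NonZero n}} → x % n ≈ x [mod n ]
    mod-% x = mod-sym (congruent (ℤ∣.divides (+ (x / n)) (begin
      + x ℤ.- + (x % n)
        ≡⟨ cong (λ z → + z ℤ.- + (x % n)) (m≡m%n+[m/n]*n x n) ⟩
      + (x % n) ℤ.+ + (x / n * n) ℤ.- + (x % n)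
        ≡⟨ lemma (+ (x % n)) (+ (x / n * n)) ⟩
      + (x / n * n)
        ≡⟨ ℤₚ.pos-* (x / n) n ⟩
      + (x / n) ℤ.* + n ∎)))
      where
      open ≡-Reasoning
      lemma : ∀ r s → r ℤ.+ s ℤ.- r ≡ s
      lemma = solveℤ

    %≡⇒mod : ∀ x y .{{_ : NonZero n}} → x % n ≡ y % n → x ≈ y [mod n ]
    %≡⇒mod x y eq = mod-trans (mod-sym (mod-% x)) (subst (_≈ y [mod n ]) (sym eq) (mod-% y))

    mod-<⇒≥ : ∀ {x y} → y < n → x ≈ y [mod n ] → y ≤ x
    mod-<⇒≥ {x} {y} y<n (congruent p) with ≤-total y x
    ... | inj₁ y≤x = y≤x
    ... | inj₂ x≤y with y ∸ x in eq
    ...   | zero  = m∸n≡0⇒m≤n eq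
    ...   | suc d = ⊥-elim (<-irrefl refl (<-≤-trans y<n (≤-trans (∣⇒≤ n∣)
              (≤-trans (≤-reflexive (sym eq)) (m∸n≤m y x)))))
      where
      n∣ : n ∣ suc d
      n∣ = subst (n ∣_) (trans (cong ℤ.∣_∣ (ℤₚ.m-n≡m⊖n x y))
        (trans (ℤₚ.∣m⊖n∣≡∣n⊖m∣ x y) (trans (cong ℤ.∣_∣ (ℤₚ.⊖-≥ x≤y)) eq))) (∣⇒∣ᵤ p)

    mod-<⇒≡ : ∀ {x y} → x < n → y < n → x ≈ y [mod n ] → x ≡ y
    mod-<⇒≡ x<n y<n p = ≤-antisym (mod-<⇒≥ x<n (mod-sym p)) (mod-<⇒≥ y<n p)

  coprime-* : ∀ {n x y} → Coprime n x → Coprime n y → Coprime n (x * y)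
  coprime-* {n} {x} {y} nx ny {d} (d∣n , d∣xy) = ny (d∣n , coprime-divisor
    (λ (e∣d , e∣x) → nx (∣-trans e∣d d∣n , e∣x)) d∣xy)

  coprime-product : ∀ {n xs} → All (Coprime n) xs → Coprime n (product xs)
  coprime-product [] = Coprimality.sym (Coprimality.1-coprimeTo _)
  coprime-product (c ∷ cs) = coprime-* c (coprime-product cs)

  coprime-resp-mod : ∀ {n x y} → x ≈ y [mod n ] → Coprime n x → Coprime n y
  coprime-resp-mod {n} {x} {y} (congruent p) nx {d} (d∣n , d∣y) = nx (d∣n , ∣⇒∣ᵤ (ℤ∣.∣m+n∣n⇒∣m {+ d} {+ x} {ℤ.- + y}
    (ℤ∣.∣-trans (∣ᵤ⇒∣ {+ d} {+ n} d∣n) p) (ℤ∣.∣m⇒∣-m (∣ᵤ⇒∣ {+ d} {+ y} d∣y))))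

  -- Multiplication by `x` permutes `U`, so the product of `U` equals itself times `x ^ length U`,
  -- and it can be cancelled. Keeping `U` abstract lets the argument serve both Fermat's theorem,
  -- with the residues 1 to q - 1, and Euler's.
  module Orbit {n} .{{_ : NonZero n}} (U : List ℕ) (unique : Unique U) (small : All (_< n) U)
    (units : All (Coprime n) U) {x} (nx : Coprime n x)
    (closed : ∀ {y} → y ∈ U → (x * y) % n ∈ U) where

    shiftU : List ℕ
    shiftU = map (λ y → (x * y) % n) U

    product-shift : ∀ ys → product (map (λ y → (x * y) % n) ys) ≈ x ^ length ys * product ys [mod n ]
    product-shift [] = mod-refl
    product-shift (y ∷ ys) = mod-trans
      (mod-* (mod-% (x * y)) (product-shift ys))
      (mod-reflexive ([m*n]*[o*p]≡[m*o]*[n*p] x y (x ^ length ys) (product ys)))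

    ^length≡1 : x ^ length U ≈ 1 [mod n ]
    ^length≡1 = mod-cancelʳ (product U) (coprime-product units) (mod-trans
      (mod-sym (product-shift U))
      (mod-reflexive (trans (sym (product-↭ perm)) (sym (*-identityˡ _)))))
      where
      perm = unique-⊆-length⇒↭ {ys = shiftU} {xs = U}
        (unique-map unique λ {y} {z} y∈ z∈ eq → mod-<⇒≡ (All.lookup small y∈) (All.lookup small z∈)
          (mod-cancelʳ x nx (subst₂ _≈_[mod n ] (*-comm x y) (*-comm x z) (%≡⇒mod (x * y) (x * z) eq))))
        (λ w∈ → case-map (∈-map⁻ _ w∈))
        (≤-reflexive (sym (length-map _ U)))
        where
        case-map : ∀ {w} → (∃ λ y → y ∈ U × w ≡ (x * y) % n) → w ∈ U
        case-map (y , y∈ , refl) = closed y∈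

  fermat : ∀ {q x} → Prime q → Coprime q x → x ^ (q ∸ 1) ≈ 1 [mod q ]
  fermat {zero} pq _ = ⊥-elim (¬prime[0] pq)
  fermat {q@(suc r)} {x} pq qx = subst (λ e → x ^ e ≈ 1 [mod q ]) (length-applyUpTo suc r)
    (Orbit.^length≡1 U (Uniqueₚ.applyUpTo⁺₁ suc r λ i<j _ → <⇒≢ (s<s i<j))
      (All.tabulate small) (All.tabulate unit) qx closed)
    where
    U = applyUpTo suc r
    small : ∀ {y} → y ∈ U → y < q
    small y∈ with ∈-applyUpTo⁻ suc y∈
    ... | i , i< , refl = s<s i<
    unit : ∀ {y} → y ∈ U → Coprime q y
    unit y∈ with ∈-applyUpTo⁻ suc y∈
    ... | i , i< , refl = prime⇒coprime pq (s<s i<)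
    closed : ∀ {y} → y ∈ U → (x * y) % q ∈ U
    closed {y} y∈ with (x * y) % q in eq | m%n<n (x * y) q
    ... | suc z | s≤s z< = ∈-applyUpTo⁺ suc z<
    -- A zero residue would make `q` coprime to a multiple of itself, hence equal to 1.
    ... | zero  | _ = ⊥-elim (¬prime[1] (subst Prime
      (coprime-* qx (unit y∈) (∣-refl , m%n≡0⇒n∣m (x * y) q eq)) pq))

  abstract
    euler : ∀ n .{{_ : NonZero n}} → ∃ λ e → 0 < e × e ≤ n × (∀ {x} → Coprime n x → x ^ e ≈ 1 [mod n ])
    -- The residue `1 % n` witnesses that `U` is nonempty; for `n = 1` it is 0, which is a unit
    -- there.
    euler n = length U , ∈⇒0<length (∈U (m%n<n 1 n) (coprime-resp-mod (mod-sym (mod-% 1))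
          (Coprimality.sym (Coprimality.1-coprimeTo n))))
      , ≤-trans (length-filter (coprime? n) (upTo n)) (≤-reflexive (length-upTo n))
      , λ {x} nx → Orbit.^length≡1 U (Uniqueₚ.filter⁺ (coprime? n) (Uniqueₚ.upTo⁺ n))
          (All.tabulate λ y∈ → ∈-upTo⁻ (proj₁ (∈-filter⁻ (coprime? n) y∈)))
          (All.tabulate λ y∈ → proj₂ (∈-filter⁻ (coprime? n) {xs = upTo n} y∈)) nx
          (λ {y} y∈ → ∈U (m%n<n (x * y) n) (coprime-resp-mod (mod-sym (mod-% (x * y)))
            (coprime-* nx (proj₂ (∈-filter⁻ (coprime? n) {xs = upTo n} y∈)))))
      where
      U : List ℕ
      U = filter (coprime? n) (upTo n)
      ∈U : ∀ {y} → y < n → Coprime n y → y ∈ U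
      ∈U y<n ny = ∈-filter⁺ (coprime? n) (∈-upTo⁺ y<n) ny
      ∈⇒0<length : ∀ {y : ℕ} {ys} → y ∈ ys → 0 < length ys
      ∈⇒0<length {ys = _ ∷ _} _ = z<s

  -- Write x - y = k m. Since `n` divides k m and is coprime to `m`, it divides k.
  mod-CRT : ∀ {m n x y} → Coprime m n → x ≈ y [mod m ] → x ≈ y [mod n ] → x ≈ y [mod m * n ]
  mod-CRT {m} {n} {x} {y} mn (congruent (ℤ∣.divides k eq)) (congruent q) = congruent (subst₂ ℤ∣._∣_
    (sym (trans (ℤₚ.pos-* m n) (ℤₚ.*-comm (+ m) (+ n)))) (sym eq)
    (ℤ∣.*-monoˡ-∣ (+ m) {+ n} {k} (∣ᵤ⇒∣ (coprime-divisor (Coprimality.sym mn) (subst (n ∣_)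
      (trans (ℤₚ.abs-* k (+ m)) (*-comm ℤ.∣ k ∣ m)) (∣⇒∣ᵤ (subst (+ n ℤ∣.∣_) eq q)))))))

  coprime-primes : ∀ {p qs} → Prime p → All Prime qs → p ∉ qs → Coprime p (product qs)
  coprime-primes pp pqs p∉ (d∣p , d∣qs) with prime⇒irreducible pp d∣p
  ... | inj₁ d≡1 = d≡1
  ... | inj₂ refl = ⊥-elim (p∉ (factorisationHasAllPrimeFactors pp d∣qs pqs))

  mod-product : ∀ {qs x y} → All Prime qs → Unique qs → All (x ≈ y [mod_]) qs → x ≈ y [mod product qs ]
  mod-product {x = x} {y} [] [] [] = congruent (∣ᵤ⇒∣ {+ 1} {+ x ℤ.- + y} (1∣ _))
  mod-product (pq ∷ pqs) (q∉ ∷ u) (c ∷ cs) = mod-CRT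
    (coprime-primes pq pqs (λ q∈ → All.lookup q∉ q∈ refl)) c (mod-product pqs u cs)

  mod-1^ : ∀ {n x} e → x ≈ 1 [mod n ] → x ^ e ≈ 1 [mod n ]
  mod-1^ {n} {x} e p = subst (x ^ e ≈_[mod n ]) (^-zeroˡ e) (mod-^ e p)

  ^-multiple : ∀ {n x e f} → x ^ e ≈ 1 [mod n ] → e ∣ f → x ^ f ≈ 1 [mod n ]
  ^-multiple {n} {x} {e} p (divides m refl) = subst (_≈ 1 [mod n ])
    (trans (^-*-assoc x e m) (cong (x ^_) (*-comm e m))) (mod-1^ m p)

  coprime-∣ˡ : ∀ {d n x} → d ∣ n → Coprime n x → Coprime d x
  coprime-∣ˡ d∣n c (e∣d , e∣x) = c (∣-trans e∣d d∣n , e∣x)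

  -- Modulo each prime of `qs` Fermat's theorem applies and q - 1 divides `E`; about `μ` only its
  -- size is known, so Euler's theorem with e ≤ μ has to do. The bound is independent of the number
  -- of primes in `qs`, which is why the exponent stays far smaller than the group.
  exponent : ∀ {μ qs E} .{{_ : NonZero μ}} → All Prime qs → Unique qs → All (λ q → q ∸ 1 ∣ E) qs → 0 < E →
    Coprime μ (product qs) →
    ∃ λ e → 0 < e × e ≤ E * μ × (∀ {x} → Coprime (μ * product qs) x → x ^ e ≈ 1 [mod μ * product qs ])
  exponent {μ} {qs} {E} pqs uqs q-1∣E 0<E cop with euler μ
  ... | e , 0<e , e≤μ , eu = E * e , *-mono-≤ 0<E 0<e , *-monoʳ-≤ E e≤μ , kills
    where
    kills : ∀ {x} → Coprime (μ * product qs) x → x ^ (E * e) ≈ 1 [mod μ * product qs ]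
    kills {x} c = mod-CRT cop
      (^-multiple {e = e} (eu (coprime-∣ˡ (m∣m*n (product qs)) c)) (n∣m*n E))
      (mod-product pqs uqs (All.tabulate at))
      where
      at : ∀ {q} → q ∈ qs → x ^ (E * e) ≈ 1 [mod q ]
      at {q} q∈ = ^-multiple {e = q ∸ 1}
        (fermat (All.lookup pqs q∈) (coprime-∣ˡ (∣n⇒∣m*n μ (∈⇒∣product q∈)) c))
        (∣-trans (All.lookup q-1∣E q∈) (m∣m*n e))

  -- Subproducts congruent to 1: a bound for the Davenport constant.

  ++-interchange : ∀ {A : Set} (as bs cs ds : List A) →
    (as ++ bs) ++ (cs ++ ds) ↭ (as ++ cs) ++ (bs ++ ds)
  ++-interchange as bs cs ds = ↭-trans (↭-reflexive (++-assoc as bs (cs ++ ds)))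
    (↭-trans (++⁺ˡ as (shifts bs cs)) (↭-reflexive (sym (++-assoc as cs (bs ++ ds)))))

  module Davenport (n : ℕ) .{{_ : NonZero n}} where

    -- m disjoint nonempty subsequences, each with product v.
    data Reps (v : ℕ) : ℕ → List ℕ → Set where
      none : ∀ {xs} → Reps v 0 xs
      more : ∀ {m xs} y ys zs → xs ↭ (y ∷ ys) ++ zs → product (y ∷ ys) ≈ v [mod n ] →
        Reps v m zs → Reps v (suc m) xs

    reps-resp-↭ : ∀ {v m xs ws} → xs ↭ ws → Reps v m xs → Reps v m ws
    reps-resp-↭ p none = none
    reps-resp-↭ p (more y ys zs q e r) = more y ys zs (↭-trans (↭-sym p) q) e r

    reps-resp-mod : ∀ {v w m xs} → v ≈ w [mod n ] → Reps v m xs → Reps w m xs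
    reps-resp-mod v≡w none = none
    reps-resp-mod v≡w (more y ys zs q e r) = more y ys zs q (mod-trans e v≡w) (reps-resp-mod v≡w r)

    reps-++ʳ : ∀ {v m xs} ws → Reps v m xs → Reps v m (xs ++ ws)
    reps-++ʳ ws none = none
    reps-++ʳ ws (more y ys zs q e r) = more y ys (zs ++ ws)
      (↭-trans (++⁺ʳ ws q) (↭-reflexive (++-assoc (y ∷ ys) zs ws))) e (reps-++ʳ ws r)

    reps-++ˡ : ∀ {v m xs} ws → Reps v m xs → Reps v m (ws ++ xs)
    reps-++ˡ {xs = xs} ws r = reps-resp-↭ (++-comm xs ws) (reps-++ʳ ws r)

    -- The blocks are paired off, so the number `m` is kept; `reps-+` instead keeps the value and
    -- adds the numbers. Doubling uses the first to multiply bundles and the second to merge two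
    -- stocks with equal products.
    reps-* : ∀ {v w m xs ws} → Reps v m xs → Reps w m ws → Reps (v * w) m (xs ++ ws)
    reps-* none none = none
    reps-* (more y ys zs p e r) (more y′ ys′ zs′ p′ e′ r′) = more y (ys ++ y′ ∷ ys′) (zs ++ zs′)
      (↭-trans (++⁺ p p′) (++-interchange (y ∷ ys) zs (y′ ∷ ys′) zs′))
      (mod-trans (mod-reflexive (product-++ (y ∷ ys) (y′ ∷ ys′))) (mod-* e e′))
      (reps-* r r′)

    reps-+ : ∀ {v m k xs ws} → Reps v m xs → Reps v k ws → Reps v (m + k) (xs ++ ws)
    reps-+ {xs = xs} none s = reps-++ˡ xs s
    reps-+ {ws = ws} (more y ys zs p e r) s = more y ys (zs ++ ws)
      (↭-trans (++⁺ʳ ws p) (↭-reflexive (++-assoc (y ∷ ys) zs ws))) e (reps-+ r s)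

    reps-≤ : ∀ {v k m xs} → k ≤ m → Reps v m xs → Reps v k xs
    reps-≤ z≤n r = none
    reps-≤ (s≤s k≤m) (more y ys zs p e r) = more y ys zs p e (reps-≤ k≤m r)

    -- All blocks are merged into one. There must be at least one of them, because a block is
    -- nonempty.
    reps-^ : ∀ {v m xs} → Reps v (suc m) xs → Reps (v ^ suc m) 1 xs
    reps-^ {v} {zero} r = reps-resp-mod (mod-reflexive (sym (*-identityʳ v))) r
    reps-^ {v} {suc m} (more y ys zs p e r) =
      reps-resp-↭ (↭-sym p) (reps-* (more y ys [] (↭-reflexive (sym (++-identityʳ (y ∷ ys)))) e none) (reps-^ r))

    reps-1 : ∀ {v m xs} → 0 < m → v ≈ 1 [mod n ] → Reps v m xs → Reps 1 1 xs
    reps-1 0<m v≡1 r = reps-resp-mod v≡1 (reps-≤ 0<m r)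

    record Bundle (m : ℕ) : Set where
      constructor bundle
      field
        value : ℕ
        coprime : Coprime n value
        elements : List ℕ
        reps : Reps value m elements

    open Bundle

    all-elements : ∀ {m k} → Vec (Bundle m) k → List ℕ
    all-elements []       = []
    all-elements (b ∷ bs) = elements b ++ all-elements bs

    selected : ∀ {m k} → Vec (Bundle m) k → Vec Bool k → ℕ
    selected []       []          = 1
    selected (b ∷ bs) (false ∷ I) = selected bs I
    selected (b ∷ bs) (true ∷ I)  = value b * selected bs I

    selected-coprime : ∀ {m k} (bs : Vec (Bundle m) k) I → Coprime n (selected bs I)
    selected-coprime []       []          = Coprimality.sym (Coprimality.1-coprimeTo n)
    selected-coprime (b ∷ bs) (false ∷ I) = selected-coprime bs I
    selected-coprime (b ∷ bs) (true ∷ I)  = coprime-* (coprime b) (selected-coprime bs I)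

    -- The products over the bundles in `I` only, in `J` only and in both are `l`, `r` and `c`; `ls`
    -- and `rs` are the stocks of the first two kinds. An empty difference has value 1 and supplies
    -- no block, hence the alternative in `left` and `right`. `distinct` remembers that `I ≢ J`
    -- makes one of the differences nonempty.
    record Separation {m k} (bs : Vec (Bundle m) k) (I J : Vec Bool k) : Set where
      field
        l r c        : ℕ
        ls rs rest   : List ℕ
        I-value      : selected bs I ≡ l * c
        J-value      : selected bs J ≡ r * c
        c-coprime    : Coprime n c
        split        : all-elements bs ↭ ls ++ rs ++ rest
        left         : l ≡ 1 ⊎ Reps l m ls
        right        : r ≡ 1 ⊎ Reps r m rs
        distinct     : I ≡ J ⊎ Reps l m ls ⊎ Reps r m rs

    extend : ∀ {m l ls} (b : Bundle m) → l ≡ 1 ⊎ Reps l m ls → Reps (value b * l) m (elements b ++ ls)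
    extend b (inj₁ refl) = reps-resp-mod (mod-reflexive (sym (*-identityʳ _))) (reps-++ʳ _ (reps b))
    extend b (inj₂ r)    = reps-* (reps b) r

    separate : ∀ {m k} (bs : Vec (Bundle m) k) I J → Separation bs I J
    separate [] [] [] = record
      { l = 1 ; r = 1 ; c = 1 ; ls = [] ; rs = [] ; rest = [] ; I-value = refl ; J-value = refl
      ; c-coprime = Coprimality.sym (Coprimality.1-coprimeTo n) ; split = ↭-refl
      ; left = inj₁ refl ; right = inj₁ refl ; distinct = inj₁ refl }
    separate (b ∷ bs) (i ∷ I) (j ∷ J) = go i j
      where
      open Separation (separate bs I J)
      es = elements b

      tail-distinct : ∀ i → i ∷ I ≡ i ∷ J ⊎ Reps l _ ls ⊎ Reps r _ rs
      tail-distinct i with distinct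
      ... | inj₁ refl = inj₁ refl
      ... | inj₂ d    = inj₂ d

      to-rest : es ++ all-elements bs ↭ ls ++ rs ++ (es ++ rest)
      to-rest = ↭-trans (++⁺ˡ es split) (↭-trans (shifts es ls) (++⁺ˡ ls (shifts es rs)))

      go : ∀ i j → Separation (b ∷ bs) (i ∷ I) (j ∷ J)
      go false false = record
        { l = l ; r = r ; c = c ; ls = ls ; rs = rs ; rest = es ++ rest
        ; I-value = I-value ; J-value = J-value ; c-coprime = c-coprime ; split = to-rest
        ; left = left ; right = right ; distinct = tail-distinct false }
      go true true = record
        { l = l ; r = r ; c = value b * c ; ls = ls ; rs = rs ; rest = es ++ rest
        ; I-value = trans (cong (value b *_) I-value) (swap l)
        ; J-value = trans (cong (value b *_) J-value) (swap r)
        ; c-coprime = coprime-* (coprime b) c-coprime ; split = to-rest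
        ; left = left ; right = right ; distinct = tail-distinct true }
        where
        swap : ∀ x → value b * (x * c) ≡ x * (value b * c)
        swap x = trans (sym (*-assoc (value b) x c))
          (trans (cong (_* c) (*-comm (value b) x)) (*-assoc x (value b) c))
      go true false = record
        { l = value b * l ; r = r ; c = c ; ls = es ++ ls ; rs = rs ; rest = rest
        ; I-value = trans (cong (value b *_) I-value) (sym (*-assoc (value b) l c))
        ; J-value = J-value ; c-coprime = c-coprime
        ; split = ↭-trans (++⁺ˡ es split) (↭-reflexive (sym (++-assoc es ls (rs ++ rest))))
        ; left = inj₂ (extend b left) ; right = right
        ; distinct = inj₂ (inj₁ (extend b left)) }
      go false true = record
        { l = l ; r = value b * r ; c = c ; ls = ls ; rs = es ++ rs ; rest = rest
        ; I-value = I-value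
        ; J-value = trans (cong (value b *_) J-value) (sym (*-assoc (value b) r c))
        ; c-coprime = c-coprime
        ; split = ↭-trans (++⁺ˡ es split) (↭-trans (shifts es ls)
            (++⁺ˡ ls (↭-reflexive (sym (++-assoc es rs rest)))))
        ; left = left ; right = inj₂ (extend b right)
        ; distinct = inj₂ (inj₂ (extend b right)) }

    module _ (h : ℕ) (n≤2^h : n ≤ 2 ^ h) where

      abstract
        -- If one of the two colliding sets contains the other, then after cancelling `c` the
        -- nonempty difference has product 1, and a subproduct 1 is found at once. Otherwise `l` and
        -- `r` agree and have disjoint stocks.
        double : ∀ {m} → 0 < m → (bs : Vec (Bundle m) (suc h)) →
          Reps 1 1 (all-elements bs) ⊎ ∃ λ v → Coprime n v × Reps v (m + m) (all-elements bs)
        double {m} 0<m bs = from-collision (Pigeonhole.collision value% (λ {I} j → value% I ≟ j) n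
          (bits-unique (suc h)) (All.universal (λ I → m%n<n (selected bs I) n) (bits (suc h)))
          (subst (n <_) (sym (bits-length (suc h)))
            (≤-<-trans n≤2^h (^-monoʳ-< 2 (s≤s (s≤s z≤n)) (n<1+n h)))))
          where
          value% : Vec Bool (suc h) → ℕ
          value% I = selected bs I % n

          from-separation : ∀ {I J} → I ≢ J → selected bs I ≈ selected bs J [mod n ] → Separation bs I J →
            Reps 1 1 (all-elements bs) ⊎ ∃ λ v → Coprime n v × Reps v (m + m) (all-elements bs)
          from-separation {I} {J} I≢J I≡J S = go left right
            where
            open Separation S
            l≡r : l ≈ r [mod n ]
            l≡r = mod-cancelʳ c c-coprime (subst₂ _≈_[mod n ] I-value J-value I≡J)
            in-left : ∀ {v k} → Reps v k ls → Reps v k (all-elements bs)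
            in-left x = reps-resp-↭ (↭-sym split) (reps-++ʳ (rs ++ rest) x)
            in-right : ∀ {v k} → Reps v k rs → Reps v k (all-elements bs)
            in-right x = reps-resp-↭ (↭-sym split) (reps-++ˡ ls (reps-++ʳ rest x))
            go : l ≡ 1 ⊎ Reps l m ls → r ≡ 1 ⊎ Reps r m rs →
              Reps 1 1 (all-elements bs) ⊎ ∃ λ v → Coprime n v × Reps v (m + m) (all-elements bs)
            go (inj₁ refl) (inj₂ R) = inj₁ (in-right (reps-1 0<m (mod-sym l≡r) R))
            go (inj₂ L) (inj₁ refl) = inj₁ (in-left (reps-1 0<m l≡r L))
            go (inj₂ L) (inj₂ R) = inj₂ (l
              , (λ (d∣n , d∣l) → selected-coprime bs I (d∣n , subst (_ ∣_) (sym I-value) (∣m⇒∣m*n c d∣l)))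
              , reps-resp-↭ (↭-sym split) (reps-+ L (reps-++ʳ rest (reps-resp-mod (mod-sym l≡r) R))))
            go (inj₁ l≡1) (inj₁ r≡1) with distinct
            ... | inj₁ I≡J      = ⊥-elim (I≢J I≡J)
            ... | inj₂ (inj₁ L) = inj₁ (in-left (reps-1 0<m (mod-reflexive l≡1) L))
            ... | inj₂ (inj₂ R) = inj₁ (in-right (reps-1 0<m (mod-reflexive r≡1) R))

          from-collision : (∃₂ λ I J → I ≢ J × value% I ≡ value% J) →
            Reps 1 1 (all-elements bs) ⊎ ∃ λ v → Coprime n v × Reps v (m + m) (all-elements bs)
          from-collision (I , J , I≢J , eq) =
            from-separation I≢J (%≡⇒mod (selected bs I) (selected bs J) eq) (separate bs I J)

        bundles : ∀ {m} d → (∀ {xs} → All (Coprime n) xs → d ≤ length xs →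
            Reps 1 1 xs ⊎ ∃ λ v → Coprime n v × Reps v m xs) →
          ∀ k {xs} → All (Coprime n) xs → k * d ≤ length xs →
          Reps 1 1 xs ⊎ ∃₂ λ (bs : Vec (Bundle m) k) rest → xs ↭ all-elements bs ++ rest
        bundles d find zero {xs} cs len = inj₂ ([] , xs , ↭-refl)
        bundles d find (suc k) {xs} cs len
          with find {take d xs} (Allₚ.take⁺ d cs)
                 (≤-reflexive (sym (trans (length-take d xs) (m≤n⇒m⊓n≡m (m+n≤o⇒m≤o d len)))))
             | bundles d find k {drop d xs} (Allₚ.drop⁺ d cs)
                 (subst (k * d ≤_) (sym (length-drop d xs)) (m+n≤o⇒m≤o∸n (k * d) (subst (_≤ length xs) (+-comm d (k * d)) len)))
        ... | inj₁ r | _ = inj₁ (subst (Reps 1 1) (take++drop≡id d xs) (reps-++ʳ (drop d xs) r))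
        ... | inj₂ _ | inj₁ r = inj₁ (subst (Reps 1 1) (take++drop≡id d xs) (reps-++ˡ (take d xs) r))
        ... | inj₂ (v , vc , r) | inj₂ (bs , rest , p) = inj₂ (bundle v vc (take d xs) r ∷ bs , rest
          , ↭-trans (↭-reflexive (sym (take++drop≡id d xs))) (↭-trans (++⁺ˡ (take d xs) p)
              (↭-reflexive (sym (++-assoc (take d xs) (all-elements bs) rest)))))

      -- Each doubling of the number of representations costs a factor `suc h` in length: the list
      -- is cut into `suc h` pieces, and each piece yields one bundle.
      many-reps : ∀ ℓ {xs} → All (Coprime n) xs → suc h ^ ℓ ≤ length xs →
        Reps 1 1 xs ⊎ ∃ λ v → Coprime n v × Reps v (2 ^ ℓ) xs
      many-reps zero {x ∷ xs} (c ∷ cs) len =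
        inj₂ (x , c , more x [] xs ↭-refl (mod-reflexive (*-identityʳ x)) none)
      many-reps (suc ℓ) {xs} cs len with bundles (suc h ^ ℓ) (many-reps ℓ) (suc h) cs len
      ... | inj₁ r = inj₁ r
      ... | inj₂ (bs , rest , p) with double (m^n>0 2 ℓ) bs
      ...   | inj₁ r = inj₁ (reps-resp-↭ (↭-sym p) (reps-++ʳ rest r))
      ...   | inj₂ (v , vc , r) = inj₂ (v , vc , reps-resp-↭ (↭-sym p) (reps-++ʳ rest
              (subst (λ k → Reps v k (all-elements bs)) (cong (λ k → 2 ^ ℓ + k) (sym (+-identityʳ (2 ^ ℓ)))) r)))

      module _ {e ℓ} (0<e : 0 < e) (e≤2^ℓ : e ≤ 2 ^ ℓ)
        (kills : ∀ {x} → Coprime n x → x ^ e ≈ 1 [mod n ]) where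

        product≡1 : ∀ {xs} → All (Coprime n) xs → suc h ^ ℓ ≤ length xs → Reps 1 1 xs
        product≡1 cs len with many-reps ℓ cs len
        ... | inj₁ r = r
        ... | inj₂ (v , vc , r) = go 0<e e≤2^ℓ (kills vc)
          where
          go : ∀ {e} → 0 < e → e ≤ 2 ^ ℓ → v ^ e ≈ 1 [mod n ] → Reps 1 1 _
          go {suc e} _ e≤ v^e≡1 = reps-resp-mod v^e≡1 (reps-^ (reps-≤ e≤ r))

        -- `k` bounds the length and makes the recursion structural; every removed block contains at
        -- least `y`, so the bound goes down.
        split-off : ∀ k xs → length xs ≤ k → All (Coprime n) xs →
          ∃₂ λ zs rs → xs ↭ zs ++ rs × product zs ≈ 1 [mod n ] × length rs < suc h ^ ℓ
        split-off k xs len cs with length xs <? suc h ^ ℓ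
        ... | yes short = [] , xs , ↭-refl , mod-refl , short
        split-off zero [] len cs | no long = ⊥-elim (long (m^n>0 (suc h) ℓ))
        split-off (suc k) xs len cs | no long with product≡1 cs (≮⇒≥ long)
        ... | more y ys ws p y≡1 none with split-off k ws
                (s≤s⁻¹ (≤-trans (s≤s (m≤n+m (length ws) (length ys)))
                  (≤-trans (≤-reflexive (sym (trans (↭-length p) (length-++ (y ∷ ys))))) len)))
                (Allₚ.++⁻ʳ (y ∷ ys) (All-resp-↭ p cs))
        ...   | zs , rs , q , z≡1 , short = y ∷ ys ++ zs , rs
                , ↭-trans p (↭-trans (++⁺ˡ (y ∷ ys) q) (↭-reflexive (sym (++-assoc (y ∷ ys) zs rs))))
                , mod-trans (mod-reflexive (product-++ (y ∷ ys) zs)) (mod-* y≡1 z≡1) , short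

  -- The chosen values are tied to `xs` by membership in both directions, so duplicates among them
  -- can be removed later.
  choose : ∀ {A B : Set} {Q : A → B → Set} {xs} → All (λ x → ∃ (Q x)) xs →
    ∃ λ ys → (∀ {x} → x ∈ xs → ∃ λ y → y ∈ ys × Q x y) × (∀ {y} → y ∈ ys → ∃ λ x → x ∈ xs × Q x y)
  choose [] = [] , (λ ()) , (λ ())
  choose {A} {B} {Q} {x ∷ xs} ((y , q) ∷ qs) with choose qs
  ... | ys , to , from = y ∷ ys , to′ , from′
    where
    to′ : ∀ {z} → z ∈ x ∷ xs → ∃ λ w → w ∈ y ∷ ys × Q z w
    to′ (here refl) = y , here refl , q
    to′ (there z∈) with to z∈
    ... | w , w∈ , r = w , there w∈ , r
    from′ : ∀ {w} → w ∈ y ∷ ys → ∃ λ z → z ∈ x ∷ xs × Q z w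
    from′ (here refl) = x , here refl , q
    from′ (there w∈) with from w∈
    ... | z , z∈ , r = z , there z∈ , r

  -- `factors≥` says that fewer than `d` primes were left over; together with `d ≤ t` it makes
  -- `factors` nonempty.
  record Unit-product (n : ℕ) (ps : List ℕ) (t d ν : ℕ) : Set where
    field
      factors    : List ℕ
      ν≡product  : ν ≡ product factors
      ν≡1        : ν ≈ 1 [mod n ]
      factors⊆   : All (_∈ ps) factors
      factors≤   : length factors ≤ t
      factors≥   : t < length factors + d

  abstract
    -- Each choice has product ν ρ with ν ≡ 1 and ρ a product of fewer than `d` primes of `ps`. The
    -- `g ^ t` products are distinct, while ρ has at most `suc (length ps) ^ d` values, so there
    -- must be many different ν.
    unit-products : ∀ n .{{_ : NonZero n}} h → n ≤ 2 ^ h → ∀ {e ℓ} → 0 < e → e ≤ 2 ^ ℓ →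
      (∀ {x} → Coprime n x → x ^ e ≈ 1 [mod n ]) →
      ∀ t g {ps} → All Prime ps → Unique ps → All (Coprime n) ps → length ps ≡ t * g →
      ∃ λ νs → Unique νs × All (Unit-product n ps t (suc h ^ ℓ)) νs ×
        g ^ t ≤ length νs * suc (length ps) ^ (suc h ^ ℓ)
    unit-products n h n≤ {e} {ℓ} 0<e e≤ kills t g {ps} pps ups cps len =
      from-choice (choose (All.tabulate splitting))
      where
      d : ℕ
      d = suc h ^ ℓ
      ts : List (List ℕ)
      ts = choices t g ps
      Q : List ℕ → ℕ → Set
      Q T ν = ∃₂ λ zs rs → ν ≡ product zs × T ↭ zs ++ rs × product zs ≈ 1 [mod n ] × length rs < d
      splitting : ∀ {T} → T ∈ ts → ∃ (Q T)
      splitting {T} T∈ with Davenport.split-off n h n≤ {ℓ = ℓ} 0<e e≤ kills (length T) T ≤-refl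
                              (All.map (All.lookup cps) (choices-⊆ t g ps T∈))
      ... | zs , rs , p , z≡1 , short = product zs , zs , rs , refl , p , z≡1 , short

      from-choice : (∃ λ ys → (∀ {x} → x ∈ ts → ∃ λ y → y ∈ ys × Q x y) ×
                      (∀ {y} → y ∈ ys → ∃ λ x → x ∈ ts × Q x y)) →
        ∃ λ νs → Unique νs × All (Unit-product n ps t d) νs × g ^ t ≤ length νs * suc (length ps) ^ d
      from-choice (ys , to , from) = νs , UniqueDec.deduplicate-! _≟_ ys
          , All.tabulate (λ ν∈ → unit (∈-deduplicate⁻ _≟_ ys ν∈))
          , (begin
            g ^ t                                    ≡⟨ choices-length t g ps len ⟨
            length ts                                ≡⟨ length-map product ts ⟨
            length (map product ts)                  ≤⟨ unique-factors⇒length≤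
              (unique-map (choices-unique t g ps ups) (choices-product-injective t g ps pps ups)) factor ⟩
            length νs * length (products≤ d ps)      ≡⟨ cong (length νs *_) (products≤-length d ps) ⟩
            length νs * suc (length ps) ^ d          ∎)
        where
        open ≤-Reasoning
        νs : List ℕ
        νs = deduplicate _≟_ ys
        unit : ∀ {ν} → ν ∈ ys → Unit-product n ps t d ν
        unit ν∈ with from ν∈
        ... | T , T∈ , zs , rs , refl , p , z≡1 , short = record
          { factors = zs ; ν≡product = refl ; ν≡1 = z≡1
          ; factors⊆ = Allₚ.++⁻ˡ zs (All-resp-↭ p (choices-⊆ t g ps T∈))
          ; factors≤ = subst (length zs ≤_) (sym lens) (m≤m+n _ _)
          ; factors≥ = subst (_< length zs + d) (sym lens) (+-monoʳ-< (length zs) short) }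
          where
          lens : t ≡ length zs + length rs
          lens = trans (sym (choices-lengths t g ps T∈)) (trans (↭-length p) (length-++ zs))
        factor : ∀ {x} → x ∈ map product ts → ∃₂ λ ν ρ → ν ∈ νs × ρ ∈ products≤ d ps × x ≡ ν * ρ
        factor x∈ with ∈-map⁻ product x∈
        ... | T , T∈ , refl with to T∈
        ...   | ν , ν∈ , zs , rs , refl , p , z≡1 , short = product zs , product rs
                , ∈-deduplicate⁺ _≟_ ν∈
                , ∈-products≤ d ps (Allₚ.++⁻ʳ zs (All-resp-↭ p (choices-⊆ t g ps T∈))) (<⇒≤ short)
                , trans (product-↭ p) (product-++ zs rs)

  -- Primes in residue classes and progressions with a common cofactor.

  -- The assumed bound in dyadic form: if `m` has about 4 ^ i bits, then a fixed multiple of a power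
  -- of log m is at most 2 to an exponent linear in `i`.
  SmallPrimes : ℕ → ℕ → Set
  SmallPrimes b e = ∀ i m c → 2 ≤ m → m ≤ 2 ^ (4 ^ i) → ℤ.gcd c (+ m) ≡ + 1 →
    ∃ λ p → Prime p × (+ m) ℤ.∣ (+ p ℤ.- c) × p ≤ m * 2 ^ (b + e * i)

  coprime-sym : ∀ {m n} → Coprime m n → Coprime n m
  coprime-sym = Coprimality.sym

  coprime-∣a+m∣ : ∀ {a m} → Coprime ℤ.∣ a ∣ m → Coprime ℤ.∣ a ℤ.+ + m ∣ (m * ℤ.∣ a ∣)
  coprime-∣a+m∣ {a} {m} am = coprime-*
    (λ {d} (d∣c , d∣m) → am (∣⇒∣ᵤ (ℤ∣.∣m+n∣n⇒∣m {+ d} {a} {+ m} (∣ᵤ⇒∣ {+ d} {a ℤ.+ + m} d∣c) (∣ᵤ⇒∣ {+ d} {+ m} d∣m)) , d∣m))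
    (λ {d} (d∣c , d∣a) → am (d∣a , ∣⇒∣ᵤ (ℤ∣.∣m+n∣m⇒∣n {+ d} {a} {+ m} (∣ᵤ⇒∣ {+ d} {a ℤ.+ + m} d∣c) (∣ᵤ⇒∣ {+ d} {a} d∣a))))

  record PrimeAt (a : ℤ) (m bound : ℕ) : Set where
    field
      p k      : ℕ
      isPrime  : Prime p
      p≡       : + p ≡ a ℤ.+ + (m * k)
      0<k      : 0 < k
      k≤       : k ≤ bound
      coprime  : Coprime p ℤ.∣ a ∣

  coprime-p-a : ∀ {p a m} → Coprime ℤ.∣ a ∣ m → + (m * ℤ.∣ a ∣) ℤ.∣ + p ℤ.- (a ℤ.+ + m) → Coprime p ℤ.∣ a ∣
  coprime-p-a {p} {a} {m} am ma∣ {d} (d∣p , d∣a) = am (d∣a , ∣⇒∣ᵤ d∣m)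
    where
    p-c = + p ℤ.- (a ℤ.+ + m)
    lemma : ∀ p a m → p ℤ.- (p ℤ.- (a ℤ.+ m)) ℤ.- a ≡ m
    lemma = solveℤ
    d∣m : + d ℤ∣.∣ + m
    d∣m = subst (+ d ℤ∣.∣_) (lemma (+ p) a (+ m))
      (ℤ∣.∣m∣n⇒∣m-n {+ d} {+ p ℤ.- p-c} {a} (ℤ∣.∣m∣n⇒∣m-n {+ d} {+ p} {p-c} (∣ᵤ⇒∣ {+ d} {+ p} d∣p)
        (∣ᵤ⇒∣ {+ d} {p-c} (∣-trans d∣a (∣-trans (n∣m*n m) ma∣)))) (∣ᵤ⇒∣ {+ d} {a} d∣a))

  -- Shifting the residue class from a to a + m modulo m∣a∣ makes p coprime to a,
  -- which excludes p = a.
  prime-at : ∀ {b e} → SmallPrimes b e → ∀ {α} i a m → 0 < ℤ.∣ a ∣ → ℤ.∣ a ∣ ≤ 2 ^ α → ℤ.∣ a ∣ ≤ m → 2 ≤ m →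
    Coprime ℤ.∣ a ∣ m → m * ℤ.∣ a ∣ ≤ 2 ^ (4 ^ i) → PrimeAt a m (2 ^ (α + b + 1 + e * i))
  prime-at {b} {e} primes {α} i a m 0<a a≤2^α a≤m 2≤m am small =
    from-prime (primes i (m * ℤ.∣ a ∣) (a ℤ.+ + m) (≤-trans 2≤m (m≤m*n m ℤ.∣ a ∣ {{>-nonZero 0<a}})) small
      (cong +_ (coprime⇒gcd≡1 (coprime-∣a+m∣ {a} am))))
    where
    X = 2 ^ (b + e * i)
    from-prime : (∃ λ p → Prime p × + (m * ℤ.∣ a ∣) ℤ.∣ (+ p ℤ.- (a ℤ.+ + m)) × p ≤ m * ℤ.∣ a ∣ * X) →
      PrimeAt a m (2 ^ (α + b + 1 + e * i))
    from-prime (p , pp , ma∣ , p≤) = from-quotient (∣ᵤ⇒∣ (∣-trans (m∣m*n ℤ.∣ a ∣) ma∣))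
      where
      pa = coprime-p-a {p} {a} am ma∣
      from-quotient : + m ℤ∣.∣ + p ℤ.- (a ℤ.+ + m) → PrimeAt a m (2 ^ (α + b + 1 + e * i))
      -- `z` is counted from a + m, so the cofactor counted from `a` is z + 1.
      from-quotient (ℤ∣.divides z eq) = at (ℤ.suc z) p≡
        where
        lemma₁ : ∀ p a m → p ≡ a ℤ.+ ((p ℤ.- (a ℤ.+ m)) ℤ.+ m)
        lemma₁ = solveℤ
        lemma₂ : ∀ m z → z ℤ.* m ℤ.+ m ≡ m ℤ.* (+ 1 ℤ.+ z)
        lemma₂ = solveℤ
        p≡ : + p ≡ a ℤ.+ + m ℤ.* ℤ.suc z
        p≡ = trans (lemma₁ (+ p) a (+ m)) (cong (λ y → a ℤ.+ y) (trans (cong (λ y → y ℤ.+ + m) eq) (lemma₂ (+ m) z)))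
        at : ∀ y → + p ≡ a ℤ.+ + m ℤ.* y → PrimeAt a m (2 ^ (α + b + 1 + e * i))
        at (+ zero) eq = ⊥-elim (¬prime[1] (subst Prime (pa (∣-refl , subst (p ∣_) (cong ℤ.∣_∣ p≡a) ∣-refl)) pp))
          where
          p≡a : + p ≡ a
          p≡a = trans eq (trans (cong (λ y → a ℤ.+ y) (ℤₚ.*-zeroʳ (+ m))) (ℤₚ.+-identityʳ a))
        -- A negative cofactor would give a = p + m (k + 1) > m.
        at -[1+ k ] eq = ⊥-elim (<-irrefl refl (<-≤-trans
            (subst (m <_) (sym (cong ℤ.∣_∣ a≡)) (+-mono-<-≤ (>-nonZero⁻¹ p {{prime⇒nonZero pp}}) (m≤m*n m (suc k)))) a≤m))
          where
          lemma : ∀ a y → a ≡ (a ℤ.+ y) ℤ.- y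
          lemma = solveℤ
          a≡ : a ≡ + (p + m * suc k)
          a≡ = trans (lemma a (+ m ℤ.* -[1+ k ])) (trans (cong (λ y → y ℤ.- (+ m ℤ.* -[1+ k ])) (sym eq))
            (cong (λ y → + p ℤ.+ y) (trans (ℤₚ.neg-distribʳ-* (+ m) -[1+ k ]) (sym (ℤₚ.pos-* m (suc k))))))
        at (+ suc k) eq = record { p = p ; k = suc k ; isPrime = pp ; p≡ = eq′ ; 0<k = z<s ; k≤ = k≤ ; coprime = pa }
          where
          eq′ : + p ≡ a ℤ.+ + (m * suc k)
          eq′ = trans eq (cong (λ y → a ℤ.+ y) (sym (ℤₚ.pos-* m (suc k))))
          lemma : ∀ x y → y ≡ (x ℤ.+ y) ℤ.- x
          lemma = solveℤ
          arith : ∀ m a x → m * a * x + a * m ≡ m * (a * (x + 1))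
          arith = solveℕ
          open ≤-Reasoning
          X≥1 : 1 ≤ X
          X≥1 = m^n>0 2 (b + e * i)
          k≤ : suc k ≤ 2 ^ (α + b + 1 + e * i)
          k≤ = *-cancelˡ-≤ m {{>-nonZero (≤-trans (s≤s z≤n) 2≤m)}} (begin
            m * suc k                        ≡⟨ cong ℤ.∣_∣ (trans (lemma a _) (cong (λ y → y ℤ.- a) (sym eq′))) ⟩
            ℤ.∣ + p ℤ.- a ∣                  ≤⟨ ℤₚ.∣i-j∣≤∣i∣+∣j∣ (+ p) a ⟩
            p + ℤ.∣ a ∣                      ≤⟨ +-mono-≤ p≤ (m≤m*n ℤ.∣ a ∣ m {{>-nonZero (≤-trans (s≤s z≤n) 2≤m)}}) ⟩
            m * ℤ.∣ a ∣ * X + ℤ.∣ a ∣ * m    ≡⟨ arith m ℤ.∣ a ∣ X ⟩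
            m * (ℤ.∣ a ∣ * (X + 1))          ≤⟨ *-monoʳ-≤ m (*-mono-≤ a≤2^α (+-monoʳ-≤ X X≥1)) ⟩
            m * (2 ^ α * (X + X))            ≡⟨ cong (λ y → m * (2 ^ α * (X + y))) (+-identityʳ X) ⟨
            m * (2 ^ α * 2 ^ (1 + (b + e * i))) ≡⟨ cong (m *_) (^-distribˡ-+-* 2 α (1 + (b + e * i))) ⟨
            m * 2 ^ (α + (1 + (b + e * i)))  ≡⟨ cong (λ y → m * 2 ^ y) (exps α b (e * i)) ⟩
            m * 2 ^ (α + b + 1 + e * i)      ∎)
            where
            exps : ∀ α b x → α + (1 + (b + x)) ≡ α + b + 1 + x
            exps = solveℕ

  n≤2^n : ∀ n → n ≤ 2 ^ n
  n≤2^n zero = z≤n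
  n≤2^n (suc n) = +-mono-≤ (m^n>0 2 n) (≤-trans (n≤2^n n) (m≤m+n (2 ^ n) 0))

  n≤4^n : ∀ n → n ≤ 4 ^ n
  n≤4^n n = ≤-trans (n≤2^n n) (^-monoˡ-≤ n (s≤s (s≤s z≤n)))

  product≤2^ : ∀ β {xs} → All (_≤ 2 ^ β) xs → product xs ≤ 2 ^ (β * length xs)
  product≤2^ β [] = m^n>0 2 (β * 0)
  product≤2^ β {x ∷ xs} (x≤ ∷ xs≤) = ≤-trans (*-mono-≤ x≤ (product≤2^ β xs≤))
    (≤-reflexive (trans (sym (^-distribˡ-+-* 2 β (β * length xs))) (cong (2 ^_) (sym (*-suc β (length xs))))))

  coprime-2^ : ∀ {x} n → Coprime x 2 → Coprime x (2 ^ n)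
  coprime-2^ zero    _ = coprime-sym (Coprimality.1-coprimeTo _)
  coprime-2^ (suc n) c = coprime-* c (coprime-2^ n c)

  unique-map-via-key : ∀ {A : Set} {key g : A → ℕ} {P : A → Set} {xs} → Unique (map key xs) → All P xs →
    (∀ {x y} → P x → P y → g x ≡ g y → key x ≡ key y) → Unique (map g xs)
  unique-map-via-key {xs = []} [] [] inj = []
  unique-map-via-key {xs = x ∷ xs} (x∉ ∷ u) (px ∷ pxs) inj =
    Allₚ.map⁺ (All.zipWith (λ (py , key≢) g≡ → key≢ (inj px py g≡)) (pxs , Allₚ.map⁻ x∉))
    ∷ unique-map-via-key u pxs inj

  monochromatic : ∀ {A : Set} (key colour : A → ℕ) K n {xs} .{{_ : NonZero K}} → Unique (map key xs) →
    All (λ x → colour x < K) xs → K * n ≤ length xs →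
    ∃₂ λ j ys → length ys ≡ n × All (λ y → colour y ≡ j) ys × Unique (map key ys)
  monochromatic {A} key colour K n {xs} u colours large = from (Pigeonhole.large-class colour is? K xs colours)
    where
    is? : ∀ {x} j → Dec (colour x ≡ j)
    is? {x} j = colour x ≟ j
    from : (∃ λ j → length xs ≤ K * length (Pigeonhole.class colour is? j xs)) →
      ∃₂ λ j ys → length ys ≡ n × All (λ y → colour y ≡ j) ys × Unique (map key ys)
    from (j , le) = j , take n ys
      , trans (length-take n ys) (m≤n⇒m⊓n≡m (*-cancelˡ-≤ K (≤-trans large le)))
      , Allₚ.take⁺ n (Allₚ.all-filter (λ x → is? {x} j) xs)
      , AllPairsₚ.map⁺ (AllPairsₚ.take⁺ n (AllPairsₚ.filter⁺ (λ x → is? {x} j) (AllPairsₚ.map⁻ u)))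
      where
      ys : List A
      ys = Pigeonhole.class colour is? j xs

  +-cancelˡ-ℤ : ∀ a {x y} → a ℤ.+ x ≡ a ℤ.+ y → x ≡ y
  +-cancelˡ-ℤ a {x} {y} eq = trans (lemma a x) (trans (cong (λ t → t ℤ.- a) eq) (sym (lemma a y)))
    where
    lemma : ∀ a x → x ≡ (a ℤ.+ x) ℤ.- a
    lemma = solveℤ

  map-proj₁-toList : ∀ {A : Set} {P : A → Set} {xs} (ps : All P xs) → map proj₁ (All.toList ps) ≡ xs
  map-proj₁-toList [] = refl
  map-proj₁-toList (p ∷ ps) = cong (_ ∷_) (map-proj₁-toList ps)

  record PrimeList (n bound : ℕ) : Set where
    field
      list     : List ℕ
      length≡  : length list ≡ n
      allPrime : All Prime list
      unique   : Unique list
      product≤ : product list ≤ 2 ^ bound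

  -- The bounds on `k` sit with the members, since an empty list would give no information about
  -- `k`.
  record Progression (a : ℤ) (G M κ n : ℕ) : Set where
    field
      k        : ℕ
      list     : List ℕ
      length≡  : length list ≡ n
      unique   : Unique list
      members  : All (λ p → Prime p × Coprime p ℤ.∣ a ∣ × 0 < k × k ≤ 2 ^ κ ×
                   ∃ λ d → d ∣ M × + p ≡ a ℤ.+ + (G * d * k)) list

  module _ {b e} (primes : SmallPrimes b e) where

    -- The residue class fixes the 2-adic valuation of p - 1, so different `i` give different primes
    -- without any comparison of sizes. The exponent in the bound is linear in `i`, whence log M is
    -- quadratic in the number of primes.
    prime-2^ : ∀ i → ∃ λ p → Prime p × (+ (2 ^ (2 + i))) ℤ.∣ (+ p ℤ.- + (1 + 2 ^ (1 + i))) ×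
      p ≤ 2 ^ ((1 + b + e) * (2 + i))
    prime-2^ i = from (primes (2 + i) (2 ^ (2 + i)) (+ (1 + 2 ^ (1 + i)))
        (^-monoʳ-≤ 2 (s≤s {0} {suc i} z≤n)) (^-monoʳ-≤ 2 (n≤4^n (2 + i)))
        (cong +_ (coprime⇒gcd≡1 (coprime-2^ (2 + i) odd))))
      where
      odd : Coprime (1 + 2 ^ (1 + i)) 2
      odd {d} (d∣ , d∣2) = ∣1⇒≡1 (∣m+n∣m⇒∣n {m = 2 ^ (1 + i)}
        (subst (d ∣_) (+-comm 1 (2 ^ (1 + i))) d∣) (∣m⇒∣m*n (2 ^ i) d∣2))
      exps : ∀ b e j → (2 + j) + (b + e * (2 + j)) + b * (1 + j) ≡ (1 + b + e) * (2 + j)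
      exps = solveℕ
      from : (∃ λ p → Prime p × (+ (2 ^ (2 + i))) ℤ.∣ (+ p ℤ.- + (1 + 2 ^ (1 + i))) ×
               p ≤ 2 ^ (2 + i) * 2 ^ (b + e * (2 + i))) →
        ∃ λ p → Prime p × (+ (2 ^ (2 + i))) ℤ.∣ (+ p ℤ.- + (1 + 2 ^ (1 + i))) ×
          p ≤ 2 ^ ((1 + b + e) * (2 + i))
      from (p , pp , m∣ , p≤) = p , pp , m∣ , (begin
        p                                          ≤⟨ p≤ ⟩
        2 ^ (2 + i) * 2 ^ (b + e * (2 + i))        ≡⟨ ^-distribˡ-+-* 2 (2 + i) (b + e * (2 + i)) ⟨
        2 ^ ((2 + i) + (b + e * (2 + i)))          ≤⟨ ^-monoʳ-≤ 2 (m≤m+n ((2 + i) + (b + e * (2 + i))) (b * (1 + i))) ⟩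
        2 ^ ((2 + i) + (b + e * (2 + i)) + b * (1 + i)) ≡⟨ cong (2 ^_) (exps b e i) ⟩
        2 ^ ((1 + b + e) * (2 + i))                ∎)
        where open ≤-Reasoning

    r : ℕ → ℕ
    r i = proj₁ (prime-2^ i)

    -- r i - 1 has 2-adic valuation 1 + i.
    r-injective : ∀ {i j} → i < j → r i ≢ r j
    r-injective {i} {j} i<j eq = <⇒≱ (^-monoʳ-< 2 (s≤s (s≤s z≤n)) (n<1+n (1 + i))) (∣⇒≤ {{m^n≢0 2 (1 + i)}} (∣⇒∣ᵤ div))
      where
      x = 2 ^ (1 + i)
      y = 2 ^ (1 + j)
      divᵢ : + 2 ^ (2 + i) ℤ∣.∣ + r i ℤ.- + (1 + x)
      divᵢ = ∣ᵤ⇒∣ (proj₁ (proj₂ (proj₂ (prime-2^ i))))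
      div-y : + 2 ^ (2 + i) ℤ∣.∣ + y
      div-y = ∣ᵤ⇒∣ (m≤n⇒m^n∣m^o (s≤s i<j))
        where
        m≤n⇒m^n∣m^o : ∀ {m n} → m ≤ n → 2 ^ m ∣ 2 ^ n
        m≤n⇒m^n∣m^o {m} {n} m≤n = subst (2 ^ m ∣_)
          (trans (sym (^-distribˡ-+-* 2 m (n ∸ m))) (cong (2 ^_) (m+[n∸m]≡n m≤n))) (m∣m*n (2 ^ (n ∸ m)))
      divⱼ : + 2 ^ (2 + i) ℤ∣.∣ + r j ℤ.- + (1 + y)
      divⱼ = ℤ∣.∣-trans (ℤ∣.∣-trans div-y (∣ᵤ⇒∣ {+ y} {+ (2 ^ (2 + j))} (n∣m*n 2))) (∣ᵤ⇒∣ (proj₁ (proj₂ (proj₂ (prime-2^ j)))))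
      lemma : ∀ r x y → ((r ℤ.- (+ 1 ℤ.+ y)) ℤ.+ y) ℤ.- (r ℤ.- (+ 1 ℤ.+ x)) ≡ x
      lemma = solveℤ
      div : + 2 ^ (2 + i) ℤ∣.∣ + x
      div = subst (+ 2 ^ (2 + i) ℤ∣.∣_) (lemma (+ r j) (+ x) (+ y))
        (ℤ∣.∣m∣n⇒∣m-n (ℤ∣.∣m∣n⇒∣m+n divⱼ div-y)
          (subst (λ p → + 2 ^ (2 + i) ℤ∣.∣ + p ℤ.- + (1 + x)) eq divᵢ))

    distinct-primes : ∀ s → PrimeList s ((1 + b + e) * (1 + s) * s)
    distinct-primes s = record
      { list = rs
      ; length≡ = length-applyUpTo r s
      ; allPrime = Allₚ.applyUpTo⁺₂ r s (λ i → proj₁ (proj₂ (prime-2^ i)))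
      ; unique = Uniqueₚ.applyUpTo⁺₁ r s (λ i<j _ → r-injective i<j)
      ; product≤ = subst (λ t → product rs ≤ 2 ^ ((1 + b + e) * (1 + s) * t)) (length-applyUpTo r s)
          (product≤2^ ((1 + b + e) * (1 + s)) (Allₚ.applyUpTo⁺₁ r s λ {i} i<s →
            ≤-trans (proj₂ (proj₂ (proj₂ (prime-2^ i)))) (^-monoʳ-≤ 2 (*-monoʳ-≤ (1 + b + e) (s≤s i<s)))))
      }
      where
      rs : List ℕ
      rs = applyUpTo r s

    -- Divisors with a common cofactor give distinct primes a + G d k. The cofactors lie among
    -- `suc (2 ^ κ)` ≤ 2 ^ (1 + κ) colours, hence the 1 in the last hypothesis. Both families of
    -- primes arise here: `r` with a = 1 and G = 2 ^ κ, and `p` with G = L₀.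
    progression : ∀ {α} i a G {xs} → 0 < ℤ.∣ a ∣ → ℤ.∣ a ∣ ≤ 2 ^ α → ℤ.∣ a ∣ ≤ G → 2 ≤ G →
      Coprime ℤ.∣ a ∣ G → Coprime ℤ.∣ a ∣ (product xs) → All Prime xs → Unique xs →
      G * product xs * ℤ.∣ a ∣ ≤ 2 ^ (4 ^ i) → ∀ n → 2 ^ (1 + (α + b + 1 + e * i)) * n ≤ 2 ^ length xs →
      Progression a G (product xs) (α + b + 1 + e * i) n
    progression {α} i a G {xs} 0<a a≤2^α a≤G 2≤G aG aM pxs uxs small n large =
      from (monochromatic proj₁ colour (suc (2 ^ κ)) n {elems}
        (subst Unique (sym (map-proj₁-toList found)) (divisors-unique pxs uxs))
        (All.universal (λ x → s≤s (PrimeAt.k≤ (proj₂ (proj₂ x)))) elems)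
        (≤-trans (*-monoˡ-≤ n (≤-trans (+-monoˡ-≤ (2 ^ κ) (m^n>0 2 κ)) (+-monoʳ-≤ (2 ^ κ) (m≤m+n (2 ^ κ) 0))))
          (≤-trans large (≤-reflexive (trans (sym (divisors-length xs))
            (trans (cong length (sym (map-proj₁-toList found))) (length-map proj₁ elems)))))))
      where
      κ = α + b + 1 + e * i
      M = product xs
      instance
        M≢0 : NonZero M
        M≢0 = productOfPrimes≢0 pxs
      Elem : ℕ → Set
      Elem d = d ∣ M × PrimeAt a (G * d) (2 ^ κ)
      0<d : ∀ {d} → d ∣ M → 0 < d
      0<d {zero} 0∣M = ⊥-elim (≢-nonZero⁻¹ M (0∣⇒≡0 0∣M))
      0<d {suc d} _ = z<s
      found : All Elem (divisors xs)
      found = All.map (λ {d} d∣M → d∣M , prime-at {b} {e} primes {α} i a (G * d) 0<a a≤2^α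
          (≤-trans a≤G (m≤m*n G d {{>-nonZero (0<d d∣M)}}))
          (≤-trans 2≤G (m≤m*n G d {{>-nonZero (0<d d∣M)}}))
          (coprime-* aG (λ (c∣a , c∣d) → aM (c∣a , ∣-trans c∣d d∣M)))
          (≤-trans (*-monoˡ-≤ ℤ.∣ a ∣ (*-monoʳ-≤ G (∣⇒≤ d∣M))) small))
        (divisors-∣ xs)
      elems : List (∃ Elem)
      elems = All.toList found
      colour : ∃ Elem → ℕ
      colour x = PrimeAt.k (proj₂ (proj₂ x))
      from : (∃₂ λ j ys → length ys ≡ n × All (λ y → colour y ≡ j) ys × Unique (map proj₁ ys)) →
        Progression a G M κ n
      from (j , ys , len , cols , u) = record
        { k = j
        ; list = map val ys
        ; length≡ = trans (length-map val ys) len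
        ; unique = unique-map-via-key u cols (λ {x} {y} → inj x y)
        ; members = Allₚ.map⁺ (All.map (λ {x} → member x) cols)
        }
        where
        val : ∃ Elem → ℕ
        val x = PrimeAt.p (proj₂ (proj₂ x))
        member : ∀ x → colour x ≡ j → Prime (val x) × Coprime (val x) ℤ.∣ a ∣ × 0 < j × j ≤ 2 ^ κ ×
          ∃ λ d → d ∣ M × + val x ≡ a ℤ.+ + (G * d * j)
        member (d , d∣M , pa) refl = isPrime , coprime , 0<k , k≤ , d , d∣M , p≡
          where open PrimeAt pa
        inj : ∀ x y → colour x ≡ j → colour y ≡ j → val x ≡ val y → proj₁ x ≡ proj₁ y
        inj (d , _ , pa) (d′ , _ , pa′) refl kd≡ p≡ = *-cancelˡ-≡ d d′ G {{G≢0}} (*-cancelʳ-≡ (G * d) (G * d′)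
          (PrimeAt.k pa) {{>-nonZero (PrimeAt.0<k pa)}} (ℤₚ.+-injective (+-cancelˡ-ℤ a (begin
            a ℤ.+ + (G * d * PrimeAt.k pa)     ≡⟨ PrimeAt.p≡ pa ⟨
            + PrimeAt.p pa                     ≡⟨ cong +_ p≡ ⟩
            + PrimeAt.p pa′                    ≡⟨ PrimeAt.p≡ pa′ ⟩
            a ℤ.+ + (G * d′ * PrimeAt.k pa′)   ≡⟨ cong (λ k → a ℤ.+ + (G * d′ * k)) kd≡ ⟩
            a ℤ.+ + (G * d′ * PrimeAt.k pa)    ∎))))
          where
          open ≡-Reasoning
          G≢0 : NonZero G
          G≢0 = >-nonZero (≤-trans (s≤s z≤n) 2≤G)

  -- Building a-Carmichael numbers from smooth primes.

  prime≥2 : ∀ {p} → Prime p → 2 ≤ p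
  prime≥2 {zero} pp = ⊥-elim (¬prime[0] pp)
  prime≥2 {suc zero} pp = ⊥-elim (¬prime[1] pp)
  prime≥2 {2+ p} pp = s≤s (s≤s z≤n)

  2^≤product : ∀ {ps} → All Prime ps → 2 ^ length ps ≤ product ps
  2^≤product [] = ≤-refl
  2^≤product (pp ∷ pps) = *-mono-≤ (prime≥2 pp) (2^≤product pps)

  -- q ν - a = q (ν - 1) + (q - a), and n₀ = q - a divides both terms.
  carmichael : ∀ {a n₀ q ν zs} → Prime q → + q ≡ a ℤ.+ + n₀ → ν ≈ 1 [mod n₀ ] → ν ≡ product zs → 0 < length zs →
    All (λ p → Prime p × (+ p ℤ.- a) ℤ.∣ + n₀) zs → IsCarmichael a (q * ν)
  carmichael {a} {n₀} {q} {ν} {z ∷ zs} pq q≡ (congruent ν≡1) refl _ ps = composite , divides-all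
    where
    instance
      q≢0 : NonZero q
      q≢0 = prime⇒nonZero pq
      q-nontrivial : NonTrivial q
      q-nontrivial = prime⇒nonTrivial pq
      ν≢0 : NonZero ν
      ν≢0 = productOfPrimes≢0 (All.map proj₁ ps)
    composite : Composite (q * ν)
    composite = composite-≢ q {{q-nontrivial}} {{m*n≢0 q ν}}
      (λ q≡qν → <⇒≢ (≤-trans (m^n>1 zs) (2^≤product (All.map proj₁ ps)))
        (*-cancelˡ-≡ 1 ν q (trans (*-identityʳ q) q≡qν)))
      (m∣m*n ν)
      where
      m^n>1 : ∀ zs → 1 < 2 ^ suc (length zs)
      m^n>1 zs = ^-monoʳ-< 2 (s≤s (s≤s z≤n)) {0} {suc (length zs)} z<s
    lemma₁ : ∀ a n → a ℤ.+ n ℤ.- a ≡ n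
    lemma₁ = solveℤ
    lemma₂ : ∀ a n ν → (a ℤ.+ n) ℤ.* (ν ℤ.- + 1) ℤ.+ n ≡ (a ℤ.+ n) ℤ.* ν ℤ.- a
    lemma₂ = solveℤ
    n₀∣ : + n₀ ℤ∣.∣ + (q * ν) ℤ.- a
    n₀∣ = subst (+ n₀ ℤ∣.∣_)
      (trans (lemma₂ a (+ n₀) (+ ν)) (cong (λ t → t ℤ.- a) (trans (cong (λ t → t ℤ.* + ν) (sym q≡)) (sym (ℤₚ.pos-* q ν)))))
      (ℤ∣.∣m∣n⇒∣m+n (ℤ∣.∣n⇒∣m*n (a ℤ.+ + n₀) ν≡1) ℤ∣.∣-refl)
    q-a : + q ℤ.- a ≡ + n₀
    q-a = trans (cong (λ t → t ℤ.- a) q≡) (lemma₁ a (+ n₀))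
    divides-all : ∀ p → Prime p → p ∣ q * ν → (+ p ℤ.- a) ℤ.∣ (+ (q * ν) ℤ.- a)
    divides-all p pp p∣ with euclidsLemma q ν pp p∣
    ... | inj₁ p∣q = ∣⇒∣ᵤ (subst (ℤ∣._∣ + (q * ν) ℤ.- a)
      (sym (trans (cong (λ t → + t ℤ.- a) (prime∣prime⇒≡ pp pq p∣q)) q-a)) n₀∣)
    ... | inj₂ p∣ν = ∣⇒∣ᵤ (ℤ∣.∣-trans (∣ᵤ⇒∣ {+ p ℤ.- a} {+ n₀} (proj₂ (All.lookup ps
      (factorisationHasAllPrimeFactors pp p∣ν (All.map proj₁ ps))))) n₀∣)

  p-a∣ : ∀ {a p m n} → + p ≡ a ℤ.+ + m → m ∣ n → (+ p ℤ.- a) ℤ.∣ + n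
  p-a∣ {a} {p} {m} {n} p≡ m∣n = subst (λ z → z ℤ.∣ + n) (sym (trans (cong (λ t → t ℤ.- a) p≡) (lemma a (+ m)))) m∣n
    where
    lemma : ∀ a n → a ℤ.+ n ℤ.- a ≡ n
    lemma = solveℤ

  -- A common divisor of `k` and one of `p`, `a` divides the other as well, because `p` and `a`
  -- differ by a multiple of `k`.
  coprime-quotient : ∀ {a p G k} → + p ≡ a ℤ.+ + (G * k) → Coprime p ℤ.∣ a ∣ → Coprime p k × Coprime ℤ.∣ a ∣ k
  coprime-quotient {a} {p} {G} {k} p≡ pa = p-k , a-k
    where
    lemma : ∀ a n → a ℤ.+ n ℤ.- n ≡ a
    lemma = solveℤ
    p-k : Coprime p k
    p-k {d} (d∣p , d∣k) = pa (d∣p , ∣⇒∣ᵤ (subst (+ d ℤ∣.∣_)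
      (trans (cong (λ t → t ℤ.- + (G * k)) p≡) (lemma a (+ (G * k))))
      (ℤ∣.∣m∣n⇒∣m-n {+ d} {+ p} {+ (G * k)} (∣ᵤ⇒∣ d∣p) (∣ᵤ⇒∣ (∣n⇒∣m*n G d∣k)))))
    a-k : Coprime ℤ.∣ a ∣ k
    a-k {d} (d∣a , d∣k) = pa (∣⇒∣ᵤ (subst (+ d ℤ∣.∣_) (sym p≡)
      (ℤ∣.∣m∣n⇒∣m+n {+ d} {a} {+ (G * k)} (∣ᵤ⇒∣ d∣a) (∣ᵤ⇒∣ (∣n⇒∣m*n G d∣k)))) , d∣a)

  ≤-of-≡ : ∀ {a p m} → + p ≡ a ℤ.+ + m → p ≤ ℤ.∣ a ∣ + m × m ≤ p + ℤ.∣ a ∣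
  ≤-of-≡ {a} {p} {m} p≡ = subst (_≤ ℤ.∣ a ∣ + m) (cong ℤ.∣_∣ (sym p≡)) (ℤₚ.∣i+j∣≤∣i∣+∣j∣ a (+ m))
    , subst (_≤ p + ℤ.∣ a ∣) (cong ℤ.∣_∣ (trans (cong (λ t → t ℤ.- a) p≡) (lemma a (+ m)))) (ℤₚ.∣i-j∣≤∣i∣+∣j∣ (+ p) a)
    where
    lemma : ∀ a n → a ℤ.+ n ℤ.- a ≡ n
    lemma = solveℤ

  0<length⇒∈ : ∀ {xs : List ℕ} → 0 < length xs → ∃ λ x → x ∈ xs
  0<length⇒∈ {x ∷ _} _ = x , here refl

  -- The primes `r`. `E` is a common multiple of all r - 1 with only `bound` bits, although there
  -- may be exponentially many primes; `large` makes them coprime to every positive number up to 2 ^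
  -- κ.
  record SmoothPrimes (n κ Q bound : ℕ) : Set where
    field
      list     : List ℕ
      length≡  : length list ≡ n
      allPrime : All Prime list
      unique   : Unique list
      E        : ℕ
      0<E      : 0 < E
      E≤       : E ≤ 2 ^ bound
      q∸1∣E    : All (λ q → q ∸ 1 ∣ E) list
      large    : All (2 ^ κ <_) list
      small    : All (_≤ 2 ^ Q) list

  module _ {b e} (primes : SmallPrimes b e) where

    abstract
      smooth-primes : ∀ κ i n s → 1 ≤ κ → 0 < n →
        let S  = (1 + b + e) * (1 + s) * s
            κ₁ = b + 1 + e * i
        in κ + S ≤ 4 ^ i → 2 ^ (1 + κ₁) * n ≤ 2 ^ s → SmoothPrimes n κ (1 + (κ + S + κ₁)) (κ + S + κ₁)
      smooth-primes κ i n s 1≤κ 0<n small large = from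
        -- The members are 1 + 2 ^ κ d k with d dividing `M`, so E = 2 ^ κ M k is a multiple of
        -- every member minus 1, and the factor 2 ^ κ forces `large`.
        (progression {b} {e} primes {0} i (+ 1) (2 ^ κ) {list} z<s ≤-refl (m^n>0 2 κ) (^-monoʳ-≤ 2 1≤κ)
          (Coprimality.1-coprimeTo _) (Coprimality.1-coprimeTo _) allPrime unique
          (begin
            2 ^ κ * product list * 1    ≡⟨ *-identityʳ _ ⟩
            2 ^ κ * product list        ≤⟨ *-monoʳ-≤ (2 ^ κ) product≤ ⟩
            2 ^ κ * 2 ^ S               ≡⟨ ^-distribˡ-+-* 2 κ S ⟨
            2 ^ (κ + S)                 ≤⟨ ^-monoʳ-≤ 2 small ⟩
            2 ^ (4 ^ i)                 ∎)
          n (subst (λ y → 2 ^ (1 + κ₁) * n ≤ 2 ^ y) (sym length≡) large))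
        where
        open ≤-Reasoning
        open PrimeList (distinct-primes {b} {e} primes s)
        S κ₁ M : ℕ
        S = (1 + b + e) * (1 + s) * s
        κ₁ = b + 1 + e * i
        M = product list
        instance
          M≢0 : NonZero M
          M≢0 = productOfPrimes≢0 allPrime
        from : Progression (+ 1) (2 ^ κ) M κ₁ n → SmoothPrimes n κ (1 + (κ + S + κ₁)) (κ + S + κ₁)
        from P = record
          { list = P.list ; length≡ = P.length≡ ; allPrime = All.map proj₁ P.members ; unique = P.unique
          ; E = E
          ; 0<E = *-mono-≤ (*-mono-≤ (m^n>0 2 κ) (>-nonZero⁻¹ M)) (proj₁ k-bounds)
          ; E≤ = E≤
          ; q∸1∣E = All.map (λ m → proj₁ (shape m)) P.members
          ; large = All.map (λ m → proj₁ (proj₂ (shape m))) P.members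
          ; small = All.map (λ m → proj₂ (proj₂ (shape m))) P.members
          }
          where
          module P = Progression P
          E : ℕ
          E = 2 ^ κ * M * P.k
          Member : ℕ → Set
          Member p = Prime p × Coprime p 1 × 0 < P.k × P.k ≤ 2 ^ κ₁ ×
                     ∃ λ d → d ∣ M × + p ≡ + 1 ℤ.+ + (2 ^ κ * d * P.k)
          k-bounds : 0 < P.k × P.k ≤ 2 ^ κ₁
          k-bounds with 0<length⇒∈ (subst (0 <_) (sym P.length≡) 0<n)
          ... | q , q∈ with All.lookup P.members q∈
          ...   | _ , _ , 0<k , k≤ , _ = 0<k , k≤
          E≤ : E ≤ 2 ^ (κ + S + κ₁)
          E≤ = begin
            2 ^ κ * M * P.k            ≤⟨ *-mono-≤ (*-monoʳ-≤ (2 ^ κ) product≤) (proj₂ k-bounds) ⟩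
            2 ^ κ * 2 ^ S * 2 ^ κ₁     ≡⟨ cong (_* 2 ^ κ₁) (^-distribˡ-+-* 2 κ S) ⟨
            2 ^ (κ + S) * 2 ^ κ₁       ≡⟨ ^-distribˡ-+-* 2 (κ + S) κ₁ ⟨
            2 ^ (κ + S + κ₁)           ∎
          shape : ∀ {q} → Member q → q ∸ 1 ∣ E × 2 ^ κ < q × q ≤ 2 ^ (1 + (κ + S + κ₁))
          shape {q} (_ , _ , 0<k , k≤ , d , d∣M , q≡) = subst (λ q → q ∸ 1 ∣ E × 2 ^ κ < q × q ≤ 2 ^ (1 + (κ + S + κ₁)))
            (sym (ℤₚ.+-injective q≡))
            ( y∣E
            , s≤s (≤-trans (m≤m*n (2 ^ κ) d {{d≢0}}) (m≤m*n (2 ^ κ * d) P.k {{>-nonZero 0<k}}))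
            , +-mono-≤ (m^n>0 2 (κ + S + κ₁)) (≤-trans (≤-trans (∣⇒≤ {{>-nonZero 0<E}} y∣E) E≤) (m≤m+n _ 0)))
            where
            0<E : 0 < E
            0<E = *-mono-≤ (*-mono-≤ (m^n>0 2 κ) (>-nonZero⁻¹ M)) 0<k
            d≢0 : NonZero d
            d≢0 = >-nonZero (n≢0⇒n>0 λ { refl → ≢-nonZero⁻¹ M (0∣⇒≡0 d∣M) })
            y∣E : 2 ^ κ * d * P.k ∣ E
            y∣E = *-monoˡ-∣ P.k (*-monoʳ-∣ (2 ^ κ) d∣M)

    abstract
      -- `h` bounds the bits of n₀ = k j L: κ each for `k` and `j`, and Q for each of the 2 w primes
      -- of `L`. The exponent of the unit group is at most E k j ≤ 2 ^ (B + 2 κ), which gives `d` as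
      -- the length of a rest. The conditions κ < Q < w serve the comparisons of size behind
      -- coprimality.
      carmichaels : ∀ {α} a → 0 < ℤ.∣ a ∣ → ℤ.∣ a ∣ ≤ 2 ^ α → ∀ i w {Q B} t g →
        let κ = α + b + 1 + e * i
            h = κ + κ + Q * (w + w)
            d = suc h ^ (B + (κ + κ))
        in SmoothPrimes (w + w) κ Q B → κ < Q → Q < w → κ + Q * (w + w) + α ≤ 4 ^ i →
           2 ^ (1 + κ) * (t * g) ≤ 2 ^ w → d ≤ t → 0 < g →
        ∃ λ ns → Unique ns × All (λ n → IsCarmichael a n × n ≤ 2 ^ ((1 + h) * (1 + t)) × 2 ^ κ < n) ns ×
          g ^ t ≤ length ns * suc (t * g) ^ d
      carmichaels {α} a 0<a a≤2^α i w {Q} {B} t g SP κ<Q Q<w fits large d≤t 0<g =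
        from-progression (progression {b} {e} primes {α} i a L₀ {qs₁} 0<a a≤2^α
          (≤-trans a≤2^α (≤-trans (^-monoʳ-≤ 2 (<⇒≤ (<-trans α<Q Q<w))) L₀≥))
          (≤-trans (^-monoʳ-≤ 2 (≤-trans (s≤s z≤n) Q<w)) L₀≥)
          (coprime-product (Allₚ.take⁺ w a-qs)) (coprime-product (Allₚ.drop⁺ w a-qs))
          (Allₚ.drop⁺ w SP.allPrime) (Uniqueₚ.drop⁺ w SP.unique)
          (subst (λ y → y * ℤ.∣ a ∣ ≤ 2 ^ (4 ^ i)) L≡ (begin
            L * ℤ.∣ a ∣               ≤⟨ *-mono-≤ L≤ a≤2^α ⟩
            2 ^ (Q * (w + w)) * 2 ^ α  ≡⟨ ^-distribˡ-+-* 2 (Q * (w + w)) α ⟨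
            2 ^ (Q * (w + w) + α)      ≤⟨ ^-monoʳ-≤ 2 (≤-trans (+-monoˡ-≤ α (m≤n+m (Q * (w + w)) κ)) fits) ⟩
            2 ^ (4 ^ i)                ∎))
          (t * g) (subst (λ y → 2 ^ (1 + κ) * (t * g) ≤ 2 ^ y) (sym length-qs₁) large))
        where
        open ≤-Reasoning
        module SP = SmoothPrimes SP
        κ h d L L₀ L₁ : ℕ
        qs qs₀ qs₁ : List ℕ
        κ = α + b + 1 + e * i
        h = κ + κ + Q * (w + w)
        d = suc h ^ (B + (κ + κ))
        qs = SP.list
        qs₀ = take w qs
        qs₁ = drop w qs
        L = product qs
        L₀ = product qs₀
        L₁ = product qs₁
        α≤κ : α ≤ κ
        α≤κ = ≤-trans (m≤m+n α b) (≤-trans (m≤m+n (α + b) 1) (m≤m+n (α + b + 1) (e * i)))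
        α<Q : α < Q
        α<Q = ≤-<-trans α≤κ κ<Q
        L≡ : L ≡ L₀ * L₁
        L≡ = trans (cong product (sym (take++drop≡id w qs))) (product-++ qs₀ qs₁)
        L≤ : L ≤ 2 ^ (Q * (w + w))
        L≤ = subst (λ y → L ≤ 2 ^ (Q * y)) SP.length≡ (product≤2^ Q SP.small)
        length-qs₀ : length qs₀ ≡ w
        length-qs₀ = trans (length-take w qs) (trans (cong (w ⊓_) SP.length≡) (m≤n⇒m⊓n≡m (m≤m+n w w)))
        length-qs₁ : length qs₁ ≡ w
        length-qs₁ = trans (length-drop w qs) (trans (cong (_∸ w) SP.length≡) (m+n∸m≡n w w))
        L₀≥ : 2 ^ w ≤ L₀
        L₀≥ = subst (λ y → 2 ^ y ≤ L₀) length-qs₀ (2^≤product (Allₚ.take⁺ w SP.allPrime))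
        instance
          a≢0 : NonZero ℤ.∣ a ∣
          a≢0 = >-nonZero 0<a
          L≢0 : NonZero L
          L≢0 = productOfPrimes≢0 SP.allPrime
          L₀≢0 : NonZero L₀
          L₀≢0 = productOfPrimes≢0 (Allₚ.take⁺ w SP.allPrime)
          L₁≢0 : NonZero L₁
          L₁≢0 = productOfPrimes≢0 (Allₚ.drop⁺ w SP.allPrime)
        a-qs : All (Coprime ℤ.∣ a ∣) qs
        a-qs = All.tabulate a-q
          where
          a-q : ∀ {q} → q ∈ qs → Coprime ℤ.∣ a ∣ q
          a-q q∈ = coprime-sym (prime⇒coprime (All.lookup SP.allPrime q∈)
            (≤-<-trans (≤-trans a≤2^α (^-monoʳ-≤ 2 α≤κ)) (All.lookup SP.large q∈)))

        L₀≤L : L₀ ≤ L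
        L₀≤L = subst (L₀ ≤_) (sym L≡) (m≤m*n L₀ L₁)

        -- Here the factor `L₀` pays off: it is at least 2 ^ w ≥ 2 ^ (Q + 1), which leaves room for
        -- subtracting ∣a∣ when `a` is negative.
        2^Q< : ∀ {p m} → + p ≡ a ℤ.+ + m → L₀ ≤ m → 2 ^ Q < p
        2^Q< {p} {m} p≡ L₀≤m = +-cancelʳ-< ℤ.∣ a ∣ (2 ^ Q) p (begin-strict
          2 ^ Q + ℤ.∣ a ∣        <⟨ +-monoʳ-< (2 ^ Q) (≤-<-trans a≤2^α (^-monoʳ-< 2 (s≤s (s≤s z≤n)) α<Q)) ⟩
          2 ^ Q + 2 ^ Q          ≡⟨ cong (λ y → 2 ^ Q + y) (+-identityʳ (2 ^ Q)) ⟨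
          2 ^ suc Q              ≤⟨ ^-monoʳ-≤ 2 Q<w ⟩
          2 ^ w                  ≤⟨ L₀≥ ⟩
          L₀                     ≤⟨ L₀≤m ⟩
          m                      ≤⟨ proj₂ (≤-of-≡ {a} {p} {m} p≡) ⟩
          p + ℤ.∣ a ∣            ∎)

        ≤2^h+1 : ∀ {p m} → + p ≡ a ℤ.+ + m → m ≤ 2 ^ h → p ≤ 2 ^ (1 + h)
        ≤2^h+1 {p} {m} p≡ m≤ = begin
          p                      ≤⟨ proj₁ (≤-of-≡ {a} {p} {m} p≡) ⟩
          ℤ.∣ a ∣ + m            ≤⟨ +-mono-≤ (≤-trans a≤2^α (^-monoʳ-≤ 2 (≤-trans α≤κ
                                      (≤-trans (m≤m+n κ κ) (m≤m+n (κ + κ) (Q * (w + w))))))) m≤ ⟩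
          2 ^ h + 2 ^ h          ≡⟨ cong (λ y → 2 ^ h + y) (+-identityʳ (2 ^ h)) ⟨
          2 ^ (1 + h)            ∎

        Result : Set
        Result = ∃ λ ns → Unique ns × All (λ n → IsCarmichael a n × n ≤ 2 ^ ((1 + h) * (1 + t)) × 2 ^ κ < n) ns ×
          g ^ t ≤ length ns * suc (t * g) ^ d

        from-progression : Progression a L₀ L₁ κ (t * g) → Result
        from-progression P = from-member (0<length⇒∈ (subst (0 <_) (sym P.length≡) (*-mono-≤ (≤-trans (m^n>0 (suc h) (B + (κ + κ))) d≤t) 0<g)))
          where
          module P = Progression P
          k : ℕ
          k = P.k
          Member : ℕ → Set
          Member p = Prime p × Coprime p ℤ.∣ a ∣ × 0 < k × k ≤ 2 ^ κ × ∃ λ c → c ∣ L₁ × + p ≡ a ℤ.+ + (L₀ * c * k)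

          from-prime : 0 < k → k ≤ 2 ^ κ → PrimeAt a (k * L) (2 ^ κ) → Result
          from-prime 0<k k≤ R = from-exponent (exponent {μ} {qs} {SP.E} SP.allPrime SP.unique SP.q∸1∣E SP.0<E μ-qs)
            where
            module R = PrimeAt R
            j q μ n₀ : ℕ
            j = R.k
            q = R.p
            μ = k * j
            n₀ = μ * L
            instance
              k≢0 : NonZero k
              k≢0 = >-nonZero 0<k
              j≢0 : NonZero j
              j≢0 = >-nonZero R.0<k
              μ≢0 : NonZero μ
              μ≢0 = m*n≢0 k j
              n₀≢0 : NonZero n₀
              n₀≢0 = m*n≢0 μ L
            μ≤ : μ ≤ 2 ^ (κ + κ)
            μ≤ = ≤-trans (*-mono-≤ k≤ R.k≤) (≤-reflexive (sym (^-distribˡ-+-* 2 κ κ)))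
            n₀≤ : n₀ ≤ 2 ^ h
            n₀≤ = ≤-trans (*-mono-≤ μ≤ L≤) (≤-reflexive (sym (^-distribˡ-+-* 2 (κ + κ) (Q * (w + w)))))
            kLj≡n₀ : ∀ k l j → k * l * j ≡ k * j * l
            kLj≡n₀ = solveℕ
            q≡ : + q ≡ a ℤ.+ + n₀
            q≡ = trans R.p≡ (cong (λ y → a ℤ.+ + y) (kLj≡n₀ k L j))
            μ-qs : Coprime μ L
            μ-qs = coprime-product (All.tabulate μ-q)
              where
              μ-q : ∀ {q} → q ∈ qs → Coprime μ q
              μ-q q∈ = coprime-sym (coprime-*
                (prime⇒coprime (All.lookup SP.allPrime q∈) (≤-<-trans k≤ (All.lookup SP.large q∈)))
                (prime⇒coprime (All.lookup SP.allPrime q∈) (≤-<-trans R.k≤ (All.lookup SP.large q∈))))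
            cofactor : ∀ {c} → c ∣ L₁ → L₀ * c * k ∣ n₀
            cofactor {c} c∣ = subst (L₀ * c * k ∣_) (trans (cong (λ y → y * k * j) (sym L≡)) (reorder L k j))
              (∣m⇒∣m*n j (*-monoˡ-∣ k (*-monoʳ-∣ L₀ c∣)))
              where
              reorder : ∀ l k j → l * k * j ≡ k * j * l
              reorder = solveℕ
            L₀≤L₀ck : ∀ {c} → c ∣ L₁ → L₀ ≤ L₀ * c * k
            L₀≤L₀ck {c} c∣ = ≤-trans (m≤m*n L₀ c {{c≢0}}) (m≤m*n (L₀ * c) k)
              where
              c≢0 : NonZero c
              c≢0 = >-nonZero (n≢0⇒n>0 λ { refl → ≢-nonZero⁻¹ L₁ (0∣⇒≡0 c∣) })
            -- Three factors, two reasons: `k` through the coprimality of `p` and `a`, `j` and the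
            -- primes of `L` because they are smaller than `p`.
            member-coprime : ∀ {p} → Member p → Coprime n₀ p
            member-coprime {p} (pp , pa , _ , _ , c , c∣ , p≡) = coprime-sym (coprime-* (coprime-*
                (proj₁ (coprime-quotient {a} {p} {L₀ * c} {k} p≡ pa))
                (prime⇒coprime pp (≤-<-trans R.k≤ (<-trans (^-monoʳ-< 2 (s≤s (s≤s z≤n)) κ<Q) Q<p))))
                (coprime-product (All.tabulate p-q)))
              where
              Q<p : 2 ^ Q < p
              Q<p = 2^Q< p≡ (L₀≤L₀ck c∣)
              p-q : ∀ {q} → q ∈ qs → Coprime p q
              p-q q∈ = prime⇒coprime pp {{prime⇒nonZero (All.lookup SP.allPrime q∈)}}
                (≤-<-trans (All.lookup SP.small q∈) Q<p)
            member-≤ : ∀ {p} → Member p → p ≤ 2 ^ (1 + h)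
            member-≤ (_ , _ , _ , _ , c , c∣ , p≡) = ≤2^h+1 p≡ (≤-trans (∣⇒≤ (cofactor c∣)) n₀≤)
            member-∣ : ∀ {p} → Member p → Prime p × (+ p ℤ.- a) ℤ.∣ + n₀
            member-∣ {p} (pp , _ , _ , _ , c , c∣ , p≡) = pp , p-a∣ {a} {p} {L₀ * c * k} p≡ (cofactor c∣)

            from-exponent : (∃ λ ε → 0 < ε × ε ≤ SP.E * μ × (∀ {x} → Coprime n₀ x → x ^ ε ≈ 1 [mod n₀ ])) → Result
            from-exponent (ε , 0<ε , ε≤ , kills) = from-products (unit-products n₀ h n₀≤ {ε} {B + (κ + κ)} 0<ε
                (≤-trans ε≤ (≤-trans (*-mono-≤ SP.E≤ μ≤) (≤-reflexive (sym (^-distribˡ-+-* 2 B (κ + κ))))))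
                kills t g {P.list} (All.map proj₁ P.members) P.unique (All.map member-coprime P.members) P.length≡)
              where
              from-products : (∃ λ νs → Unique νs × All (Unit-product n₀ P.list t d) νs ×
                g ^ t ≤ length νs * suc (length P.list) ^ d) → Result
              from-products (νs , uνs , units , count) = map (q *_) νs
                , Uniqueₚ.map⁺ (*-cancelˡ-≡ _ _ q {{prime⇒nonZero R.isPrime}}) uνs
                , Allₚ.map⁺ (All.map good units)
                , subst₂ (λ y z → g ^ t ≤ y * suc z ^ d) (sym (length-map (q *_) νs)) P.length≡ count
                where
                good : ∀ {ν} → Unit-product n₀ P.list t d ν →
                  IsCarmichael a (q * ν) × q * ν ≤ 2 ^ ((1 + h) * (1 + t)) × 2 ^ κ < q * ν
                good {ν} U = carmichael {a} {n₀} {q} {ν} {U.factors} R.isPrime q≡ U.ν≡1 U.ν≡product 0<factors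
                      (All.map member-∣ members)
                  , (begin
                    q * ν                                ≤⟨ *-mono-≤ (≤2^h+1 q≡ n₀≤) ν≤ ⟩
                    2 ^ (1 + h) * 2 ^ ((1 + h) * t)      ≡⟨ ^-distribˡ-+-* 2 (1 + h) ((1 + h) * t) ⟨
                    2 ^ ((1 + h) + (1 + h) * t)          ≡⟨ cong (2 ^_) (*-suc (1 + h) t) ⟨
                    2 ^ ((1 + h) * (1 + t))              ∎)
                  , (begin-strict
                    2 ^ κ     <⟨ ^-monoʳ-< 2 (s≤s (s≤s z≤n)) κ<Q ⟩
                    2 ^ Q     <⟨ 2^Q< q≡ (≤-trans L₀≤L (m≤n*m L μ)) ⟩
                    q         ≤⟨ m≤m*n q ν {{ν≢0}} ⟩
                    q * ν     ∎)
                  where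
                  module U = Unit-product U
                  members : All Member U.factors
                  members = All.map (All.lookup P.members) U.factors⊆
                  0<factors : 0 < length U.factors
                  0<factors = +-cancelʳ-< d 0 (length U.factors) (≤-<-trans d≤t U.factors≥)
                  ν≢0 : NonZero ν
                  ν≢0 = subst NonZero (sym U.ν≡product) (productOfPrimes≢0 (All.map proj₁ members))
                  ν≤ : ν ≤ 2 ^ ((1 + h) * t)
                  ν≤ = begin
                    ν                                    ≡⟨ U.ν≡product ⟩
                    product U.factors                    ≤⟨ product≤2^ (1 + h) (All.map member-≤ members) ⟩
                    2 ^ ((1 + h) * length U.factors)     ≤⟨ ^-monoʳ-≤ 2 (*-monoʳ-≤ (1 + h) U.factors≤) ⟩
                    2 ^ ((1 + h) * t)                    ∎

          from-member : (∃ λ p → p ∈ P.list) → Result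
          -- A member is needed before `q` can be found: only through it is `k` known to be
          -- positive, small and coprime to `a`.
          from-member (p , p∈) = go (All.lookup P.members p∈)
            where
            go : Member p → Result
            go (pp , pa , 0<k , k≤ , c , c∣ , p≡) = from-prime 0<k k≤ (prime-at {b} {e} primes {α} i a (k * L) 0<a a≤2^α
              (≤-trans a≤2^α (≤-trans (^-monoʳ-≤ 2 (<⇒≤ (<-trans α<Q Q<w))) 2^w≤kL))
              (≤-trans (^-monoʳ-≤ 2 (≤-trans (s≤s z≤n) Q<w)) 2^w≤kL)
              (coprime-* (proj₂ (coprime-quotient {a} {p} {L₀ * c} {k} p≡ pa)) (coprime-product a-qs))
              (begin
                k * L * ℤ.∣ a ∣                         ≤⟨ *-mono-≤ (*-mono-≤ k≤ L≤) a≤2^α ⟩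
                2 ^ κ * 2 ^ (Q * (w + w)) * 2 ^ α       ≡⟨ cong (_* 2 ^ α) (^-distribˡ-+-* 2 κ (Q * (w + w))) ⟨
                2 ^ (κ + Q * (w + w)) * 2 ^ α           ≡⟨ ^-distribˡ-+-* 2 (κ + Q * (w + w)) α ⟨
                2 ^ (κ + Q * (w + w) + α)               ≤⟨ ^-monoʳ-≤ 2 fits ⟩
                2 ^ (4 ^ i)                             ∎))
              where
              2^w≤kL : 2 ^ w ≤ k * L
              2^w≤kL = ≤-trans L₀≥ (≤-trans L₀≤L (m≤n*m L k {{>-nonZero 0<k}}))

  -- The choice of parameters.

  ≤-by : ∀ {m n} d → m + d ≡ n → m ≤ n
  ≤-by {m} d refl = m≤m+n m d

  ^-distribʳ-* : ∀ o m n → (m * n) ^ o ≡ m ^ o * n ^ o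
  ^-distribʳ-* zero    m n = refl
  ^-distribʳ-* (suc o) m n = trans (cong (m * n *_) (^-distribʳ-* o m n))
    ([m*n]*[o*p]≡[m*o]*[n*p] m n (m ^ o) (n ^ o))

  abstract
    -- Induction on the degree. Half of the exponent, x = ⌊ v /2⌋, pays for all but one factor x by
    -- the induction hypothesis, the other half for the last factor by x ≤ 2 ^ x; the constant 3 ^
    -- suc k comes from v ≤ 3 x.
    2^-dominates : ∀ k c → ∃ λ v₀ → ∀ v → v₀ ≤ v → c * v ^ k ≤ 2 ^ v
    2^-dominates zero c = c , λ v c≤v → ≤-trans (≤-reflexive (*-identityʳ c))
      (≤-trans (n≤2^n c) (^-monoʳ-≤ 2 c≤v))
    2^-dominates (suc k) c with 2^-dominates k (c * 3 ^ suc k)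
    -- This threshold gives x ≥ 1 + x₀; that x is positive is what v ≤ 3 x requires of odd v.
    ... | x₀ , ih = 2 + (x₀ + x₀) , λ v v₀≤v →
      let x = ⌊ v /2⌋
          y = ⌈ v /2⌉
          x> : 1 + x₀ ≤ x
          x> = subst (λ t → suc t ≤ x) (sym (n≡⌊n+n/2⌋ x₀)) (⌊n/2⌋-mono v₀≤v)
          v≤3x : v ≤ 3 * x
          v≤3x = begin
            v            ≡⟨ ⌊n/2⌋+⌈n/2⌉≡n v ⟨
            x + y        ≤⟨ +-monoʳ-≤ x (≤-trans (⌊n/2⌋-mono (n≤1+n (suc v))) (+-monoˡ-≤ x (≤-trans (s≤s z≤n) x>))) ⟩
            x + (x + x)  ≡⟨ cong (λ t → x + (x + t)) (+-identityʳ x) ⟨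
            3 * x        ∎
      in begin
        c * v ^ suc k                  ≤⟨ *-monoʳ-≤ c (^-monoˡ-≤ (suc k) v≤3x) ⟩
        c * (3 * x) ^ suc k            ≡⟨ cong (c *_) (^-distribʳ-* (suc k) 3 x) ⟩
        c * (3 ^ suc k * x ^ suc k)    ≡⟨ reorder c (3 ^ suc k) x (x ^ k) ⟩
        c * 3 ^ suc k * x ^ k * x      ≤⟨ *-mono-≤ (ih x (≤-trans (n≤1+n x₀) x>)) (n≤2^n x) ⟩
        2 ^ x * 2 ^ x                  ≤⟨ *-monoʳ-≤ (2 ^ x) (^-monoʳ-≤ 2 (⌊n/2⌋≤⌈n/2⌉ v)) ⟩
        2 ^ x * 2 ^ y                  ≡⟨ ^-distribˡ-+-* 2 x y ⟨
        2 ^ (x + y)                    ≡⟨ cong (2 ^_) (⌊n/2⌋+⌈n/2⌉≡n v) ⟩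
        2 ^ v                          ∎
      where
      open ≤-Reasoning
      reorder : ∀ c t x z → c * (t * (x * z)) ≡ c * t * z * x
      reorder = solveℕ

  -- The count at X = 2 ^ J, with ℓ the integer part of log₂ log₂ J and thus of the order of log log
  -- log X. The base 4 matches the bound 4 ^ E for the exponential of a number up to E.
  ManyCarmichaels : ℤ → Set
  ManyCarmichaels a = ∃₂ λ c ℓ₀ → ∀ ℓ → ℓ₀ ≤ ℓ → ∀ J → 2 ^ (2 ^ ℓ) ≤ J → J < 2 ^ (2 ^ suc ℓ) →
    ∃₂ λ ns E → Unique ns × All (λ n → IsCarmichael a n × n ≤ 2 ^ J × ℓ < n) ns ×
      J ≤ c * (ℓ * ℓ) * E × 4 ^ E ≤ length ns

  -- N absorbs the constants and Z bounds every exponent of 2 that occurs, whereas the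
  -- number w = 2 ^ v of prime factors of L₀ and of L₁ is exponential in v.
  module Scale (α b e y : ℕ) where

    -- Bit lengths: `κ₁` of the cofactor of the primes `r`, `κ` of `k` and `j`, `S` of `M`, `β` of
    -- `E`, `Q` of a prime `r`. `s` is the number of primes in `M`; 2 ^ s divisors in 2 ^ (1 + κ₁)
    -- classes leave 2 ^ (1 + v) primes `r`, one half for each of `L₀` and `L₁`.
    v N Z κ₁ κ s S β Q : ℕ
    v  = suc y
    N  = 1 + α + b + e
    Z  = 35 * (N * N * N) * (v * v)
    κ₁ = b + 1 + e * v
    κ  = α + b + 1 + e * (v + v + 2)
    s  = (1 + κ₁) + (1 + v)
    S  = (1 + b + e) * (1 + s) * s
    β  = κ + S + κ₁
    Q  = 1 + β

    κ₁≤ : κ₁ ≤ N * v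
    κ₁≤ = ≤-by (α * v + b * y + y) (eq α b e y)
      where
      eq : ∀ α b e y → b + 1 + e * suc y + (α * suc y + b * y + y) ≡ (1 + α + b + e) * suc y
      eq = solveℕ

    κ≤ : κ ≤ 4 * N * v
    κ≤ = ≤-by (3 + 4 * y + 3 * α + 4 * α * y + 3 * b + 4 * b * y + 2 * e * y) (eq α b e y)
      where
      eq : ∀ α b e y → α + b + 1 + e * (suc y + suc y + 2) + (3 + 4 * y + 3 * α + 4 * α * y + 3 * b + 4 * b * y + 2 * e * y)
        ≡ 4 * (1 + α + b + e) * suc y
      eq = solveℕ

    s≤ : s ≤ 4 * N * v
    s≤ = begin
      (1 + κ₁) + (1 + v)         ≤⟨ +-monoˡ-≤ (1 + v) (+-monoʳ-≤ 1 κ₁≤) ⟩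
      (1 + N * v) + (1 + v)      ≤⟨ ≤-by (2 * y + 3 * (α + b + e) * v) (eq (α + b + e) y) ⟩
      4 * suc (α + b + e) * v    ≡⟨⟩
      4 * N * v                  ∎
      where
      open ≤-Reasoning
      eq : ∀ n y → (1 + suc n * suc y) + (1 + suc y) + (2 * y + 3 * n * suc y) ≡ 4 * suc n * suc y
      eq = solveℕ

    N≥1 : 1 ≤ N
    N≥1 = s≤s z≤n

    v≥1 : 1 ≤ v
    v≥1 = s≤s z≤n

    Nv≥1 : 1 ≤ N * v
    Nv≥1 = s≤s z≤n

    -- Origin of the constant 35: `S` contributes 5 times 4 as a product of two linear quantities,
    -- and the linear terms add up to 15.
    Q+2κ<Z : 2 + (β + (κ + κ)) ≤ Z
    Q+2κ<Z = begin
      2 + (β + (κ + κ))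
        ≤⟨ +-monoʳ-≤ 2 (+-mono-≤ (+-mono-≤ (+-mono-≤ κ≤ S≤) κ₁≤) (+-mono-≤ κ≤ κ≤)) ⟩
      2 + (4 * N * v + N * (5 * N * v) * (4 * N * v) + N * v + (4 * N * v + 4 * N * v))
        ≤⟨ +-monoˡ-≤ _ (*-monoʳ-≤ 2 Nv≥1) ⟩
      2 * (N * v) + (4 * N * v + N * (5 * N * v) * (4 * N * v) + N * v + (4 * N * v + 4 * N * v))
        ≡⟨ eq₁ N v ⟩
      20 * (N * N * N) * (v * v) + 15 * (N * 1 * 1) * (v * 1)
        ≤⟨ +-monoʳ-≤ (20 * (N * N * N) * (v * v)) (*-mono-≤ (*-monoʳ-≤ 15 (*-mono-≤ (*-monoʳ-≤ N N≥1) N≥1)) (*-monoʳ-≤ v v≥1)) ⟩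
      20 * (N * N * N) * (v * v) + 15 * (N * N * N) * (v * v)
        ≡⟨ eq₂ (N * N * N) (v * v) ⟩
      Z ∎
      where
      open ≤-Reasoning
      eq₁ : ∀ N v → 2 * (N * v) + (4 * N * v + N * (5 * N * v) * (4 * N * v) + N * v + (4 * N * v + 4 * N * v))
        ≡ 20 * (N * N * N) * (v * v) + 15 * (N * 1 * 1) * (v * 1)
      eq₁ = solveℕ
      eq₂ : ∀ x y → 20 * x * y + 15 * x * y ≡ 35 * x * y
      eq₂ = solveℕ
      eq₃ : ∀ x → x + 4 * x ≡ 5 * x
      eq₃ = solveℕ
      S≤ : S ≤ N * (5 * N * v) * (4 * N * v)
      S≤ = *-mono-≤ (*-mono-≤ {1 + b + e} {N} (s≤s (+-monoˡ-≤ e (m≤n+m b α)))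
        (≤-trans (+-mono-≤ Nv≥1 s≤) (≤-reflexive (trans (cong (λ k → N * v + k) (*-assoc 4 N v)) (trans (eq₃ (N * v)) (sym (*-assoc 5 N v))))))) s≤

    module _ (Z≤w : Z ≤ 2 ^ v) where

      w h P : ℕ
      w = 2 ^ v
      h = κ + κ + Q * (w + w)
      P = suc h

      Q≤Z : suc Q ≤ Z
      Q≤Z = ≤-trans (+-monoʳ-≤ 2 (m≤m+n β (κ + κ))) Q+2κ<Z

      κ<Q : κ < Q
      κ<Q = s≤s (≤-trans (m≤m+n κ S) (m≤m+n (κ + S) κ₁))

      Q<w : Q < w
      Q<w = ≤-trans Q≤Z Z≤w

      w≤4^v : w ≤ 4 ^ v
      w≤4^v = ^-monoˡ-≤ v (s≤s (s≤s z≤n))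

      first-fits : κ + S ≤ 4 ^ v
      first-fits = ≤-trans (≤-trans (m≤m+n (κ + S) κ₁) (≤-trans (n≤1+n β) (<⇒≤ Q<w))) w≤4^v

      second-fits : κ + Q * (w + w) + α ≤ 4 ^ (v + v + 2)
      second-fits = begin
        κ + Q * (w + w) + α            ≤⟨ +-mono-≤ (+-mono-≤ κ≤w (*-monoˡ-≤ (w + w) (<⇒≤ Q<w))) (≤-trans α≤κ κ≤w) ⟩
        w + w * (w + w) + w            ≤⟨ +-mono-≤ (+-monoˡ-≤ (w * (w + w)) w≤ww) w≤ww ⟩
        w * w + w * (w + w) + w * w    ≡⟨ eq w ⟩
        w * w * 4                      ≤⟨ *-mono-≤ (*-mono-≤ w≤4^v w≤4^v) (s≤s (s≤s (s≤s (s≤s (z≤n {12}))))) ⟩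
        4 ^ v * 4 ^ v * 4 ^ 2          ≡⟨ cong (_* 4 ^ 2) (^-distribˡ-+-* 4 v v) ⟨
        4 ^ (v + v) * 4 ^ 2            ≡⟨ ^-distribˡ-+-* 4 (v + v) 2 ⟨
        4 ^ (v + v + 2)                ∎
        where
        open ≤-Reasoning
        eq : ∀ w → w * w + w * (w + w) + w * w ≡ w * w * 4
        eq = solveℕ
        κ≤w : κ ≤ w
        κ≤w = <⇒≤ (<-trans κ<Q Q<w)
        α≤κ : α ≤ κ
        α≤κ = ≤-trans (m≤m+n α b) (≤-trans (m≤m+n (α + b) 1) (m≤m+n (α + b + 1) (e * (v + v + 2))))
        w≤ww : w ≤ w * w
        w≤ww = m≤m*n w w {{>-nonZero (m^n>0 2 v)}}

      P≤ : P ≤ 2 * w * Z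
      P≤ = begin
        suc (κ + κ + Q * (w + w))                    ≤⟨ +-monoˡ-≤ (Q * (w + w)) (m≤m*n (suc (κ + κ)) (w + w) {{>-nonZero (≤-trans (m^n>0 2 v) (m≤m+n w w))}}) ⟩
        suc (κ + κ) * (w + w) + Q * (w + w)          ≡⟨ eq w κ β ⟩
        2 * w * (2 + (β + (κ + κ)))                  ≤⟨ *-monoʳ-≤ (2 * w) Q+2κ<Z ⟩
        2 * w * Z                                    ∎
        where
        open ≤-Reasoning
        eq : ∀ w κ β → suc (κ + κ) * (w + w) + suc β * (w + w) ≡ 2 * w * (2 + (β + (κ + κ)))
        eq = solveℕ

  module _ {b e} (primes : SmallPrimes b e) (0<e : 0 < e) (a : ℤ) (0<a : 0 < ℤ.∣ a ∣) where

    private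
      α K : ℕ
      α = ℤ.∣ a ∣
      K = let N = 1 + α + b + e in 35 * (N * N * N)

    module AtScale (ℓ : ℕ) (1≤ℓ : 1 ≤ ℓ) (bound : 72 * K * (3 + ℓ) ^ 3 ≤ 2 ^ (3 + ℓ)) where

      open Scale α b e (2 + ℓ)
      open ≤-Reasoning

      -- Nine copies of v Z are what `P[1+6D]≤` consumes; the 72 in `bound` is 9 times the 8 in 2 ^
      -- (3 + ℓ) = 8 2 ^ ℓ.
      9vZ≤ : 9 * (v * Z) ≤ 2 ^ ℓ
      9vZ≤ = *-cancelˡ-≤ 8 (begin
        8 * (9 * (v * Z))      ≡⟨ eq K v ⟩
        72 * K * v ^ 3         ≤⟨ bound ⟩
        2 ^ (3 + ℓ)            ≡⟨ ^-distribˡ-+-* 2 3 ℓ ⟩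
        8 * 2 ^ ℓ              ∎)
        where
        eq : ∀ k v → 8 * (9 * (v * (k * (v * v)))) ≡ 72 * k * (v * (v * (v * 1)))
        eq = solveℕ

      1≤Z : 1 ≤ Z
      1≤Z = ≤-trans (s≤s z≤n) Q+2κ<Z

      Z≤2^ℓ : Z ≤ 2 ^ ℓ
      Z≤2^ℓ = ≤-trans (≤-trans (m≤n*m Z v) (m≤n*m (v * Z) 9)) 9vZ≤

      Z≤w : Z ≤ 2 ^ v
      Z≤w = ≤-trans Z≤2^ℓ (^-monoʳ-≤ 2 (m≤n+m ℓ 3))

      -- `D` is the length of a rest. `g` is the upper end of the range of `J`, so that t < g and a
      -- rest costs at most (1 + t g) ^ D ≤ g ^ (2 D).
      D γ g : ℕ
      D = P Z≤w ^ (β + (κ + κ))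
      γ = 2 ^ suc ℓ
      g = 2 ^ γ

      P≤2^ : P Z≤w ≤ 2 ^ (1 + v + v)
      P≤2^ = begin
        P Z≤w                 ≤⟨ P≤ Z≤w ⟩
        2 * 2 ^ v * Z         ≤⟨ *-monoʳ-≤ (2 * 2 ^ v) Z≤w ⟩
        2 ^ (1 + v) * 2 ^ v   ≡⟨ ^-distribˡ-+-* 2 (1 + v) v ⟨
        2 ^ (1 + v + v)       ∎

      D≤2^ : D ≤ 2 ^ ((1 + v + v) * Z)
      D≤2^ = begin
        P Z≤w ^ (β + (κ + κ))               ≤⟨ ^-monoʳ-≤ (P Z≤w) (≤-trans (m≤n+m (β + (κ + κ)) 2) Q+2κ<Z) ⟩
        P Z≤w ^ Z                           ≤⟨ ^-monoˡ-≤ Z P≤2^ ⟩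
        (2 ^ (1 + v + v)) ^ Z               ≡⟨ ^-*-assoc 2 (1 + v + v) Z ⟩
        2 ^ ((1 + v + v) * Z)               ∎

      1≤D : 1 ≤ D
      1≤D = m^n>0 (P Z≤w) (β + (κ + κ))

      -- Ensures t ≥ 6 D. Of these, 2 D choices are lost to the rest, and the remaining t′ ≥ 4 D
      -- still dominates the loss up to a constant factor.
      P[1+6D]≤ : P Z≤w * (1 + 6 * D) ≤ 2 ^ (2 ^ ℓ)
      P[1+6D]≤ = begin
        P Z≤w * (1 + 6 * D)                         ≤⟨ *-mono-≤ P≤2^ (+-mono-≤ 1≤D (*-monoʳ-≤ 6 (≤-refl {D}))) ⟩
        2 ^ (1 + v + v) * (7 * D)                   ≤⟨ *-monoʳ-≤ (2 ^ (1 + v + v)) (*-mono-≤ (n≤1+n 7) D≤2^) ⟩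
        2 ^ (1 + v + v) * (2 ^ 3 * 2 ^ ((1 + v + v) * Z))
          ≡⟨ cong (2 ^ (1 + v + v) *_) (^-distribˡ-+-* 2 3 ((1 + v + v) * Z)) ⟨
        2 ^ (1 + v + v) * 2 ^ (3 + (1 + v + v) * Z) ≡⟨ ^-distribˡ-+-* 2 (1 + v + v) (3 + (1 + v + v) * Z) ⟨
        2 ^ ((1 + v + v) + (3 + (1 + v + v) * Z))   ≤⟨ ^-monoʳ-≤ 2 (≤-trans exponents 9vZ≤) ⟩
        2 ^ (2 ^ ℓ)                                 ∎
        where
        eq : ∀ v z → 3 * (v * z) + v * z + v * z + (v * z + (v + v + v) * z) ≡ 9 * (v * z)
        eq = solveℕ
        1≤vZ : 1 ≤ v * Z
        1≤vZ = *-mono-≤ v≥1 1≤Z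
        v≤vZ : v ≤ v * Z
        v≤vZ = m≤m*n v Z {{>-nonZero 1≤Z}}
        eq′ : ∀ v x → (1 + v + v) + (3 + x) ≡ 3 * 1 + v + v + (1 + x)
        eq′ = solveℕ
        exponents : (1 + v + v) + (3 + (1 + v + v) * Z) ≤ 9 * (v * Z)
        exponents = begin
          (1 + v + v) + (3 + (1 + v + v) * Z)                          ≡⟨ eq′ v ((1 + v + v) * Z) ⟩
          3 * 1 + v + v + (1 + (1 + v + v) * Z)
            ≤⟨ +-mono-≤ (+-mono-≤ (+-mono-≤ (*-monoʳ-≤ 3 1≤vZ) v≤vZ) v≤vZ)
                 (+-mono-≤ 1≤vZ (*-monoˡ-≤ Z (+-monoˡ-≤ v (+-monoˡ-≤ v v≥1)))) ⟩
          3 * (v * Z) + v * Z + v * Z + (v * Z + (v + v + v) * Z)      ≡⟨ eq v Z ⟩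
          9 * (v * Z)                                                  ∎

      1≤g : 1 ≤ g
      1≤g = m^n>0 2 γ

      module _ (J : ℕ) (J≥ : 2 ^ (2 ^ ℓ) ≤ J) (J< : J < g) where

        -- The prime `q` counts as one of the T = 1 + t factors, each at most 2 ^ P; the product
        -- then stays below 2 ^ J.
        T t : ℕ
        T = J / P Z≤w
        t = pred T

        T≥ : 1 + 6 * D ≤ T
        T≥ = subst (_≤ T) (trans (cong (_/ P Z≤w) (*-comm (P Z≤w) (1 + 6 * D))) (m*n/n≡m (1 + 6 * D) (P Z≤w))) (/-monoˡ-≤ (P Z≤w) (≤-trans P[1+6D]≤ J≥))

        T≡ : T ≡ suc t
        T≡ = sym (suc-pred T {{>-nonZero (≤-trans (s≤s z≤n) T≥)}})

        t≥6D : 6 * D ≤ t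
        t≥6D = s≤s⁻¹ (subst (1 + 6 * D ≤_) T≡ T≥)

        D≤t : D ≤ t
        D≤t = ≤-trans (m≤n*m D 6) t≥6D

        t<g : suc t ≤ g
        t<g = subst (_≤ g) T≡ (≤-trans (m/n≤m J (P Z≤w)) (<⇒≤ J<))

        PT≤J : P Z≤w * (1 + t) ≤ J
        PT≤J = begin
          P Z≤w * (1 + t)   ≡⟨ *-comm (P Z≤w) (1 + t) ⟩
          (1 + t) * P Z≤w   ≡⟨ cong (_* P Z≤w) T≡ ⟨
          T * P Z≤w         ≤⟨ m/n*n≤m J (P Z≤w) ⟩
          J                 ∎

        -- The origin of v = ℓ + 3: the 2 ^ v = 4 γ bits are spent as γ on `g`, γ on `t` and 2 γ on
        -- the number of cofactors.
        large : 2 ^ (1 + κ) * (t * g) ≤ 2 ^ (2 ^ v)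
        large = begin
          2 ^ (1 + κ) * (t * g)                ≤⟨ *-mono-≤ (^-monoʳ-≤ 2 1+κ≤) (*-monoˡ-≤ g (≤-trans (n≤1+n t) t<g)) ⟩
          2 ^ (γ + γ) * (2 ^ γ * 2 ^ γ)        ≡⟨ cong (2 ^ (γ + γ) *_) (^-distribˡ-+-* 2 γ γ) ⟨
          2 ^ (γ + γ) * 2 ^ (γ + γ)            ≡⟨ ^-distribˡ-+-* 2 (γ + γ) (γ + γ) ⟨
          2 ^ (γ + γ + (γ + γ))                ≡⟨ cong (2 ^_) (eq γ) ⟩
          2 ^ (2 ^ v)                          ∎
          where
          eq : ∀ γ → γ + γ + (γ + γ) ≡ 2 * (2 * γ)
          eq = solveℕ
          1+κ≤ : 1 + κ ≤ γ + γ
          1+κ≤ = begin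
            1 + κ        ≤⟨ κ<Q Z≤w ⟩
            Q            ≤⟨ ≤-trans (n≤1+n Q) (Q≤Z Z≤w) ⟩
            Z            ≤⟨ Z≤2^ℓ ⟩
            2 ^ ℓ        ≤⟨ ^-monoʳ-≤ 2 (n≤1+n ℓ) ⟩
            γ            ≤⟨ m≤m+n γ γ ⟩
            γ + γ        ∎

        t′ E : ℕ
        t′ = t ∸ (D + D)
        E  = 2 ^ ℓ * t′

        t≡ : D + D + t′ ≡ t
        t≡ = m+[n∸m]≡n (≤-trans (≤-by {D + D} {6 * D} (4 * D) (eq D)) t≥6D)
          where
          eq : ∀ d → d + d + 4 * d ≡ 6 * d
          eq = solveℕ

        4D≤t′ : 4 * D ≤ t′
        4D≤t′ = +-cancelˡ-≤ (D + D) (4 * D) t′ (subst₂ _≤_ (eq D) (sym t≡) t≥6D)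
          where
          eq : ∀ d → 6 * d ≡ d + d + 4 * d
          eq = solveℕ

        4^E≡ : 4 ^ E ≡ g ^ t′
        4^E≡ = trans (^-*-assoc 2 2 E) (trans (cong (2 ^_) (sym (*-assoc 2 (2 ^ ℓ) t′))) (sym (^-*-assoc 2 γ t′)))

        enough : ∀ {n} → g ^ t ≤ n * suc (t * g) ^ D → 4 ^ E ≤ n
        enough {n} count = subst (_≤ n) (sym 4^E≡) (*-cancelʳ-≤ (g ^ t′) n (g ^ (D + D)) {{m^n≢0 g (D + D) {{>-nonZero 1≤g}}}} (begin
          g ^ t′ * g ^ (D + D)      ≡⟨ trans (sym (^-distribˡ-+-* g t′ (D + D))) (cong (g ^_) (trans (+-comm t′ (D + D)) t≡)) ⟩
          g ^ t                     ≤⟨ count ⟩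
          n * suc (t * g) ^ D       ≤⟨ *-monoʳ-≤ n (^-monoˡ-≤ D (≤-trans (+-monoˡ-≤ (t * g) 1≤g) (*-monoˡ-≤ g t<g))) ⟩
          n * (g * g) ^ D           ≡⟨ cong (n *_) (trans (^-distribʳ-* D g g) (sym (^-distribˡ-+-* g D D))) ⟩
          n * g ^ (D + D)           ∎))

        -- `J` is about t P, and P is at most 2 2 ^ v Z, where Z is quadratic in `v`. Dividing by
        -- the 2 ^ ℓ t′ of `E` leaves this quadratic factor, the source of the square in the final
        -- exponent; the 4 times 4 comes from v ≤ 4 ℓ.
        J≤ : J ≤ 32 * K * (4 * 4) * (ℓ * ℓ) * E
        J≤ = begin
          J                                             ≡⟨ m≡m%n+[m/n]*n J (P Z≤w) ⟩
          J % P Z≤w + T * P Z≤w                         ≤⟨ +-monoˡ-≤ (T * P Z≤w) (<⇒≤ (m%n<n J (P Z≤w))) ⟩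
          P Z≤w + T * P Z≤w                             ≡⟨ cong (λ y → P Z≤w + y * P Z≤w) T≡ ⟩
          (2 + t) * P Z≤w                               ≡⟨ cong (λ y → (2 + y) * P Z≤w) t≡ ⟨
          (2 + (D + D + t′)) * P Z≤w                    ≤⟨ *-mono-≤ 2+t≤ (P≤ Z≤w) ⟩
          2 * t′ * (2 * 2 ^ v * Z)                      ≡⟨ cong (λ y → 2 * t′ * (2 * y * Z)) (^-distribˡ-+-* 2 3 ℓ) ⟩
          2 * t′ * (2 * (8 * 2 ^ ℓ) * Z)                ≡⟨ eq t′ (2 ^ ℓ) K v ⟩
          32 * K * (v * v) * E                          ≤⟨ *-monoˡ-≤ E (*-monoʳ-≤ (32 * K) (*-mono-≤ v≤4ℓ v≤4ℓ)) ⟩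
          32 * K * (4 * ℓ * (4 * ℓ)) * E                ≡⟨ cong (_* E) (trans (cong (32 * K *_) ([m*n]*[o*p]≡[m*o]*[n*p] 4 ℓ 4 ℓ)) (sym (*-assoc (32 * K) (4 * 4) (ℓ * ℓ)))) ⟩
          32 * K * (4 * 4) * (ℓ * ℓ) * E                ∎
          where
          eq : ∀ t p k v → 2 * t * (2 * (8 * p) * (k * (v * v))) ≡ 32 * k * (v * v) * (p * t)
          eq = solveℕ
          v≤4ℓ : v ≤ 4 * ℓ
          v≤4ℓ = ≤-trans (+-monoˡ-≤ ℓ (*-monoʳ-≤ 3 1≤ℓ)) (≤-reflexive (eq″ ℓ))
            where
            eq″ : ∀ l → 3 * l + l ≡ 4 * l
            eq″ = solveℕ
          2+t≤ : 2 + (D + D + t′) ≤ 2 * t′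
          2+t≤ = begin
            2 + (D + D + t′)            ≤⟨ +-monoˡ-≤ (D + D + t′) (*-monoʳ-≤ 2 1≤D) ⟩
            2 * D + (D + D + t′)        ≡⟨ eq‴ D t′ ⟩
            4 * D + t′                  ≤⟨ +-monoˡ-≤ t′ 4D≤t′ ⟩
            t′ + t′                     ≡⟨ cong (λ k → t′ + k) (+-identityʳ t′) ⟨
            2 * t′                      ∎
            where
            eq‴ : ∀ d t → 2 * d + (d + d + t) ≡ 4 * d + t
            eq‴ = solveℕ

        -- The constructed numbers exceed 2 ^ κ, so this makes them exceed ℓ. It is where `e` has to
        -- be positive, as κ grows with the scale only through `e`.
        ℓ≤κ : ℓ ≤ κ
        ℓ≤κ = begin
          ℓ                        ≤⟨ m≤n+m ℓ 3 ⟩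
          v                        ≤⟨ ≤-trans (m≤m+n v v) (m≤m+n (v + v) 2) ⟩
          v + v + 2                ≤⟨ m≤n*m (v + v + 2) e {{>-nonZero 0<e}} ⟩
          e * (v + v + 2)          ≤⟨ m≤n+m (e * (v + v + 2)) (α + b + 1) ⟩
          κ                        ∎

        1≤κ : 1 ≤ κ
        1≤κ = ≤-trans 1≤ℓ ℓ≤κ

        smooth : SmoothPrimes (2 ^ v + 2 ^ v) κ Q β
        smooth = smooth-primes {b} {e} primes κ v (2 ^ v + 2 ^ v) s 1≤κ (≤-trans (m^n>0 2 v) (m≤m+n (2 ^ v) (2 ^ v)))
          (first-fits Z≤w) (≤-reflexive (trans (cong (λ y → 2 ^ (1 + κ₁) * (2 ^ v + y)) (sym (+-identityʳ (2 ^ v))))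
            (sym (^-distribˡ-+-* 2 (1 + κ₁) (1 + v)))))

        conclusion : ∃₂ λ ns E → Unique ns × All (λ n → IsCarmichael a n × n ≤ 2 ^ J × ℓ < n) ns ×
          J ≤ 32 * K * (4 * 4) * (ℓ * ℓ) * E × 4 ^ E ≤ length ns
        conclusion = from (carmichaels {b} {e} primes {α} a 0<a (n≤2^n α) (v + v + 2) (2 ^ v) t g smooth
          (κ<Q Z≤w) (Q<w Z≤w) (second-fits Z≤w) large D≤t 1≤g)
          where
          from : (∃ λ ns → Unique ns × All (λ n → IsCarmichael a n × n ≤ 2 ^ (P Z≤w * (1 + t)) × 2 ^ κ < n) ns ×
              g ^ t ≤ length ns * suc (t * g) ^ D) →
            ∃₂ λ ns E → Unique ns × All (λ n → IsCarmichael a n × n ≤ 2 ^ J × ℓ < n) ns ×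
              J ≤ 32 * K * (4 * 4) * (ℓ * ℓ) * E × 4 ^ E ≤ length ns
          from (ns , u , good , count) = ns , E , u
            , All.map (λ (c , n≤ , n>) → c , ≤-trans n≤ (^-monoʳ-≤ 2 PT≤J) , ≤-<-trans (≤-trans ℓ≤κ (n≤2^n κ)) n>) good
            , J≤ , enough count

    many-carmichaels : ManyCarmichaels a
    many-carmichaels = from (2^-dominates 3 (72 * K))
      where
      from : (∃ λ v₀ → ∀ v → v₀ ≤ v → 72 * K * v ^ 3 ≤ 2 ^ v) → ManyCarmichaels a
      from (v₀ , dominates) = 32 * K * (4 * 4) , v₀ ⊔ 1 , λ ℓ ℓ≥ J J≥ J< →
        AtScale.conclusion ℓ (≤-trans (m≤n⊔m v₀ 1) ℓ≥)
          (dominates (3 + ℓ) (≤-trans (m≤m⊔n v₀ 1) (≤-trans ℓ≥ (m≤n+m ℓ 3)))) J J≥ J<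

module Analysis where

  import Algebra.Definitions.RawSemiring
  open import Data.Empty using (⊥-elim)
  open import Data.Integer.Base as ℤ using (ℤ; +_; -[1+_])
  import Data.Integer.Divisibility as ℤ
  open import Data.List.Base using (List; []; _∷_; length; applyUpTo)
  open import Data.List.Properties using (length-applyUpTo)
  open import Data.List.Relation.Unary.All as All using (All; []; _∷_)
  import Data.List.Relation.Unary.All.Properties as Allₚ
  open import Data.List.Relation.Unary.Unique.Propositional using (Unique)
  import Data.List.Relation.Unary.Unique.Propositional.Properties as Uniqueₚ
  import Data.Nat.Base as ℕ
  open ℕ using (ℕ; zero; suc)
  open import Data.Nat.DivMod using (m≡m%n+[m/n]*n; m%n<n; m/n*n≤m; m*n/n≡m; /-monoˡ-≤)
  import Data.Nat.Divisibility as ℕ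
  open import Data.Nat.Primality using (Prime; composite-≢)
  import Data.Nat.Properties as ℕₚ
  open import Data.Nat.Tactic.RingSolver using () renaming (solve-∀ to solveℕ)
  open import Data.Product.Base using (∃; ∃₂; _×_; _,_; proj₁; proj₂; Σ-syntax; ∃-syntax)
  open import Data.Rational.Base
    using (ℚ; 0ℚ; 1ℚ; ½; _+_; _*_; _-_; -_; ∣_∣; _≤_; _<_; +-*-rawSemiring; nonNegative; positive)
  open import Data.Rational.Properties
  open import Data.Rational.Solver using (module +-*-Solver)
  open import Defs
  open import Relation.Binary.PropositionalEquality hiding (J)
  open import Relation.Nullary using (yes; no)

  open Arithmetic using (SmallPrimes; ManyCarmichaels; many-carmichaels; n≤2^n)
  open Algebra.Definitions.RawSemiring +-*-rawSemiring using (_^_)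
  open +-*-Solver using (solve; _:+_; _:*_; _:-_; :-_; _:=_; con)

  -- Partial sums of the exponential and logarithmic series.

  natℚ-+ : ∀ m n → natℚ (m ℕ.+ n) ≡ natℚ m + natℚ n
  natℚ-+ zero    n = sym (+-identityˡ (natℚ n))
  natℚ-+ (suc m) n = trans (natℚ-suc (m ℕ.+ n)) (trans (cong (_+ 1ℚ) (natℚ-+ m n))
    (trans (solve 2 (λ x y → (x :+ y) :+ con 1ℚ := (x :+ con 1ℚ) :+ y) refl (natℚ m) (natℚ n))
      (cong (_+ natℚ n) (sym (natℚ-suc m)))))

  natℚ-* : ∀ m n → natℚ (m ℕ.* n) ≡ natℚ m * natℚ n
  natℚ-* zero    n = sym (*-zeroˡ (natℚ n))
  natℚ-* (suc m) n = trans (natℚ-+ n (m ℕ.* n)) (trans (cong (λ t → natℚ n + t) (natℚ-* m n))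
    (trans (solve 2 (λ x y → y :+ x :* y := (x :+ con 1ℚ) :* y) refl (natℚ m) (natℚ n))
      (cong (_* natℚ n) (sym (natℚ-suc m)))))

  natℚ-pos : ∀ {n} → 0 ℕ.< n → 0ℚ < natℚ n
  natℚ-pos {suc n} _ = <-≤-trans 0<1 (natℚ-mono {1} {suc n} (ℕ.s≤s ℕ.z≤n))

  natℚ-cancel-≤ : ∀ {m n} → natℚ m ≤ natℚ n → m ℕ.≤ n
  natℚ-cancel-≤ {m} {n} m≤n with m ℕₚ.≤? n
  ... | yes p = p
  ... | no m≰n = ⊥-elim (<-irrefl refl (<-≤-trans (subst (_< natℚ n + 1ℚ) (+-identityʳ (natℚ n)) (+-monoʳ-< (natℚ n) 0<1))
    (≤-trans (subst (_≤ natℚ m) (natℚ-suc n) (natℚ-mono (ℕₚ.≰⇒> m≰n))) m≤n)))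

  ∑<-mono : ∀ n {f g} → (∀ k → f k ≤ g k) → ∑< n f ≤ ∑< n g
  ∑<-mono zero    f≤g = ≤-refl
  ∑<-mono (suc n) f≤g = +-mono-≤ (∑<-mono n f≤g) (f≤g n)

  ∑<-abs : ∀ n {f g} → (∀ k → ∣ f k ∣ ≤ g k) → ∣ ∑< n f ∣ ≤ ∑< n g
  ∑<-abs zero    f≤g = ≤-refl
  ∑<-abs (suc n) {f} f≤g = ≤-trans (∣p+q∣≤∣p∣+∣q∣ (∑< n f) (f n)) (+-mono-≤ (∑<-abs n f≤g) (f≤g n))

  ∑<-*ˡ : ∀ n c f → ∑< n (λ k → c * f k) ≡ c * ∑< n f
  ∑<-*ˡ zero    c f = sym (*-zeroʳ c)
  ∑<-*ˡ (suc n) c f = trans (cong (_+ c * f n) (∑<-*ˡ n c f)) (sym (*-distribˡ-+ c (∑< n f) (f n)))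

  ∑<-nonNeg : ∀ n {f} → (∀ k → 0ℚ ≤ f k) → 0ℚ ≤ ∑< n f
  ∑<-nonNeg zero    0≤f = ≤-refl
  ∑<-nonNeg (suc n) 0≤f = +-nonNeg (∑<-nonNeg n 0≤f) (0≤f n)

  Exp∑ : ℕ → ℚ → ℚ
  Exp∑ n q = ∑< n (expTerm q)

  expLip-sum : ∀ n {R} → 0ℚ ≤ R → ∑< n (expLip R) ≤ Exp∑ n R
  expLip-sum n {R} 0≤R = subst (∑< n (expLip R) ≤_) (shift n) (0≤a⇒b≤b+a (expLip-nonNeg n) (∑< n (expLip R)))
    where
    expLip-nonNeg : ∀ k → 0ℚ ≤ expLip R k
    expLip-nonNeg zero    = ≤-refl
    expLip-nonNeg (suc k) = expTerm-nonNeg 0≤R k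
    shift : ∀ n → ∑< (suc n) (expLip R) ≡ Exp∑ n R
    shift zero    = refl
    shift (suc n) = cong (_+ expTerm R n) (shift n)

  -- The derivative of the partial sum is at most the partial sum, so a step of ½ adds at most half
  -- the new value: E′ ≤ E + ½ E′. A full step would give no information, so each unit is taken as
  -- two half steps, which yields the base 4.
  Exp∑-half : ∀ n {R} → 0ℚ ≤ R → Exp∑ n (R + ½) ≤ natℚ 2 * Exp∑ n R
  Exp∑-half n {R} 0≤R = 0≤-⇒≤ (subst (0ℚ ≤_) (solve 2 (λ x y → con (natℚ 2) :* (y :+ con ½ :* x :- x) := con (natℚ 2) :* y :- x) refl E′ E)
    (*-nonNeg 0≤2 (≤⇒0≤- bound)))
    where
    R′ = R + ½
    E = Exp∑ n R
    E′ = Exp∑ n R′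
    0≤½ : 0ℚ ≤ ½
    0≤½ = nonNegative⁻¹ ½
    0≤R′ : 0ℚ ≤ R′
    0≤R′ = +-nonNeg 0≤R 0≤½
    R≤R′ : ∣ R ∣ ≤ R′
    R≤R′ = subst (_≤ R′) (sym (0≤p⇒∣p∣≡p 0≤R)) (0≤a⇒b≤b+a 0≤½ R)
    step : ∀ k → expTerm R′ k - expTerm R k ≤ ½ * expLip R′ k
    step k = ≤-trans (p≤∣p∣ _) (≤-trans (expTerm-lip 0≤R′ (≤-reflexive (0≤p⇒∣p∣≡p 0≤R′)) R≤R′ k)
      (≤-reflexive (trans (*-comm (expLip R′ k) ∣ R′ - R ∣) (cong (λ t → ∣ t ∣ * expLip R′ k)
        (solve 1 (λ r → (r :+ con ½) :- r := con ½) refl R)))))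
    bound : E′ ≤ E + ½ * E′
    bound = ≤-trans (≤-reflexive (trans (solve 2 (λ x y → x := y :+ (x :- y)) refl E′ E)
        (cong (λ t → E + t) (∑<-minus n (expTerm R′) (expTerm R)))))
      (+-monoʳ-≤ E (≤-trans (∑<-mono n step) (≤-trans (≤-reflexive (∑<-*ˡ n ½ (expLip R′)))
        (*-monoˡ-≤-nonNeg ½ (expLip-sum n 0≤R′)))))

  Exp∑-natℚ : ∀ n m → Exp∑ n (natℚ m) ≤ natℚ (4 ℕ.^ m)
  -- The empty sum is 0 rather than 1, so one more term is added before evaluating at 0.
  Exp∑-natℚ n zero = ≤-trans (0≤a⇒b≤b+a (expTerm-nonNeg ≤-refl n) (Exp∑ n 0ℚ)) (≤-reflexive (at-0 n))
    where
    at-0 : ∀ n → Exp∑ (suc n) 0ℚ ≡ 1ℚ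
    at-0 zero    = refl
    at-0 (suc n) = trans (cong₂ _+_ (at-0 n)
      (solve 2 (λ e r → (e :* con 0ℚ) :* r := con 0ℚ) refl (expTerm 0ℚ n) (1/suc n))) (+-identityʳ 1ℚ)
  Exp∑-natℚ n (suc m) = ≤-trans (≤-reflexive (cong (Exp∑ n) (trans (natℚ-suc m)
      (solve 1 (λ x → x :+ con 1ℚ := (x :+ con ½) :+ con ½) refl (natℚ m)))))
    (≤-trans (Exp∑-half n (+-nonNeg (natℚ-nonNeg m) (nonNegative⁻¹ ½)))
      (≤-trans (*-monoˡ-≤-nonNeg (natℚ 2) (Exp∑-half n (natℚ-nonNeg m)))
        (≤-trans (*-monoˡ-≤-nonNeg (natℚ 2) (*-monoˡ-≤-nonNeg (natℚ 2) (Exp∑-natℚ n m)))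
          (≤-reflexive (trans (solve 1 (λ x → con (natℚ 2) :* (con (natℚ 2) :* x) := con (natℚ 4) :* x) refl (natℚ (4 ℕ.^ m)))
            (sym (natℚ-* 4 (4 ℕ.^ m))))))))

  Exp∑≤ : ∀ n m {q} → ∣ q ∣ ≤ natℚ m → ∣ Exp∑ n q ∣ ≤ natℚ (4 ℕ.^ m)
  Exp∑≤ n m q≤m = ≤-trans (∑<-abs n (expTerm-abs q≤m)) (Exp∑-natℚ n m)

  Log∑ : ℕ → ℚ → ℚ
  Log∑ n z = ∑< n (logTerm z)

  logTerm-mono : ∀ {w z} → ∣ w ∣ ≤ z → ∀ k → ∣ logTerm w k ∣ ≤ logTerm z k
  logTerm-mono {w} {z} w≤z k = ≤-trans
    (≤-reflexive (trans (∣p*q∣≡∣p∣*∣q∣ (natℚ 2 * p) r)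
      (cong₂ _*_ (∣p*q∣≡∣p∣*∣q∣ (natℚ 2) p) (0≤p⇒∣p∣≡p (1/suc-nonNeg (2 ℕ.* k))))))
    (*-monoʳ-≤-nonNeg r {{nonNegative (1/suc-nonNeg (2 ℕ.* k))}}
      (*-monoˡ-≤-nonNeg (natℚ 2) (^-abs w≤z (suc (2 ℕ.* k)))))
    where
    p = w ^ suc (2 ℕ.* k)
    r = 1/suc (2 ℕ.* k)

  Log∑-abs : ∀ n {w z} → ∣ w ∣ ≤ z → ∣ Log∑ n w ∣ ≤ Log∑ n z
  Log∑-abs n w≤z = ∑<-abs n (logTerm-mono w≤z)

  cay : ℚ → ℚ
  cay x = (x - 1ℚ) * recip (x + 1ℚ)

  +1-pos : ∀ {x} → 0ℚ ≤ x → 0ℚ < x + 1ℚ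
  +1-pos {x} 0≤x = <-≤-trans 0<1 (subst (1ℚ ≤_) (+-comm 1ℚ x) (0≤a⇒b≤b+a 0≤x 1ℚ))

  cay-* : ∀ {x} → 0ℚ ≤ x → cay x * (x + 1ℚ) ≡ x - 1ℚ
  cay-* {x} 0≤x = trans (solve 3 (λ a r d → (a :* r) :* d := a :* (d :* r)) refl (x - 1ℚ) (recip (x + 1ℚ)) (x + 1ℚ))
    (trans (cong ((x - 1ℚ) *_) (recip-inverse (x + 1ℚ) (>⇒≢0 (+1-pos 0≤x)))) (*-identityʳ (x - 1ℚ)))

  -- ∣ (x - 1) / (x + 1) ∣ ≤ (y - 1) / (y + 1) means x ≤ y and 1 ≤ x y.
  cay-mono : ∀ {x y} → 0ℚ ≤ x → x ≤ y → 1ℚ ≤ x * y → ∣ cay x ∣ ≤ cay y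
  cay-mono {x} {y} 0≤x x≤y 1≤xy = ∣p∣≤ (cay x)
    (*-cancelʳ-≤-pos D {{positive 0<D}} (subst₂ _≤_ (sym e₁) (sym e₂)
      (0≤-⇒≤ (subst (0ℚ ≤_) (solve 2 (λ x y → (y :- x) :+ (y :- x) := (y :- con 1ℚ) :* (x :+ con 1ℚ) :- (x :- con 1ℚ) :* (y :+ con 1ℚ)) refl x y)
        (+-nonNeg (≤⇒0≤- x≤y) (≤⇒0≤- x≤y))))))
    (*-cancelʳ-≤-pos D {{positive 0<D}} (subst₂ _≤_ (sym (trans (solve 2 (λ c d → (:- c) :* d := :- (c :* d)) refl (cay x) D) (cong -_ e₁))) (sym e₂)
      (0≤-⇒≤ (subst (0ℚ ≤_) (solve 2 (λ x y → (x :* y :- con 1ℚ) :+ (x :* y :- con 1ℚ) := (y :- con 1ℚ) :* (x :+ con 1ℚ) :- (:- ((x :- con 1ℚ) :* (y :+ con 1ℚ)))) refl x y)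
        (+-nonNeg (≤⇒0≤- 1≤xy) (≤⇒0≤- 1≤xy))))))
    where
    0≤y = ≤-trans 0≤x x≤y
    D = (x + 1ℚ) * (y + 1ℚ)
    0<D : 0ℚ < D
    0<D = *-pos (+1-pos 0≤x) (+1-pos 0≤y)
    e₁ : cay x * D ≡ (x - 1ℚ) * (y + 1ℚ)
    e₁ = trans (sym (*-assoc (cay x) (x + 1ℚ) (y + 1ℚ))) (cong (_* (y + 1ℚ)) (cay-* 0≤x))
    e₂ : cay y * D ≡ (y - 1ℚ) * (x + 1ℚ)
    e₂ = trans (solve 3 (λ c a b → c :* (a :* b) := (c :* b) :* a) refl (cay y) (x + 1ℚ) (y + 1ℚ)) (cong (_* (x + 1ℚ)) (cay-* 0≤y))

  ^-lower : ∀ {u v} → 0ℚ ≤ u → u ≤ v → ∀ j → natℚ (suc j) * u ^ j * (v - u) ≤ v ^ suc j - u ^ suc j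
  ^-lower {u} {v} 0≤u u≤v zero = ≤-reflexive
    (solve 2 (λ u v → con 1ℚ :* con 1ℚ :* (v :- u) := v :* con 1ℚ :- u :* con 1ℚ) refl u v)
  ^-lower {u} {v} 0≤u u≤v (suc j) = ≤-trans
    (≤-reflexive (trans (cong (λ t → t * (u * u ^ j) * (v - u)) (natℚ-suc (suc j)))
      (solve 4 (λ n u p d → (n :+ con 1ℚ) :* (u :* p) :* d := u :* (n :* p :* d) :+ d :* (u :* p)) refl (natℚ (suc j)) u (u ^ j) (v - u))))
    (≤-trans (+-monoˡ-≤ ((v - u) * u ^ suc j)
      (*-mono 0≤u u≤v (*-nonNeg (*-nonNeg (natℚ-nonNeg (suc j)) (^-nonNeg 0≤u j)) (≤⇒0≤- u≤v)) (^-lower 0≤u u≤v j)))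
      (≤-reflexive (solve 4 (λ u v p q → v :* (p :- q) :+ (v :- u) :* q := v :* p :- u :* q) refl u v (v ^ suc j) (u ^ suc j))))

  ^-even : ∀ (v : ℚ) k → v ^ (2 ℕ.* suc k) ≡ v * v * v ^ (2 ℕ.* k)
  ^-even v k = trans (cong (v ^_) (ℕₚ.*-suc 2 k)) (sym (*-assoc v v (v ^ (2 ℕ.* k))))

  -- Half the derivative of `Log∑ n` at `v`, a partial sum of 1 / (1 - v ^ 2).
  Even∑ : ℕ → ℚ → ℚ
  Even∑ n v = ∑< n (λ k → v ^ (2 ℕ.* k))

  Even∑-geometric : ∀ n v → (1ℚ - v * v) * Even∑ n v ≡ 1ℚ - v ^ (2 ℕ.* n)
  Even∑-geometric zero    v = *-zeroʳ (1ℚ - v * v)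
  Even∑-geometric (suc n) v = trans (*-distribˡ-+ (1ℚ - v * v) (Even∑ n v) (v ^ (2 ℕ.* n)))
    (trans (cong (_+ (1ℚ - v * v) * v ^ (2 ℕ.* n)) (Even∑-geometric n v))
      (trans (solve 2 (λ v p → (con 1ℚ :- p) :+ (con 1ℚ :- v :* v) :* p := con 1ℚ :- v :* v :* p) refl v (v ^ (2 ℕ.* n)))
        (cong (λ t → 1ℚ - t) (sym (^-even v n)))))

  Even∑-nonNeg : ∀ n {v} → 0ℚ ≤ v → 0ℚ ≤ Even∑ n v
  Even∑-nonNeg n 0≤v = ∑<-nonNeg n (λ k → ^-nonNeg 0≤v (2 ℕ.* k))

  logTerm-diff : ∀ v u k → logTerm v k - logTerm u k ≡ natℚ 2 * 1/suc (2 ℕ.* k) * (v ^ suc (2 ℕ.* k) - u ^ suc (2 ℕ.* k))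
  logTerm-diff v u k = solve 4 (λ a p q r → (a :* p) :* r :- (a :* q) :* r := a :* r :* (p :- q)) refl
    (natℚ 2) (v ^ suc (2 ℕ.* k)) (u ^ suc (2 ℕ.* k)) (1/suc (2 ℕ.* k))

  logTerm-slope : ∀ k p d → natℚ 2 * 1/suc (2 ℕ.* k) * (natℚ (suc (2 ℕ.* k)) * p * d) ≡ natℚ 2 * d * p
  logTerm-slope k p d = trans
    (solve 5 (λ a r n p d → a :* r :* (n :* p :* d) := (n :* r) :* (a :* d :* p)) refl (natℚ 2) (1/suc (2 ℕ.* k)) (natℚ (suc (2 ℕ.* k))) p d)
    (trans (cong (_* (natℚ 2 * d * p)) (1/suc-inverse (2 ℕ.* k))) (*-identityˡ (natℚ 2 * d * p)))

  0≤2/suc : ∀ k → 0ℚ ≤ natℚ 2 * 1/suc (2 ℕ.* k)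
  0≤2/suc k = *-nonNeg 0≤2 (1/suc-nonNeg (2 ℕ.* k))

  -- The mean value theorem for artanh, whose derivative is 1 / (1 - z ^ 2).
  module _ {u v} (0≤u : 0ℚ ≤ u) (u≤v : u ≤ v) where

    private
      0≤v : 0ℚ ≤ v
      0≤v = ≤-trans 0≤u u≤v

    Log∑-diff≤ : ∀ n → Log∑ n v - Log∑ n u ≤ natℚ 2 * (v - u) * Even∑ n v
    Log∑-diff≤ n = ≤-trans (≤-reflexive (∑<-minus n (logTerm v) (logTerm u)))
      (≤-trans (∑<-mono n term) (≤-reflexive (∑<-*ˡ n (natℚ 2 * (v - u)) (λ k → v ^ (2 ℕ.* k)))))
      where
      term : ∀ k → logTerm v k - logTerm u k ≤ natℚ 2 * (v - u) * v ^ (2 ℕ.* k)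
      term k = ≤-trans (≤-reflexive (logTerm-diff v u k))
        (≤-trans (*-monoˡ-≤-nonNeg (natℚ 2 * 1/suc (2 ℕ.* k)) {{nonNegative (0≤2/suc k)}}
          (≤-trans (p≤∣p∣ _) (^-lip 0≤v (≤-reflexive (0≤p⇒∣p∣≡p 0≤v)) (subst (_≤ v) (sym (0≤p⇒∣p∣≡p 0≤u)) u≤v) (2 ℕ.* k))))
          (≤-reflexive (trans (cong (λ t → natℚ 2 * 1/suc (2 ℕ.* k) * (natℚ (suc (2 ℕ.* k)) * v ^ (2 ℕ.* k) * t))
            (0≤p⇒∣p∣≡p (≤⇒0≤- u≤v))) (logTerm-slope k (v ^ (2 ℕ.* k)) (v - u)))))

    Log∑-diff≥ : ∀ n → natℚ 2 * (v - u) * Even∑ n u ≤ Log∑ n v - Log∑ n u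
    Log∑-diff≥ n = ≤-trans (≤-reflexive (sym (∑<-*ˡ n (natℚ 2 * (v - u)) (λ k → u ^ (2 ℕ.* k)))))
      (≤-trans (∑<-mono n term) (≤-reflexive (sym (∑<-minus n (logTerm v) (logTerm u)))))
      where
      term : ∀ k → natℚ 2 * (v - u) * u ^ (2 ℕ.* k) ≤ logTerm v k - logTerm u k
      term k = ≤-trans (≤-reflexive (sym (logTerm-slope k (u ^ (2 ℕ.* k)) (v - u))))
        (≤-trans (*-monoˡ-≤-nonNeg (natℚ 2 * 1/suc (2 ℕ.* k)) {{nonNegative (0≤2/suc k)}} (^-lower 0≤u u≤v (2 ℕ.* k)))
          (≤-reflexive (sym (logTerm-diff v u k))))

  ⅓ : ℚ
  ⅓ = 1/suc 2

  -- Partial sums do not obey log (2 x) = log x + log 2, so the gain of a doubling is estimated by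
  -- the mean value theorem between the Cayley transforms `u` and `v` of `x` and 2 x. In terms of α
  -- = 1 / (x + 1) and β = 1 / (2 x + 1) all quantities are polynomials.
  module Doubling {x} (1≤x : 1ℚ ≤ x) where

    x₂ u v α β : ℚ
    x₂ = x + x
    u = cay x
    v = cay x₂
    α = recip (x + 1ℚ)
    β = recip (x₂ + 1ℚ)

    0≤x : 0ℚ ≤ x
    0≤x = ≤-trans 0≤1 1≤x

    0≤x₂ : 0ℚ ≤ x₂
    0≤x₂ = +-nonNeg 0≤x 0≤x

    α-inv : (x + 1ℚ) * α ≡ 1ℚ
    α-inv = recip-inverse (x + 1ℚ) (>⇒≢0 (+1-pos 0≤x))

    β-inv : (x₂ + 1ℚ) * β ≡ 1ℚ
    β-inv = recip-inverse (x₂ + 1ℚ) (>⇒≢0 (+1-pos 0≤x₂))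

    0<α : 0ℚ < α
    0<α = recip-pos (+1-pos 0≤x)

    0<β : 0ℚ < β
    0<β = recip-pos (+1-pos 0≤x₂)

    u≡ : u ≡ 1ℚ - (α + α)
    u≡ = trans (solve 2 (λ x a → (x :- con 1ℚ) :* a := (x :+ con 1ℚ) :* a :- (a :+ a)) refl x α) (cong (_- (α + α)) α-inv)

    v≡ : v ≡ 1ℚ - (β + β)
    v≡ = trans (solve 2 (λ x a → (x :- con 1ℚ) :* a := (x :+ con 1ℚ) :* a :- (a :+ a)) refl x₂ β) (cong (_- (β + β)) β-inv)

    1-α : 1ℚ - α ≡ α * x
    1-α = trans (cong (_- α) (sym α-inv)) (solve 2 (λ x a → (x :+ con 1ℚ) :* a :- a := a :* x) refl x α)

    1-β : 1ℚ - β ≡ β * x₂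
    1-β = trans (cong (_- β) (sym β-inv)) (solve 2 (λ x a → (x :+ con 1ℚ) :* a :- a := a :* x) refl x₂ β)

    α-β : α - β ≡ α * β * x
    α-β = trans (sym (cong₂ _-_ (trans (cong (α *_) β-inv) (*-identityʳ α)) (trans (cong (β *_) α-inv) (*-identityʳ β))))
      (solve 3 (λ x a b → a :* ((x :+ x :+ con 1ℚ) :* b) :- b :* ((x :+ con 1ℚ) :* a) := a :* b :* x) refl x α β)

    2β-α : β + β - α ≡ α * β
    2β-α = trans (sym (cong₂ (λ s t → s + s - t) (trans (cong (β *_) α-inv) (*-identityʳ β)) (trans (cong (α *_) β-inv) (*-identityʳ α))))
      (solve 3 (λ x a b → b :* ((x :+ con 1ℚ) :* a) :+ b :* ((x :+ con 1ℚ) :* a) :- a :* ((x :+ x :+ con 1ℚ) :* b) := a :* b) refl x α β)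

    2[v-u] : natℚ 2 * (v - u) ≡ natℚ 4 * (α * β * x)
    2[v-u] = trans (cong₂ (λ s t → natℚ 2 * (s - t)) v≡ u≡)
      (trans (solve 2 (λ a b → con (natℚ 2) :* ((con 1ℚ :- (b :+ b)) :- (con 1ℚ :- (a :+ a))) := con (natℚ 4) :* (a :- b)) refl α β)
        (cong (natℚ 4 *_) α-β))

    1-v² : 1ℚ - v * v ≡ natℚ 4 * (β * (β * x₂))
    1-v² = trans (cong (λ s → 1ℚ - s * s) v≡)
      (trans (solve 1 (λ b → con 1ℚ :- (con 1ℚ :- (b :+ b)) :* (con 1ℚ :- (b :+ b)) := con (natℚ 4) :* (b :* (con 1ℚ :- b))) refl β)
        (cong (λ s → natℚ 4 * (β * s)) 1-β))

    1-u² : 1ℚ - u * u ≡ natℚ 4 * (α * (α * x))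
    1-u² = trans (cong (λ s → 1ℚ - s * s) u≡)
      (trans (solve 1 (λ b → con 1ℚ :- (con 1ℚ :- (b :+ b)) :* (con 1ℚ :- (b :+ b)) := con (natℚ 4) :* (b :* (con 1ℚ :- b))) refl α)
        (cong (λ s → natℚ 4 * (α * s)) 1-α))

    0≤4xαβ : ∀ {s} → 0ℚ ≤ s → 0ℚ ≤ natℚ 4 * (s * x * (α * β))
    0≤4xαβ 0≤s = *-nonNeg (natℚ-nonNeg 4) (*-nonNeg (*-nonNeg 0≤s 0≤x) (*-nonNeg (<⇒≤ 0<α) (<⇒≤ 0<β)))

    -- This bound and `slope≥` both come down to 2 β - α = α β ≥ 0.
    slope≤ : natℚ 2 * (v - u) ≤ 1ℚ - v * v
    slope≤ = 0≤-⇒≤ (subst (0ℚ ≤_) (sym (trans (cong₂ _-_ 1-v² 2[v-u])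
      (trans (solve 3 (λ x a b → con (natℚ 4) :* (b :* (b :* (x :+ x))) :- con (natℚ 4) :* (a :* b :* x)
          := con (natℚ 4) :* (b :* x :* (b :+ b :- a))) refl x α β)
        (cong (λ s → natℚ 4 * (β * x * s)) 2β-α)))) (0≤4xαβ (<⇒≤ 0<β)))

    slope≥ : ½ * (1ℚ - u * u) ≤ natℚ 2 * (v - u)
    slope≥ = 0≤-⇒≤ (subst (0ℚ ≤_) (sym (trans (cong₂ (λ s t → s - ½ * t) 2[v-u] 1-u²)
      (trans (solve 3 (λ x a b → con (natℚ 4) :* (a :* b :* x) :- con ½ :* (con (natℚ 4) :* (a :* (a :* x)))
          := con ½ :* (con (natℚ 4) :* (a :* x :* (b :+ b :- a)))) refl x α β)
        (cong (λ s → ½ * (natℚ 4 * (α * x * s))) 2β-α)))) (*-nonNeg (nonNegative⁻¹ ½) (0≤4xαβ (<⇒≤ 0<α))))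

    0≤u : 0ℚ ≤ u
    0≤u = *-nonNeg (≤⇒0≤- 1≤x) (<⇒≤ 0<α)

    u≤v : u ≤ v
    u≤v = ≤-trans (p≤∣p∣ u) (cay-mono 0≤x (0≤a⇒b≤b+a 0≤x x)
      (≤-trans (≤-trans (≤-reflexive (sym (*-identityˡ 1ℚ))) (*-mono 0≤1 1≤x 0≤1 1≤x))
        (*-monoˡ-≤-nonNeg x {{nonNegative 0≤x}} (0≤a⇒b≤b+a 0≤x x))))

    0≤v : 0ℚ ≤ v
    0≤v = ≤-trans 0≤u u≤v

    Log∑-double≤ : ∀ n → Log∑ n v ≤ Log∑ n u + 1ℚ
    Log∑-double≤ n = ≤-trans (≤-reflexive (solve 2 (λ a b → a := b :+ (a :- b)) refl (Log∑ n v) (Log∑ n u)))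
      (+-monoʳ-≤ (Log∑ n u) (≤-trans (Log∑-diff≤ 0≤u u≤v n)
        (≤-trans (*-monoʳ-≤-nonNeg (Even∑ n v) {{nonNegative (Even∑-nonNeg n 0≤v)}} slope≤)
          (≤-trans (≤-reflexive (Even∑-geometric n v)) (0≤-⇒≤ (subst (0ℚ ≤_)
            (solve 1 (λ p → p := con 1ℚ :- (con 1ℚ :- p)) refl (v ^ (2 ℕ.* n))) (^-nonNeg 0≤v (2 ℕ.* n))))))))

    -- Truncation leaves ½ (1 - u ^ (2 n)), so the bound holds only for large `n`. Since ½ (1 - ⅓) =
    -- ⅓, the same ⅓ serves as tolerance and as gain.
    Log∑-double≥ : ∃ λ N → ∀ n → N ℕ.≤ n → Log∑ n u + ⅓ ≤ Log∑ n v
    Log∑-double≥ = from (^-null 0≤u (+-mono-< 0<α 0<α) u+2α ⅓ (positive⁻¹ ⅓))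
      where
      u+2α : u + (α + α) ≡ 1ℚ
      u+2α = trans (cong (_+ (α + α)) u≡) (solve 1 (λ a → (con 1ℚ :- (a :+ a)) :+ (a :+ a) := con 1ℚ) refl α)
      from : (∃ λ N → u ^ N ≤ ⅓) → ∃ λ N → ∀ n → N ℕ.≤ n → Log∑ n u + ⅓ ≤ Log∑ n v
      from (N , small) = N , λ n N≤n → ≤-trans (+-monoʳ-≤ (Log∑ n u) (≤-trans (third n N≤n)
          (≤-trans (≤-reflexive (trans (cong (½ *_) (sym (Even∑-geometric n u))) (sym (*-assoc ½ (1ℚ - u * u) (Even∑ n u)))))
            (≤-trans (*-monoʳ-≤-nonNeg (Even∑ n u) {{nonNegative (Even∑-nonNeg n 0≤u)}} slope≥) (Log∑-diff≥ 0≤u u≤v n)))))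
        (≤-reflexive (solve 2 (λ a b → b :+ (a :- b) := a) refl (Log∑ n v) (Log∑ n u)))
        where
        third : ∀ n → N ℕ.≤ n → ⅓ ≤ ½ * (1ℚ - u ^ (2 ℕ.* n))
        third n N≤n = ≤-trans (≤-reflexive {⅓} {½ * (1ℚ - ⅓)} refl) (*-monoˡ-≤-nonNeg ½ (+-monoʳ-≤ 1ℚ (neg-antimono-≤
          (≤-trans (^-antimono 0≤u (+-mono-< 0<α 0<α) u+2α (ℕₚ.≤-trans N≤n (ℕₚ.m≤m+n n _))) small))))

  1≤2^ : ∀ J → 1ℚ ≤ natℚ (2 ℕ.^ J)
  1≤2^ J = natℚ-mono (ℕₚ.m^n>0 2 J)

  natℚ-2^suc : ∀ J → natℚ (2 ℕ.^ suc J) ≡ natℚ (2 ℕ.^ J) + natℚ (2 ℕ.^ J)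
  natℚ-2^suc J = trans (cong (λ t → natℚ (2 ℕ.^ J ℕ.+ t)) (ℕₚ.+-identityʳ (2 ℕ.^ J))) (natℚ-+ (2 ℕ.^ J) (2 ℕ.^ J))

  Log∑-0 : ∀ n → Log∑ n 0ℚ ≡ 0ℚ
  Log∑-0 zero    = refl
  Log∑-0 (suc n) = trans (cong₂ _+_ (Log∑-0 n)
    (solve 2 (λ p r → (con (natℚ 2) :* (con 0ℚ :* p)) :* r := con 0ℚ) refl (0ℚ ^ (2 ℕ.* n)) (1/suc (2 ℕ.* n)))) (+-identityʳ 0ℚ)

  Log∑-2^≤ : ∀ J n → Log∑ n (cay (natℚ (2 ℕ.^ J))) ≤ natℚ J
  Log∑-2^≤ zero    n = ≤-reflexive (Log∑-0 n)
  Log∑-2^≤ (suc J) n = ≤-trans (≤-reflexive (cong (λ t → Log∑ n (cay t)) (natℚ-2^suc J)))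
    (≤-trans (Doubling.Log∑-double≤ (1≤2^ J) n) (≤-trans (+-monoˡ-≤ 1ℚ (Log∑-2^≤ J n)) (≤-reflexive (sym (natℚ-suc J)))))

  Log∑-2^≥ : ∀ J → ∃ λ N → ∀ n → N ℕ.≤ n → natℚ J * ⅓ ≤ Log∑ n (cay (natℚ (2 ℕ.^ J)))
  Log∑-2^≥ zero    = 0 , λ n _ → ≤-reflexive (trans (*-zeroˡ ⅓) (sym (Log∑-0 n)))
  Log∑-2^≥ (suc J) = from (Log∑-2^≥ J) (Doubling.Log∑-double≥ (1≤2^ J))
    where
    x : ℚ
    x = natℚ (2 ℕ.^ J)
    from : (∃ λ N → ∀ n → N ℕ.≤ n → natℚ J * ⅓ ≤ Log∑ n (cay x)) →
      (∃ λ N → ∀ n → N ℕ.≤ n → Log∑ n (cay x) + ⅓ ≤ Log∑ n (cay (x + x))) →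
      ∃ λ N → ∀ n → N ℕ.≤ n → natℚ (suc J) * ⅓ ≤ Log∑ n (cay (natℚ (2 ℕ.^ suc J)))
    from (N , ih) (M , step) = N ℕ.⊔ M , λ n n≥ → ≤-trans
      (≤-reflexive (trans (cong (_* ⅓) (natℚ-suc J)) (solve 2 (λ j t → (j :+ con 1ℚ) :* t := j :* t :+ t) refl (natℚ J) ⅓)))
      (≤-trans (+-monoˡ-≤ ⅓ (ih n (ℕₚ.≤-trans (ℕₚ.m≤m⊔n N M) n≥)))
        (≤-trans (step n (ℕₚ.≤-trans (ℕₚ.m≤n⊔m N M) n≥)) (≤-reflexive (cong (λ t → Log∑ n (cay t)) (sym (natℚ-2^suc J))))))

  -- Eventual bounds for log and exp, and the assumption in dyadic form.

  Eventually : (ℕ → Set) → Set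
  Eventually P = ∃ λ N → ∀ n → N ℕ.≤ n → P n

  ev-map : ∀ {P Q : ℕ → Set} → (∀ n → P n → Q n) → Eventually P → Eventually Q
  ev-map f (N , p) = N , λ n N≤n → f n (p n N≤n)

  ev-map₂ : ∀ {P Q R : ℕ → Set} → (∀ n → P n → Q n → R n) → Eventually P → Eventually Q → Eventually R
  ev-map₂ f (N , p) (M , q) = N ℕ.⊔ M , λ n n≥ →
    f n (p n (ℕₚ.≤-trans (ℕₚ.m≤m⊔n N M) n≥)) (q n (ℕₚ.≤-trans (ℕₚ.m≤n⊔m N M) n≥))

  ev-witness : ∀ {P : ℕ → Set} → Eventually P → ∃ P
  ev-witness (N , p) = N , p N ℕₚ.≤-refl

  always : ∀ {P : ℕ → Set} → (∀ n → P n) → Eventually P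
  always p = 0 , λ n _ → p n

  positive-from : ∀ x {ε} → 0ℚ < ε → Eventually (λ n → ε ≤ approx x n) → 0ᴿ <ᴿ x
  positive-from x {ε} 0<ε = λ ev → ε , 0<ε , ev-map (λ n ε≤ → subst (_≤ approx x n) (sym (+-identityˡ ε)) ε≤) ev

  nonNeg-eventually : ∀ x → 0ᴿ <ᴿ x → Eventually (λ n → 0ℚ ≤ approx x n)
  nonNeg-eventually x (ε , 0<ε , ev) = ev-map (λ n ε≤ → ≤-trans (+-nonNeg ≤-refl (<⇒≤ 0<ε)) ε≤) ev

  eventually-∣∣≤ : ∀ x → ∃ λ k → Eventually (λ n → ∣ approx x n ∣ ≤ natℚ k)
  eventually-∣∣≤ x = from (bounded (cauchy x))
    where
    from : (∃ λ K → 0ℚ < K × Eventually (λ n → ∣ approx x n ∣ ≤ K)) → ∃ λ k → Eventually (λ n → ∣ approx x n ∣ ≤ natℚ k)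
    from (K , _ , ev) = proj₁ (archimedean K) , ev-map (λ n ≤K → ≤-trans ≤K (proj₂ (archimedean K))) ev

  abstract
    -- The second hypothesis means x ≥ 2 ^ (- J). It is needed because the logarithm is also taken
    -- of numbers below 1, such as log 2.
    log-∣∣≤ : ∀ x (p : 0ᴿ <ᴿ x) J → Eventually (λ n → approx x n ≤ natℚ (2 ℕ.^ J)) →
      Eventually (λ n → 1ℚ ≤ approx x n * natℚ (2 ℕ.^ J)) → Eventually (λ n → ∣ approx (log x p) n ∣ ≤ natℚ J)
    log-∣∣≤ x p J upper lower = ev-map₂ (λ n 0≤x (x≤ , 1≤) → ≤-trans (Log∑-abs n (cay-mono 0≤x x≤ 1≤)) (Log∑-2^≤ J n))
      (nonNeg-eventually x p) (ev-map₂ (λ _ x≤ 1≤ → x≤ , 1≤) upper lower)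

    log-≥ : ∀ x (p : 0ᴿ <ᴿ x) J → Eventually (λ n → natℚ (2 ℕ.^ J) ≤ approx x n) →
      Eventually (λ n → natℚ J * ⅓ ≤ approx (log x p) n)
    log-≥ x p J = ev-map₂ step (Log∑-2^≥ J)
      where
      z : ℚ
      z = natℚ (2 ℕ.^ J)
      step : ∀ n → natℚ J * ⅓ ≤ Log∑ n (cay z) → z ≤ approx x n → natℚ J * ⅓ ≤ Log∑ n (cay (approx x n))
      step n J≤ z≤x = ≤-trans J≤ (≤-trans (p≤∣p∣ _) (Log∑-abs n (cay-mono (≤-trans 0≤1 (1≤2^ J)) z≤x
        (≤-trans (≤-reflexive (sym (*-identityˡ 1ℚ))) (*-mono 0≤1 (1≤2^ J) 0≤1 (≤-trans (1≤2^ J) z≤x))))))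

    exp-∣∣≤ : ∀ x k → Eventually (λ n → ∣ approx x n ∣ ≤ natℚ k) → Eventually (λ n → ∣ approx (exp x) n ∣ ≤ natℚ (4 ℕ.^ k))
    exp-∣∣≤ x k = ev-map (λ n → Exp∑≤ n k)

  third : ∀ {k J} → 3 ℕ.* k ℕ.≤ J → natℚ k ≤ natℚ J * ⅓
  third {k} {J} 3k≤J = ≤-trans (≤-reflexive (trans (solve 1 (λ x → x := (con (natℚ 3) :* x) :* con ⅓) refl (natℚ k))
    (cong (_* ⅓) (sym (natℚ-* 3 k))))) (*-monoʳ-≤-nonNeg ⅓ (natℚ-mono 3k≤J))

  ∣*∣≤ : ∀ {x y m n} → ∣ x ∣ ≤ natℚ m → ∣ y ∣ ≤ natℚ n → ∣ x * y ∣ ≤ natℚ (m ℕ.* n)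
  ∣*∣≤ {x} {y} {m} {n} x≤ y≤ = ≤-trans (≤-reflexive (∣p*q∣≡∣p∣*∣q∣ x y))
    (≤-trans (*-mono (0≤∣p∣ x) x≤ (0≤∣p∣ y) y≤) (≤-reflexive (sym (natℚ-* m n))))

  module _ {A B : ℝ} (least : LeastPrimeBound A B) where

    private
      a₁ b₁ : ℕ
      a₁ = proj₁ (eventually-∣∣≤ A)
      b₁ = proj₁ (eventually-∣∣≤ B)

    -- From log m ≤ 4 ^ i follows ∣log log m∣ ≤ j with `j` linear in `i`, so the power of log m is
    -- at most 4 ^ (a₁ j). The `suc` in the second argument keeps it positive when a₁ = 0.
    least⇒small : SmallPrimes (b₁ ℕ.+ 4 ℕ.* a₁ ℕ.+ 1) (suc (4 ℕ.* a₁))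
    least⇒small i m c 2≤m m≤ gcd≡1 = from (least m 2≤m c gcd≡1)
      where
      M y : ℝ
      M = fromℕ m
      y = log-fromℕ m 2≤m
      0<M : 0ᴿ <ᴿ M
      0<M = 1<⇒0<ᴿ M (1<fromℕ 2≤m)
      0<y : 0ᴿ <ᴿ y
      0<y = log-fromℕ-pos m 2≤m
      j k : ℕ
      -- Already 2 i bounds log log m from above; the additional 2 gives 2 ^ j ≥ 3 for i = 0, so
      -- that log m ≥ ⅓ suffices for the bound from below.
      j = 2 ℕ.* suc i
      k = a₁ ℕ.* j
      y≤ : Eventually (λ n → ∣ approx y n ∣ ≤ natℚ (4 ℕ.^ i))
      y≤ = log-∣∣≤ M 0<M (4 ℕ.^ i) (always (λ _ → natℚ-mono m≤)) (always λ _ →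
        ≤-trans (≤-reflexive (sym (*-identityˡ 1ℚ))) (*-mono 0≤1 (natℚ-mono (ℕₚ.≤-trans (ℕ.s≤s ℕ.z≤n) 2≤m)) 0≤1 (1≤2^ (4 ℕ.^ i))))
      y≥ : Eventually (λ n → natℚ 1 * ⅓ ≤ approx y n)
      y≥ = log-≥ M 0<M 1 (always (λ _ → natℚ-mono 2≤m))
      4^i≤2^j : 4 ℕ.^ i ℕ.≤ 2 ℕ.^ j
      4^i≤2^j = ℕₚ.≤-trans (ℕₚ.≤-reflexive (ℕₚ.^-*-assoc 2 2 i)) (ℕₚ.^-monoʳ-≤ 2 (ℕₚ.*-monoʳ-≤ 2 (ℕₚ.n≤1+n i)))
      3≤2^j : 3 ℕ.≤ 2 ℕ.^ j
      3≤2^j = ℕₚ.≤-trans (ℕₚ.n≤1+n 3) (ℕₚ.^-monoʳ-≤ 2 {2} {j} (ℕₚ.*-monoʳ-≤ 2 (ℕ.s≤s ℕ.z≤n)))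
      loglog≤ : Eventually (λ n → ∣ approx (log y 0<y) n ∣ ≤ natℚ j)
      loglog≤ = log-∣∣≤ y 0<y j (ev-map (λ n y≤ → ≤-trans (p≤∣p∣ _) (≤-trans y≤ (natℚ-mono 4^i≤2^j))) y≤)
        (ev-map (λ n ⅓≤ → *-mono {1ℚ * ⅓} {approx y n} {natℚ 3} {natℚ (2 ℕ.^ j)} (nonNegative⁻¹ _) ⅓≤ (natℚ-nonNeg 3) (natℚ-mono 3≤2^j)) y≥)
      power : ℝ
      power = rpow y 0<y A
      power≤ : Eventually (λ n → ∣ approx power n ∣ ≤ natℚ (4 ℕ.^ k))
      power≤ = exp-∣∣≤ (A *ᴿ log y 0<y) k (ev-map₂ (λ n → ∣*∣≤ {approx A n} {approx (log y 0<y) n} {a₁} {j}) (proj₂ (eventually-∣∣≤ A)) loglog≤)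
      product≤ : Eventually (λ n → approx (B *ᴿ M *ᴿ power) n ≤ natℚ (b₁ ℕ.* m ℕ.* 4 ℕ.^ k))
      product≤ = ev-map₂ (λ n B≤ P≤ → ≤-trans (p≤∣p∣ _) (∣*∣≤ {approx B n * natℚ m} {approx power n} {b₁ ℕ.* m} {4 ℕ.^ k}
          (∣*∣≤ {approx B n} {natℚ m} {b₁} {m} B≤ (≤-reflexive (0≤p⇒∣p∣≡p (natℚ-nonNeg m)))) P≤))
        (proj₂ (eventually-∣∣≤ B)) power≤
      exps : ∀ b a i → b ℕ.+ 2 ℕ.* (a ℕ.* (2 ℕ.* suc i)) ℕ.+ 1 ≡ b ℕ.+ 4 ℕ.* a ℕ.+ 1 ℕ.+ 4 ℕ.* a ℕ.* i
      exps = solveℕ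
      from : (∃ λ p → IsLeastPrime≡ c m p × fromℕ p ≤ᴿ B *ᴿ M *ᴿ power) →
        ∃ λ p → Prime p × (+ m) ℤ.∣ (+ p ℤ.- c) ×
          p ℕ.≤ m ℕ.* 2 ℕ.^ (b₁ ℕ.+ 4 ℕ.* a₁ ℕ.+ 1 ℕ.+ suc (4 ℕ.* a₁) ℕ.* i)
      from (p , (pp , m∣ , _) , p≤) = p , pp , m∣ , (begin
        -- The real inequality is used with ε = 1; the resulting 1 is absorbed by a doubling, the
        -- final + 1 of the first argument of `SmallPrimes`.
        p                                                     ≤⟨ natℚ-cancel-≤ {p} {suc Y} (proj₂ (ev-witness
          (ev-map₂ (λ n p≤ prod≤ → ≤-trans p≤ (≤-trans (+-monoˡ-≤ 1ℚ prod≤) (≤-reflexive (sym (natℚ-suc Y))))) (p≤ 1ℚ 0<1) product≤))) ⟩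
        1 ℕ.+ Y                                               ≤⟨ ℕₚ.+-mono-≤ 1≤Z Y≤Z ⟩
        Z ℕ.+ Z                                               ≡⟨ double m (2 ℕ.^ (b₁ ℕ.+ 2 ℕ.* k)) ⟩
        m ℕ.* (2 ℕ.^ (b₁ ℕ.+ 2 ℕ.* k) ℕ.* 2 ℕ.^ 1)            ≡⟨ cong (m ℕ.*_) (ℕₚ.^-distribˡ-+-* 2 (b₁ ℕ.+ 2 ℕ.* k) 1) ⟨
        m ℕ.* 2 ℕ.^ (b₁ ℕ.+ 2 ℕ.* k ℕ.+ 1)                    ≤⟨ ℕₚ.*-monoʳ-≤ m (ℕₚ.^-monoʳ-≤ 2 (ℕₚ.≤-trans
          (ℕₚ.≤-reflexive (exps b₁ a₁ i)) (ℕₚ.+-monoʳ-≤ (b₁ ℕ.+ 4 ℕ.* a₁ ℕ.+ 1) (ℕₚ.m≤n+m (4 ℕ.* a₁ ℕ.* i) i)))) ⟩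
        m ℕ.* 2 ℕ.^ (b₁ ℕ.+ 4 ℕ.* a₁ ℕ.+ 1 ℕ.+ suc (4 ℕ.* a₁) ℕ.* i)   ∎)
        where
        open ℕₚ.≤-Reasoning
        Y Z : ℕ
        Y = b₁ ℕ.* m ℕ.* 4 ℕ.^ k
        Z = m ℕ.* 2 ℕ.^ (b₁ ℕ.+ 2 ℕ.* k)
        double : ∀ m x → m ℕ.* x ℕ.+ m ℕ.* x ≡ m ℕ.* (x ℕ.* 2)
        double = solveℕ
        1≤Z : 1 ℕ.≤ Z
        1≤Z = ℕₚ.*-mono-≤ (ℕₚ.≤-trans (ℕ.s≤s ℕ.z≤n) 2≤m) (ℕₚ.m^n>0 2 (b₁ ℕ.+ 2 ℕ.* k))
        Y≤Z : Y ℕ.≤ Z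
        Y≤Z = begin
          b₁ ℕ.* m ℕ.* 4 ℕ.^ k                      ≤⟨ ℕₚ.*-monoˡ-≤ (4 ℕ.^ k) (ℕₚ.*-monoˡ-≤ m (n≤2^n b₁)) ⟩
          2 ℕ.^ b₁ ℕ.* m ℕ.* 4 ℕ.^ k                ≡⟨ cong₂ (λ s t → s ℕ.* t) (ℕₚ.*-comm (2 ℕ.^ b₁) m) (ℕₚ.^-*-assoc 2 2 k) ⟩
          m ℕ.* 2 ℕ.^ b₁ ℕ.* 2 ℕ.^ (2 ℕ.* k)        ≡⟨ ℕₚ.*-assoc m (2 ℕ.^ b₁) (2 ℕ.^ (2 ℕ.* k)) ⟩
          m ℕ.* (2 ℕ.^ b₁ ℕ.* 2 ℕ.^ (2 ℕ.* k))      ≡⟨ cong (m ℕ.*_) (ℕₚ.^-distribˡ-+-* 2 b₁ (2 ℕ.* k)) ⟨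
          m ℕ.* 2 ℕ.^ (b₁ ℕ.+ 2 ℕ.* k)              ∎

    small-primes : ∃₂ λ b e → SmallPrimes b (suc e)
    small-primes = b₁ ℕ.+ 4 ℕ.* a₁ ℕ.+ 1 , 4 ℕ.* a₁ , least⇒small

  -- Integer logarithms, the case a = 0, and infinitude.

  floor-log₂ : ∀ n → ∃ λ j → 2 ℕ.^ j ℕ.≤ suc n × suc n ℕ.< 2 ℕ.^ suc j
  floor-log₂ zero = 0 , ℕₚ.≤-refl , ℕₚ.≤-refl
  floor-log₂ (suc n) with floor-log₂ n
  ... | j , lo , hi with 2 ℕ.^ suc j ℕₚ.≤? suc (suc n)
  ...   | yes le = suc j , le , ℕₚ.≤-<-trans hi (ℕₚ.^-monoʳ-< 2 (ℕ.s≤s (ℕ.s≤s ℕ.z≤n)) (ℕₚ.n<1+n (suc j)))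
  ...   | no  gt = j , ℕₚ.m≤n⇒m≤1+n lo , ℕₚ.≰⇒> gt

  floor-log₂⁺ : ∀ {n} → 0 ℕ.< n → ∃ λ j → 2 ℕ.^ j ℕ.≤ n × n ℕ.< 2 ℕ.^ suc j
  floor-log₂⁺ {suc n} _ = floor-log₂ n

  2^-cancel-< : ∀ {m n} → 2 ℕ.^ m ℕ.< 2 ℕ.^ n → m ℕ.< n
  2^-cancel-< {m} {n} lt = ℕₚ.≰⇒> λ n≤m → ℕₚ.<⇒≱ lt (ℕₚ.^-monoʳ-≤ 2 n≤m)

  floorℚ : ∀ q → 0ℚ ≤ q → ∃ λ M → natℚ M ≤ q × q ≤ natℚ (suc M)
  floorℚ q 0≤q = search (proj₁ (archimedean q)) (proj₂ (archimedean q))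
    where
    search : ∀ n → q ≤ natℚ n → ∃ λ M → natℚ M ≤ q × q ≤ natℚ (suc M)
    search zero    q≤ = 0 , 0≤q , ≤-trans q≤ 0≤1
    search (suc n) q≤ with natℚ n ≤? q
    ... | yes n≤q = n , n≤q , q≤
    ... | no  n≰q = search n (<⇒≤ (≰⇒> n≰q))

  1+n≤2^n : ∀ n → 1 ℕ.+ n ℕ.≤ 2 ℕ.^ n
  1+n≤2^n zero    = ℕₚ.≤-refl
  1+n≤2^n (suc n) = ℕₚ.+-mono-≤ (ℕₚ.m^n>0 2 n) (ℕₚ.≤-trans (1+n≤2^n n) (ℕₚ.m≤m+n (2 ℕ.^ n) 0))

  -- For a = 0 the condition p ∣ n is void, so the composite numbers 2 (ℓ + 2 + i) serve.
  0-many : ManyCarmichaels (+ 0)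
  0-many = 4 , 3 , λ ℓ 3≤ℓ J J≥ _ → many ℓ 3≤ℓ J J≥
    where
    many : ∀ ℓ → 3 ℕ.≤ ℓ → ∀ J → 2 ℕ.^ (2 ℕ.^ ℓ) ℕ.≤ J →
      ∃₂ λ ns E → Unique ns × All (λ n → IsCarmichael (+ 0) n × n ℕ.≤ 2 ℕ.^ J × ℓ ℕ.< n) ns ×
        J ℕ.≤ 4 ℕ.* (ℓ ℕ.* ℓ) ℕ.* E × 4 ℕ.^ E ℕ.≤ length ns
    many ℓ 3≤ℓ J J≥ = applyUpTo f (4 ℕ.^ E) , E
        , Uniqueₚ.applyUpTo⁺₁ f (4 ℕ.^ E) (λ i<j _ eq → ℕₚ.<⇒≢ i<j (ℕₚ.+-cancelˡ-≡ (2 ℕ.+ ℓ) _ _ (ℕₚ.*-cancelˡ-≡ _ _ 2 eq)))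
        , Allₚ.applyUpTo⁺₁ f (4 ℕ.^ E) (λ {i} i< → carmichael₀ i , small i i<
            , ℕₚ.≤-trans (ℕₚ.≤-trans (ℕₚ.n≤1+n (suc ℓ)) (ℕₚ.m≤m+n (2 ℕ.+ ℓ) i)) (ℕₚ.m≤n*m (2 ℕ.+ ℓ ℕ.+ i) 2))
        , J≤
        , ℕₚ.≤-reflexive (sym (length-applyUpTo f (4 ℕ.^ E)))
      where
      open ℕₚ.≤-Reasoning
      E : ℕ
      E = J ℕ./ 4
      f : ℕ → ℕ
      f i = 2 ℕ.* (2 ℕ.+ ℓ ℕ.+ i)
      carmichael₀ : ∀ i → IsCarmichael (+ 0) (f i)
      carmichael₀ i = composite-≢ {f i} 2 (λ eq → ℕₚ.<⇒≢ (ℕ.s≤s (ℕ.s≤s ℕ.z≤n)) (ℕₚ.*-cancelˡ-≡ 1 (2 ℕ.+ ℓ ℕ.+ i) 2 eq))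
          (ℕ.m∣m*n (2 ℕ.+ ℓ ℕ.+ i))
        , λ p _ p∣ → subst₂ ℕ._∣_ (sym (ℕₚ.+-identityʳ p)) (sym (ℕₚ.+-identityʳ (f i))) p∣
      E≥ : 1 ℕ.+ ℓ ℕ.≤ E
      E≥ = ℕₚ.≤-trans (ℕₚ.≤-reflexive (sym (m*n/n≡m (1 ℕ.+ ℓ) 4))) (/-monoˡ-≤ 4 (begin
        (1 ℕ.+ ℓ) ℕ.* 4          ≤⟨ ℕₚ.*-monoˡ-≤ 4 (1+n≤2^n ℓ) ⟩
        2 ℕ.^ ℓ ℕ.* 2 ℕ.^ 2      ≡⟨ ℕₚ.^-distribˡ-+-* 2 ℓ 2 ⟨
        2 ℕ.^ (ℓ ℕ.+ 2)          ≤⟨ ℕₚ.^-monoʳ-≤ 2 (ℓ+2≤ 3≤ℓ) ⟩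
        2 ℕ.^ (2 ℕ.^ ℓ)          ≤⟨ J≥ ⟩
        J                        ∎))
        where
        ℓ+2≤ : ∀ {ℓ} → 3 ℕ.≤ ℓ → ℓ ℕ.+ 2 ℕ.≤ 2 ℕ.^ ℓ
        ℓ+2≤ {suc l} (ℕ.s≤s 2≤l) = begin
          suc l ℕ.+ 2              ≡⟨ ℕₚ.+-comm (suc l) 2 ⟩
          2 ℕ.+ suc l              ≤⟨ ℕₚ.+-monoˡ-≤ (suc l) (ℕₚ.≤-trans 2≤l (ℕₚ.n≤1+n l)) ⟩
          suc l ℕ.+ suc l          ≤⟨ ℕₚ.+-mono-≤ (1+n≤2^n l) (ℕₚ.≤-trans (1+n≤2^n l) (ℕₚ.m≤m+n (2 ℕ.^ l) 0)) ⟩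
          2 ℕ.^ suc l              ∎
      4E≤J : E ℕ.* 4 ℕ.≤ J
      4E≤J = m/n*n≤m J 4
      1≤E : 1 ℕ.≤ E
      1≤E = ℕₚ.≤-trans (ℕ.s≤s ℕ.z≤n) E≥
      small : ∀ i → i ℕ.< 4 ℕ.^ E → f i ℕ.≤ 2 ℕ.^ J
      small i i< = begin
        2 ℕ.* (2 ℕ.+ ℓ ℕ.+ i)            ≤⟨ ℕₚ.*-monoʳ-≤ 2 (ℕₚ.+-mono-≤ (ℕₚ.≤-trans (ℕ.s≤s E≥) (ℕₚ.≤-trans (1+n≤2^n E)
                                              (ℕₚ.^-monoˡ-≤ E (ℕ.s≤s (ℕ.s≤s ℕ.z≤n))))) (ℕₚ.<⇒≤ i<)) ⟩
        2 ℕ.* (4 ℕ.^ E ℕ.+ 4 ℕ.^ E)      ≡⟨ eq (4 ℕ.^ E) ⟩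
        4 ℕ.^ suc E                      ≡⟨ ℕₚ.^-*-assoc 2 2 (suc E) ⟩
        2 ℕ.^ (2 ℕ.* suc E)              ≤⟨ ℕₚ.^-monoʳ-≤ 2 (ℕₚ.≤-trans 2+2E≤4E 4E≤J) ⟩
        2 ℕ.^ J                          ∎
        where
        eq : ∀ x → 2 ℕ.* (x ℕ.+ x) ≡ 4 ℕ.* x
        eq = solveℕ
        eq′ : ∀ x → 2 ℕ.* (x ℕ.+ x) ≡ x ℕ.* 4
        eq′ = solveℕ
        2+2E≤4E : 2 ℕ.* suc E ℕ.≤ E ℕ.* 4
        2+2E≤4E = ℕₚ.≤-trans (ℕₚ.*-monoʳ-≤ 2 (ℕₚ.+-monoˡ-≤ E 1≤E)) (ℕₚ.≤-reflexive (eq′ E))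
      J≤ : J ℕ.≤ 4 ℕ.* (ℓ ℕ.* ℓ) ℕ.* E
      J≤ = begin
        J                                ≡⟨ m≡m%n+[m/n]*n J 4 ⟩
        J ℕ.% 4 ℕ.+ E ℕ.* 4              ≤⟨ ℕₚ.+-monoˡ-≤ (E ℕ.* 4) (ℕₚ.≤-trans (ℕₚ.<⇒≤ (m%n<n J 4)) (ℕₚ.*-monoˡ-≤ 4 1≤E)) ⟩
        E ℕ.* 4 ℕ.+ E ℕ.* 4              ≡⟨ eq E ⟩
        4 ℕ.* 2 ℕ.* E                    ≤⟨ ℕₚ.*-monoˡ-≤ E (ℕₚ.*-monoʳ-≤ 4 (ℕₚ.*-mono-≤ {2} {ℓ} {1} {ℓ}
                                              (ℕₚ.≤-trans (ℕₚ.n≤1+n 2) 3≤ℓ) (ℕₚ.≤-trans (ℕ.s≤s ℕ.z≤n) 3≤ℓ))) ⟩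
        4 ℕ.* (ℓ ℕ.* ℓ) ℕ.* E            ∎
        where
        eq : ∀ x → x ℕ.* 4 ℕ.+ x ℕ.* 4 ≡ 4 ℕ.* 2 ℕ.* x
        eq = solveℕ

  carmichael-many : (∃₂ λ b e → SmallPrimes b (suc e)) → ∀ a → ManyCarmichaels a
  carmichael-many _                (+ zero)     = 0-many
  carmichael-many (b , e , primes) a@(+ suc _)  = many-carmichaels {b} {suc e} primes (ℕ.s≤s ℕ.z≤n) a (ℕ.s≤s ℕ.z≤n)
  carmichael-many (b , e , primes) a@(-[1+ _ ]) = many-carmichaels {b} {suc e} primes (ℕ.s≤s ℕ.z≤n) a (ℕ.s≤s ℕ.z≤n)

  -- At the scale ℓ = ℓ₀ ⊔ k every number in the list exceeds ℓ, and 4 ^ E ≥ 1 keeps the list from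
  -- being empty.
  infinitely-many : ∀ a → ManyCarmichaels a → ∀ k → ∃ λ n → k ℕ.< n × IsCarmichael a n
  infinitely-many a (c , ℓ₀ , many) k = from (many ℓ (ℕₚ.m≤m⊔n ℓ₀ k) (2 ℕ.^ (2 ℕ.^ ℓ)) ℕₚ.≤-refl
      (ℕₚ.^-monoʳ-< 2 (ℕ.s≤s (ℕ.s≤s ℕ.z≤n)) (ℕₚ.^-monoʳ-< 2 (ℕ.s≤s (ℕ.s≤s ℕ.z≤n)) (ℕₚ.n<1+n ℓ))))
    where
    ℓ : ℕ
    ℓ = ℓ₀ ℕ.⊔ k
    from : (∃₂ λ ns E → Unique ns × All (λ n → IsCarmichael a n × n ℕ.≤ 2 ℕ.^ (2 ℕ.^ (2 ℕ.^ ℓ)) × ℓ ℕ.< n) ns ×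
        2 ℕ.^ (2 ℕ.^ ℓ) ℕ.≤ c ℕ.* (ℓ ℕ.* ℓ) ℕ.* E × 4 ℕ.^ E ℕ.≤ length ns) → ∃ λ n → k ℕ.< n × IsCarmichael a n
    from ([] , E , _ , _ , _ , 4^E≤0) = ⊥-elim (ℕₚ.<⇒≱ (ℕₚ.m^n>0 4 E) 4^E≤0)
    from (n ∷ _ , _ , _ , (carm , _ , ℓ<n) ∷ _ , _ , _) = n , ℕₚ.≤-<-trans (ℕₚ.m≤n⊔m ℓ₀ k) ℓ<n , carm

  -- Integer scales of a real number.

  -- `J`, `j` and `ℓ` are iterated binary logarithms of `X`. The integer part of a real cannot be
  -- decided, so `J` is only required to satisfy 2 ^ J ≤ X ≤ 2 ^ (2 + J).
  record Scales (ℓ₁ : ℕ) (X : ℝ) : Set where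
    field
      J j ℓ    : ℕ
      ℓ₁≤ℓ     : ℓ₁ ℕ.≤ ℓ
      2^ℓ≤j    : 2 ℕ.^ ℓ ℕ.≤ j
      2^j≤J    : 2 ℕ.^ j ℕ.≤ J
      J<       : J ℕ.< 2 ℕ.^ (2 ℕ.^ suc ℓ)
      lower    : Eventually (λ n → natℚ (2 ℕ.^ J) ≤ approx X n)
      upper    : Eventually (λ n → approx X n ≤ natℚ (2 ℕ.^ (2 ℕ.+ J)))

  -- Three exponentials undo the three logarithms leading to `ℓ`; the 4 leaves room for losses of 1
  -- from `_≤ᴿ_`, from the Cauchy radius and from rounding.
  threshold : ℕ → ℕ
  threshold ℓ₁ = 4 ℕ.+ 2 ℕ.^ (2 ℕ.^ (2 ℕ.^ ℓ₁))

  module _ (ℓ₁ : ℕ) (X : ℝ) (large : fromℕ (threshold ℓ₁) ≤ᴿ X) where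

    private
      T : ℕ
      T = 2 ℕ.^ (2 ℕ.^ (2 ℕ.^ ℓ₁))

    scales-from-floor : ∀ M → T ℕ.≤ M → Eventually (λ n → natℚ M ≤ approx X n × approx X n ≤ natℚ (3 ℕ.+ M)) → Scales ℓ₁ X
    scales-from-floor M T≤M bounds = from-J (floor-log₂⁺ (ℕₚ.≤-trans (ℕₚ.m^n>0 2 (2 ℕ.^ (2 ℕ.^ ℓ₁))) T≤M))
      where
      from-J : (∃ λ J → 2 ℕ.^ J ℕ.≤ M × M ℕ.< 2 ℕ.^ suc J) → Scales ℓ₁ X
      from-J (J , lo , hi) = from-j (floor-log₂⁺ (ℕₚ.≤-trans (ℕₚ.m^n>0 2 (2 ℕ.^ ℓ₁)) J≥))
        where
        J≥ : 2 ℕ.^ (2 ℕ.^ ℓ₁) ℕ.≤ J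
        J≥ = ℕ.s≤s⁻¹ (2^-cancel-< (ℕₚ.≤-<-trans T≤M hi))
        from-j : (∃ λ j → 2 ℕ.^ j ℕ.≤ J × J ℕ.< 2 ℕ.^ suc j) → Scales ℓ₁ X
        from-j (j , lo′ , hi′) = from-ℓ (floor-log₂⁺ (ℕₚ.≤-trans (ℕₚ.m^n>0 2 ℓ₁) j≥))
          where
          j≥ : 2 ℕ.^ ℓ₁ ℕ.≤ j
          j≥ = ℕ.s≤s⁻¹ (2^-cancel-< (ℕₚ.≤-<-trans J≥ hi′))
          from-ℓ : (∃ λ ℓ → 2 ℕ.^ ℓ ℕ.≤ j × j ℕ.< 2 ℕ.^ suc ℓ) → Scales ℓ₁ X
          from-ℓ (ℓ , lo″ , hi″) = record
            { J = J ; j = j ; ℓ = ℓ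
            ; ℓ₁≤ℓ = ℕ.s≤s⁻¹ (2^-cancel-< (ℕₚ.≤-<-trans j≥ hi″))
            ; 2^ℓ≤j = lo″ ; 2^j≤J = lo′
            ; J< = ℕₚ.<-≤-trans hi′ (ℕₚ.^-monoʳ-≤ 2 hi″)
            ; lower = ev-map (λ n (M≤ , _) → ≤-trans (natℚ-mono lo) M≤) bounds
            ; upper = ev-map (λ n (_ , ≤M) → ≤-trans ≤M (natℚ-mono 3+M≤)) bounds
            }
            where
            open ℕₚ.≤-Reasoning
            3+M≤ : 3 ℕ.+ M ℕ.≤ 2 ℕ.^ (2 ℕ.+ J)
            3+M≤ = begin
              2 ℕ.+ suc M                          ≤⟨ ℕₚ.+-mono-≤ (ℕₚ.^-monoʳ-≤ 2 {1} {suc J} (ℕ.s≤s ℕ.z≤n)) hi ⟩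
              2 ℕ.^ suc J ℕ.+ 2 ℕ.^ suc J          ≡⟨ cong (λ y → 2 ℕ.^ suc J ℕ.+ y) (ℕₚ.+-identityʳ (2 ℕ.^ suc J)) ⟨
              2 ℕ.^ (2 ℕ.+ J)                      ∎

    -- One rational approximation beyond both moduli is within 1 of all later ones, so its integer
    -- part, which is computable, determines every scale.
    scales : Scales ℓ₁ X
    scales = from-cauchy (cauchy X 1ℚ 0<1) (large 1ℚ 0<1)
      where
      from-cauchy : (∃ λ N → ∀ m n → N ℕ.≤ m → N ℕ.≤ n → ∣ approx X m - approx X n ∣ ≤ 1ℚ) →
        Eventually (λ n → natℚ (threshold ℓ₁) ≤ approx X n + 1ℚ) → Scales ℓ₁ X
      from-cauchy (N , close) (K , big) = from-floor (floorℚ r (≤-trans (natℚ-nonNeg (3 ℕ.+ T)) r≥))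
        where
        P : ℕ
        P = N ℕ.⊔ K
        r : ℚ
        r = approx X P
        near : ∀ n → N ℕ.≤ n → ∣ r - approx X n ∣ ≤ 1ℚ
        near n N≤n = close P n (ℕₚ.m≤m⊔n N K) N≤n
        +1-cancel : ∀ {x y} → x + 1ℚ ≤ y + 1ℚ → x ≤ y
        +1-cancel {x} {y} le = subst₂ _≤_ (e x) (e y) (+-monoˡ-≤ (- 1ℚ) le)
          where
          e : ∀ x → x + 1ℚ + - 1ℚ ≡ x
          e = solve 1 (λ x → x :+ con 1ℚ :+ con (- 1ℚ) := x) refl
        r≥ : natℚ (3 ℕ.+ T) ≤ r
        r≥ = +1-cancel (subst (_≤ r + 1ℚ) (natℚ-suc (3 ℕ.+ T)) (big P (ℕₚ.m≤n⊔m N K)))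
        from-floor : (∃ λ M → natℚ M ≤ r × r ≤ natℚ (suc M)) → Scales ℓ₁ X
        from-floor (zero , _ , r≤1) = ⊥-elim (ℕₚ.<⇒≱ (ℕ.s≤s (ℕ.s≤s ℕ.z≤n)) (natℚ-cancel-≤ {3 ℕ.+ T} {1} (≤-trans r≥ r≤1)))
        from-floor (suc M , M≤ , ≤M) = scales-from-floor M
          (ℕₚ.≤-trans (ℕₚ.n≤1+n T) (ℕ.s≤s⁻¹ (ℕ.s≤s⁻¹ (natℚ-cancel-≤ {3 ℕ.+ T} {2 ℕ.+ M} (≤-trans r≥ ≤M)))))
          (N , λ n N≤n →
            +1-cancel (≤-trans (≤-trans (≤-reflexive (sym (natℚ-suc M))) M≤)
              (≤-trans (≤-reflexive (solve 2 (λ r x → r := x :+ (r :- x)) refl r (approx X n)))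
                (+-monoʳ-≤ (approx X n) (≤-trans (p≤∣p∣ _) (near n N≤n)))))
            , ≤-trans (≤-reflexive (solve 2 (λ r x → x := r :+ (:- (r :- x))) refl r (approx X n)))
                (≤-trans (+-mono-≤ ≤M (≤-trans (-p≤∣p∣ (r - approx X n)) (near n N≤n)))
                  (≤-reflexive (sym (natℚ-suc (2 ℕ.+ M))))))

  -- The counting bound.

  -- Origin of C = 1 / (32 (1 + c)): log X ≤ 2 + J ≤ 2 (1 + c) E ℓ ^ 2, and ℓ ≤ 4 log log log X
  -- contributes 16. The `suc` makes the number invertible also for c = 0.
  exponent-bound : ∀ {c ℓ J E l L} → J ℕ.≤ c ℕ.* (ℓ ℕ.* ℓ) ℕ.* E → 2 ℕ.≤ J → 0ℚ < l → natℚ ℓ ≤ natℚ 4 * l →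
    0ℚ ≤ L → L ≤ natℚ (2 ℕ.+ J) → ∣ recip (natℚ (32 ℕ.* suc c)) * recip (l * l) * L ∣ ≤ natℚ E
  exponent-bound {c} {ℓ} {J} {E} {l} {L} J≤ 2≤J 0<l ℓ≤4l 0≤L L≤ =
    ≤-trans (≤-reflexive (0≤p⇒∣p∣≡p (*-nonNeg (*-nonNeg (<⇒≤ 0<w) (<⇒≤ 0<r)) 0≤L)))
      (≤-trans (*-monoˡ-≤-nonNeg (w * r) {{nonNegative (*-nonNeg (<⇒≤ 0<w) (<⇒≤ 0<r))}} L≤WllE)
        (≤-reflexive cancel))
    where
    W w r e : ℚ
    W = natℚ (32 ℕ.* suc c)
    w = recip W
    r = recip (l * l)
    e = natℚ E
    0<W : 0ℚ < W
    0<W = natℚ-pos {32 ℕ.* suc c} (ℕ.s≤s ℕ.z≤n)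
    0<w : 0ℚ < w
    0<w = recip-pos 0<W
    0<ll : 0ℚ < l * l
    0<ll = *-pos 0<l 0<l
    0<r : 0ℚ < r
    0<r = recip-pos 0<ll
    cancel : w * r * (W * (l * l) * e) ≡ e
    cancel = trans (solve 5 (λ w r W s e → w :* r :* (W :* s :* e) := (W :* w) :* (s :* r) :* e) refl w r W (l * l) e)
      (trans (cong₂ (λ s t → s * t * e) (recip-inverse W (>⇒≢0 0<W)) (recip-inverse (l * l) (>⇒≢0 0<ll)))
        (trans (cong (_* e) (*-identityˡ 1ℚ)) (*-identityˡ e)))
    2+J≤ : 2 ℕ.+ J ℕ.≤ 2 ℕ.* suc c ℕ.* E ℕ.* (ℓ ℕ.* ℓ)
    2+J≤ = begin
      2 ℕ.+ J                                     ≤⟨ ℕₚ.+-mono-≤ 2≤J J≤ ⟩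
      J ℕ.+ c ℕ.* (ℓ ℕ.* ℓ) ℕ.* E                 ≤⟨ ℕₚ.+-monoˡ-≤ (c ℕ.* (ℓ ℕ.* ℓ) ℕ.* E) J≤ ⟩
      c ℕ.* (ℓ ℕ.* ℓ) ℕ.* E ℕ.+ c ℕ.* (ℓ ℕ.* ℓ) ℕ.* E
        ≤⟨ ℕₚ.m≤m+n _ (2 ℕ.* (E ℕ.* (ℓ ℕ.* ℓ))) ⟩
      c ℕ.* (ℓ ℕ.* ℓ) ℕ.* E ℕ.+ c ℕ.* (ℓ ℕ.* ℓ) ℕ.* E ℕ.+ 2 ℕ.* (E ℕ.* (ℓ ℕ.* ℓ))
        ≡⟨ eq c (ℓ ℕ.* ℓ) E ⟩
      2 ℕ.* suc c ℕ.* E ℕ.* (ℓ ℕ.* ℓ)             ∎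
      where
      open ℕₚ.≤-Reasoning
      eq : ∀ c s e → c ℕ.* s ℕ.* e ℕ.+ c ℕ.* s ℕ.* e ℕ.+ 2 ℕ.* (e ℕ.* s) ≡ 2 ℕ.* suc c ℕ.* e ℕ.* s
      eq = solveℕ
    L≤WllE : L ≤ W * (l * l) * e
    L≤WllE = ≤-trans L≤ (≤-trans (natℚ-mono 2+J≤)
      (≤-trans (≤-reflexive (trans (natℚ-* (2 ℕ.* suc c ℕ.* E) (ℓ ℕ.* ℓ)) (cong₂ _*_
          (trans (natℚ-* (2 ℕ.* suc c) E) (cong (_* e) (natℚ-* 2 (suc c)))) (natℚ-* ℓ ℓ))))
        (≤-trans (*-monoˡ-≤-nonNeg (natℚ 2 * natℚ (suc c) * e)
            {{nonNegative (*-nonNeg (*-nonNeg 0≤2 (natℚ-nonNeg (suc c))) (natℚ-nonNeg E))}}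
            (*-mono (natℚ-nonNeg ℓ) ℓ≤4l (natℚ-nonNeg ℓ) ℓ≤4l))
          (≤-reflexive (trans
            (solve 3 (λ c e l → con (natℚ 2) :* c :* e :* (con (natℚ 4) :* l :* (con (natℚ 4) :* l)) := con (natℚ 32) :* c :* (l :* l) :* e)
              refl (natℚ (suc c)) e l)
            (cong (λ t → t * (l * l) * e) (sym (natℚ-* 32 (suc c)))))))))

  module _ (a : ℤ) (many : ManyCarmichaels a) where

    private
      c ℓ₁ : ℕ
      c  = proj₁ many
      -- ℓ ≥ 12 means ℓ′ ≥ 9, which is what 3 ℓ ≤ 4 ℓ′ amounts to.
      ℓ₁ = proj₁ (proj₂ many) ℕ.⊔ 12

      C : ℝ
      C = fromℚ (recip (natℚ (32 ℕ.* suc c)))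

    0<C : 0ᴿ <ᴿ C
    0<C = positive-from C (recip-pos (natℚ-pos {32 ℕ.* suc c} (ℕ.s≤s ℕ.z≤n))) (always λ _ → ≤-refl)

    module Count (X : ℝ) (S : Scales ℓ₁ X) where

      open Scales S

      -- Each logarithm is bounded below by only ⅓ of the binary one. Lowering `j` by 2 and `ℓ` by 3
      -- makes up for this: 3 2 ^ j′ ≤ 2 ^ j, and 3 2 ^ ℓ′ ≤ 2 ^ ℓ - 2.
      ℓ′ j′ : ℕ
      ℓ′ = ℓ ℕ.∸ 3
      j′ = j ℕ.∸ 2

      12≤ℓ : 12 ℕ.≤ ℓ
      12≤ℓ = ℕₚ.≤-trans (ℕₚ.m≤n⊔m (proj₁ (proj₂ many)) 12) ℓ₁≤ℓ

      ℓ≡ : 3 ℕ.+ ℓ′ ≡ ℓ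
      ℓ≡ = ℕₚ.m+[n∸m]≡n (ℕₚ.≤-trans (ℕ.s≤s (ℕ.s≤s (ℕ.s≤s ℕ.z≤n))) 12≤ℓ)

      9≤ℓ′ : 9 ℕ.≤ ℓ′
      9≤ℓ′ = ℕₚ.+-cancelˡ-≤ 3 9 ℓ′ (subst (12 ℕ.≤_) (sym ℓ≡) 12≤ℓ)

      8*2^ℓ′≤j : 2 ℕ.^ (3 ℕ.+ ℓ′) ℕ.≤ j
      8*2^ℓ′≤j = subst (λ y → 2 ℕ.^ y ℕ.≤ j) (sym ℓ≡) 2^ℓ≤j

      j≡ : 2 ℕ.+ j′ ≡ j
      j≡ = ℕₚ.m+[n∸m]≡n (ℕₚ.≤-trans (ℕₚ.^-monoʳ-≤ 2 {1} {3 ℕ.+ ℓ′} (ℕ.s≤s ℕ.z≤n)) 8*2^ℓ′≤j)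

      3*2^j′≤J : 3 ℕ.* 2 ℕ.^ j′ ℕ.≤ J
      3*2^j′≤J = ℕₚ.≤-trans (ℕₚ.*-monoˡ-≤ (2 ℕ.^ j′) (ℕₚ.n≤1+n 3))
        (ℕₚ.≤-trans (ℕₚ.≤-reflexive (trans (sym (ℕₚ.^-distribˡ-+-* 2 2 j′)) (cong (2 ℕ.^_) j≡))) 2^j≤J)

      3*2^ℓ′≤j′ : 3 ℕ.* 2 ℕ.^ ℓ′ ℕ.≤ j′
      3*2^ℓ′≤j′ = ℕₚ.+-cancelˡ-≤ 2 (3 ℕ.* x) j′ (begin
        2 ℕ.+ 3 ℕ.* x                ≤⟨ ℕₚ.+-monoˡ-≤ (3 ℕ.* x) (ℕₚ.*-monoʳ-≤ 2 (ℕₚ.m^n>0 2 ℓ′)) ⟩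
        2 ℕ.* x ℕ.+ 3 ℕ.* x          ≤⟨ ℕₚ.m≤m+n _ (3 ℕ.* x) ⟩
        2 ℕ.* x ℕ.+ 3 ℕ.* x ℕ.+ 3 ℕ.* x  ≡⟨ eq x ⟩
        8 ℕ.* x                      ≡⟨ ℕₚ.^-distribˡ-+-* 2 3 ℓ′ ⟨
        2 ℕ.^ (3 ℕ.+ ℓ′)             ≤⟨ 8*2^ℓ′≤j ⟩
        j                            ≡⟨ j≡ ⟨
        2 ℕ.+ j′                     ∎)
        where
        open ℕₚ.≤-Reasoning
        x : ℕ
        x = 2 ℕ.^ ℓ′
        eq : ∀ x → 2 ℕ.* x ℕ.+ 3 ℕ.* x ℕ.+ 3 ℕ.* x ≡ 8 ℕ.* x
        eq = solveℕ

      p₀ : 0ᴿ <ᴿ X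
      p₀ = positive-from X (<-≤-trans 0<1 (1≤2^ J)) lower

      L₁ : ℝ
      L₁ = log X p₀

      L₁≥ : Eventually (λ n → natℚ (2 ℕ.^ j′) ≤ approx L₁ n)
      L₁≥ = ev-map (λ n → ≤-trans (third {2 ℕ.^ j′} {J} 3*2^j′≤J)) (log-≥ X p₀ J lower)

      L₁≤ : Eventually (λ n → ∣ approx L₁ n ∣ ≤ natℚ (2 ℕ.+ J))
      L₁≤ = log-∣∣≤ X p₀ (2 ℕ.+ J) upper (ev-map (λ n J≤X → ≤-trans (≤-reflexive (sym (*-identityˡ 1ℚ)))
        (*-mono 0≤1 (≤-trans (1≤2^ J) J≤X) 0≤1 (1≤2^ (2 ℕ.+ J)))) lower)

      p₁ : 0ᴿ <ᴿ L₁
      p₁ = positive-from L₁ (<-≤-trans 0<1 (1≤2^ j′)) L₁≥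

      L₂ : ℝ
      L₂ = log L₁ p₁

      L₂≥ : Eventually (λ n → natℚ (2 ℕ.^ ℓ′) ≤ approx L₂ n)
      L₂≥ = ev-map (λ n → ≤-trans (third {2 ℕ.^ ℓ′} {j′} 3*2^ℓ′≤j′)) (log-≥ L₁ p₁ j′ L₁≥)

      p₂ : 0ᴿ <ᴿ L₂
      p₂ = positive-from L₂ (<-≤-trans 0<1 (1≤2^ ℓ′)) L₂≥

      L₃ : ℝ
      L₃ = log L₂ p₂

      L₃≥ : Eventually (λ n → natℚ ℓ′ * ⅓ ≤ approx L₃ n)
      L₃≥ = log-≥ L₂ p₂ ℓ′ L₂≥

      L₃≥1 : Eventually (λ n → 1ℚ ≤ approx L₃ n)
      L₃≥1 = ev-map (λ n → ≤-trans (third {1} {ℓ′} (ℕₚ.≤-trans (ℕ.s≤s (ℕ.s≤s (ℕ.s≤s ℕ.z≤n))) 9≤ℓ′))) L₃≥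

      p₃ : 0ᴿ <ᴿ L₃
      p₃ = positive-from L₃ 0<1 L₃≥1

      ℓ≤4L₃ : Eventually (λ n → natℚ ℓ ≤ natℚ 4 * approx L₃ n)
      ℓ≤4L₃ = ev-map (λ n L₃≥ → ≤-trans (third {ℓ} {4 ℕ.* ℓ′} 3ℓ≤4ℓ′)
        (≤-trans (≤-reflexive (trans (cong (_* ⅓) (natℚ-* 4 ℓ′)) (*-assoc (natℚ 4) (natℚ ℓ′) ⅓)))
          (*-monoˡ-≤-nonNeg (natℚ 4) L₃≥))) L₃≥
        where
        eq : ∀ x → 9 ℕ.+ 3 ℕ.* x ≡ 3 ℕ.* (3 ℕ.+ x)
        eq = solveℕ
        eq′ : ∀ x → x ℕ.+ 3 ℕ.* x ≡ 4 ℕ.* x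
        eq′ = solveℕ
        3ℓ≤4ℓ′ : 3 ℕ.* ℓ ℕ.≤ 4 ℕ.* ℓ′
        3ℓ≤4ℓ′ = ℕₚ.≤-trans (ℕₚ.≤-reflexive (trans (cong (3 ℕ.*_) (sym ℓ≡)) (sym (eq ℓ′))))
          (ℕₚ.≤-trans (ℕₚ.+-monoˡ-≤ (3 ℕ.* ℓ′) 9≤ℓ′) (ℕₚ.≤-reflexive (eq′ ℓ′)))

      2≤J : 2 ℕ.≤ J
      2≤J = ℕₚ.≤-trans (ℕₚ.≤-trans (ℕₚ.n≤1+n 2) (ℕₚ.*-monoʳ-≤ 3 (ℕₚ.m^n>0 2 j′))) 3*2^j′≤J

      Y : ℝ
      Y = 1ᴿ *ᴿ rpow X p₀ (C ÷ᴿ (L₃ *ᴿ L₃) [ 0<*ᴿ L₃ L₃ p₃ p₃ ])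

      -- The power is exp of C log X / (log log log X) ^ 2, whose argument `exponent-bound` keeps
      -- below E.
      Y≤ : ∀ E → J ℕ.≤ c ℕ.* (ℓ ℕ.* ℓ) ℕ.* E → Eventually (λ n → approx Y n ≤ natℚ (4 ℕ.^ E))
      Y≤ E J≤ = ev-map (λ n ≤4^E → ≤-trans (≤-reflexive (*-identityˡ _)) (≤-trans (p≤∣p∣ _) ≤4^E))
        (exp-∣∣≤ (C ÷ᴿ (L₃ *ᴿ L₃) [ 0<*ᴿ L₃ L₃ p₃ p₃ ] *ᴿ L₁) E
          (ev-map₂ (λ n (1≤L₃ , ℓ≤) (≥L₁ , L₁≤) → exponent-bound {c} {ℓ} {J} {E} J≤ 2≤J (<-≤-trans 0<1 1≤L₃) ℓ≤
              (≤-trans (natℚ-nonNeg (2 ℕ.^ j′)) ≥L₁) (≤-trans (p≤∣p∣ _) L₁≤))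
            (ev-map₂ (λ _ → _,_) L₃≥1 ℓ≤4L₃) (ev-map₂ (λ _ → _,_) L₁≥ L₁≤)))

      count : CountUpTo≥ (IsCarmichael a) X Y
      count = from (proj₂ (proj₂ many) ℓ (ℕₚ.≤-trans (ℕₚ.m≤m⊔n (proj₁ (proj₂ many)) 12) ℓ₁≤ℓ) J
          (ℕₚ.≤-trans (ℕₚ.^-monoʳ-≤ 2 2^ℓ≤j) 2^j≤J) J<)
        where
        from : (∃₂ λ ns E → Unique ns × All (λ n → IsCarmichael a n × n ℕ.≤ 2 ℕ.^ J × ℓ ℕ.< n) ns ×
            J ℕ.≤ c ℕ.* (ℓ ℕ.* ℓ) ℕ.* E × 4 ℕ.^ E ℕ.≤ length ns) → CountUpTo≥ (IsCarmichael a) X Y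
        from (ns , E , unique , good , J≤ , enough) = ns , unique
          , All.map (λ (carm , n≤ , _) → carm , λ ε 0<ε →
              ev-map (λ n J≤X → ≤-trans (≤-trans (natℚ-mono n≤) J≤X) (0≤a⇒b≤b+a (<⇒≤ 0<ε) _)) lower) good
          , λ ε 0<ε → ev-map (λ n Y≤ → ≤-trans (≤-trans Y≤ (natℚ-mono enough)) (0≤a⇒b≤b+a (<⇒≤ 0<ε) _)) (Y≤ E J≤)

    counting : ∃[ C ] ∃[ c₀ ] 0ᴿ <ᴿ C × 0ᴿ <ᴿ c₀ ×
        (∃[ X₀ ] ∀ (X : ℝ) → X₀ ≤ᴿ X →
          Σ[ p₀ ∈ 0ᴿ <ᴿ X ]
          Σ[ p₁ ∈ 0ᴿ <ᴿ log X p₀ ]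
          Σ[ p₂ ∈ 0ᴿ <ᴿ log (log X p₀) p₁ ]
          Σ[ p₃ ∈ 0ᴿ <ᴿ log (log (log X p₀) p₁) p₂ ]
            (let logloglogX = log (log (log X p₀) p₁) p₂ in
             CountUpTo≥ (IsCarmichael a) X
               (c₀ *ᴿ rpow X p₀
                 (C ÷ᴿ (logloglogX *ᴿ logloglogX) [ 0<*ᴿ logloglogX logloglogX p₃ p₃ ]))))
    counting = C , 1ᴿ , 0<C , positive-from 1ᴿ 0<1 (always λ _ → ≤-refl) , fromℕ (threshold ℓ₁) , λ X large →
      let module M = Count X (scales ℓ₁ X large) in M.p₀ , M.p₁ , M.p₂ , M.p₃ , M.count

open import Defs
open import Data.Integer.Base using (ℤ)
open import Data.Nat.Base using (ℕ; _<_)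
open import Data.Product.Base using (Σ-syntax; ∃-syntax; _×_; _,_)
open Arithmetic using (ManyCarmichaels)
open Analysis using (small-primes; carmichael-many; infinitely-many; counting)

theorem1 : (∃[ A ] ∃[ B ] 0ᴿ <ᴿ A × 0ᴿ <ᴿ B × LeastPrimeBound A B) →
    (∀ (a : ℤ) (k : ℕ) → ∃[ n ] k < n × IsCarmichael a n) ×
    (∀ (a : ℤ) → ∃[ C ] ∃[ c₀ ] 0ᴿ <ᴿ C × 0ᴿ <ᴿ c₀ ×
    (∃[ X₀ ] ∀ (X : ℝ) → X₀ ≤ᴿ X →
    Σ[ p₀ ∈ 0ᴿ <ᴿ X ]
    Σ[ p₁ ∈ 0ᴿ <ᴿ log X p₀ ]
    Σ[ p₂ ∈ 0ᴿ <ᴿ log (log X p₀) p₁ ]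
    Σ[ p₃ ∈ 0ᴿ <ᴿ log (log (log X p₀) p₁) p₂ ]
    (let logloglogX = log (log (log X p₀) p₁) p₂ in
    CountUpTo≥ (IsCarmichael a) X
    (c₀ *ᴿ rpow X p₀
    (C ÷ᴿ (logloglogX *ᴿ logloglogX) [ 0<*ᴿ logloglogX logloglogX p₃ p₃ ])))))
theorem1 (A , B , _ , _ , least) = (λ a → infinitely-many a (many a)) , (λ a → counting a (many a))
  where
  many : ∀ a → ManyCarmichaels a
  many = carmichael-many (small-primes {A} {B} least)
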